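{- Let $n\geqslant 6$ and let $i<j<n$ be positive integers with $1\notin\{i,j\}$. Then the set $S_{\{i,j\}_{n}^{1}}$ is Laplacian realizable if and only if $j=n-1$ and one of the following holds: (i) $n\equiv 0 \pmod 4$ and $i=2k$ for some $k\in\{1,2,\ldots,\frac{n-2}{2}\}$; (ii) $n\equiv 1 \pmod 4$ and $i=2k$ for some $k\in\{1,2,\ldots,\frac{n-3}{2}\}$; (iii) $n\equiv 2 \pmod 4$ and $i=2k+1$ for some $k\in\{1,2,\ldots,\frac{n-4}{2}\}$; (iv) $n\equiv 3 \pmod 4$ and $i=2k+1$ for some $k\in\{1,2,\ldots,\frac{n-3}{2}\}$.
   Context: For a simple graph $G$, its Laplacian spectrum is the multiset of eigenvalues of $L(G)=D-A$ ($D$ the degree diagonal matrix, $A$ the adjacency matrix). For integers $0<i<j\leqslant n$ and $m\in\{1,\dots,n\}\setminus\{i,j\}$, $S_{\{i,j\}_{n}^{m}}$ denotes the multiset $\{0,1,\ldots,m-1,m,m,m+1,\ldots,n\}\setminus\{i,j\}$ (all integers $0,\dots,n$ each once, except $m$ appearing twice, with $i$ and $j$ removed). A multiset $S$ is called Laplacian realizable if there is a simple connected graph whose Laplacian spectrum (with multiplicities) equals $S$. -}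

module Defs where

open import Data.Bool using (Bool; true; false; if_then_else_; not; _∧_)
open import Data.Nat as ℕ using (ℕ; zero; suc; _≡ᵇ_)
open import Data.Fin using (Fin; zero; suc; punchIn; _≟_)
open import Data.Integer as ℤ using (ℤ; +_; -_; _-_)
open import Data.List using (List; []; _∷_; filterᵇ; upTo; foldr; map)
open import Data.Product using (Σ; ∃-syntax; _×_)
open import Relation.Nullary using (does)
open import Relation.Binary.PropositionalEquality using (_≡_)

sumFin : (n : ℕ) → (Fin n → ℤ) → ℤ
sumFin zero    f = + 0
sumFin (suc n) f = f zero ℤ.+ sumFin n (λ k → f (suc k))

det : (n : ℕ) → (Fin n → Fin n → ℤ) → ℤ
det zero    M = + 1
det (suc n) M = sumFin (suc n) (λ c → sign c ℤ.* (M zero c ℤ.* det n (λ r c' → M (suc r) (punchIn c c'))))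
  where
  sign : {m : ℕ} → Fin m → ℤ
  sign zero          = + 1
  sign (suc zero)    = - (+ 1)
  sign (suc (suc k)) = sign k

record SimpleGraph (n : ℕ) : Set where
  field
    adj   : Fin n → Fin n → Bool
    symm  : ∀ u v → adj u v ≡ adj v u
    irrefl : ∀ v → adj v v ≡ false
open SimpleGraph public

data Reach {n : ℕ} (G : SimpleGraph n) (u : Fin n) : Fin n → Set where
  here : Reach G u u
  step : ∀ {v w} → Reach G u v → adj G v w ≡ true → Reach G u w

Connected : {n : ℕ} → SimpleGraph n → Set
Connected G = ∀ u v → Reach G u v

degree : {n : ℕ} → SimpleGraph n → Fin n → ℤ
degree {n} G u = sumFin n (λ w → if adj G u w then + 1 else + 0)

laplacian : {n : ℕ} → SimpleGraph n → Fin n → Fin n → ℤ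
laplacian G u v =
  if does (u ≟ v) then degree G u else (if adj G u v then - (+ 1) else + 0)

charPolyL : {n : ℕ} → SimpleGraph n → ℤ → ℤ
charPolyL {n} G x = det n (λ u v → (if does (u ≟ v) then x else + 0) - laplacian G u v)

prodRoots : List ℕ → ℤ → ℤ
prodRoots S x = foldr (λ s acc → (x - + s) ℤ.* acc) (+ 1) S

-- The Laplacian spectrum of G equals the multiset S (with multiplicities):
-- the characteristic polynomial of L(G) is ∏_{s∈S}(x - s)  (as polynomials,
-- equivalently as functions on ℤ).
HasLaplacianSpectrum : {n : ℕ} → SimpleGraph n → List ℕ → Set
HasLaplacianSpectrum G S = ∀ x → charPolyL G x ≡ prodRoots S x

LaplacianRealizable : List ℕ → Set
LaplacianRealizable S = ∃[ n ] Σ (SimpleGraph n) (λ G → Connected G × HasLaplacianSpectrum G S)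

Sset : (n m i j : ℕ) → List ℕ
Sset n m i j = m ∷ filterᵇ (λ k → not (k ≡ᵇ i) ∧ not (k ≡ᵇ j)) (upTo (suc n))

{-# OPTIONS --safe #-}
-- Everything is read off from determinants; no eigenvector is used.
--
-- Necessity.  Let H be the complement of a realization G.  Since n is an eigenvalue
-- of G, 0 is a double root of the characteristic polynomial of H, so H is
-- disconnected; since 1 is an eigenvalue of G, n - 1 is one of H, and an eigenvalue
-- is bounded by the order of some component, so H = K₁ ∪ H′.  As 1 is a double
-- eigenvalue of G, the complement of H′ is disconnected too.  If j ≠ n - 1, then
-- n - 1 is an eigenvalue of G, the complement of H′ is K₁ ∪ Γ′ by the same argument,
-- and Γ′ is disconnected with an eigenvalue equal to its order: a contradiction.  The
-- parity conditions express that the trace of the Laplacian is even.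
--
-- Sufficiency.  Following Fallat, Kirkland, Molitierno and Neumann, the spectra
-- {0, …, n} \ {i} with i < n and an even sum are realized recursively by cones over
-- disjoint unions with K₁ or K₂ and by complements; cones over K₁ ∪ K₁ ∪ G and
-- K₁ ∪ K₂ ∪ G then realize the required spectra.
module Submission where

open import Defs hiding (det; sumFin)
import Defs
open import Data.Product using (_×_; ∃-syntax)
open import Data.Sum using (_⊎_)
open import Function.Bundles using (_⇔_)
open import Relation.Binary.PropositionalEquality using (_≡_; _≢_)

-- A spectrum is given as an identity between functions on ℤ, so eigenvalues enter only as integer
-- zeros of a determinant. Two tools carry the graph theory. A weakly diagonally dominant matrix
-- with nonpositive off-diagonal entries has positive determinant unless some set of its rows sums
-- to zero row by row and has no entries outside the set; for a Laplacian such a set is a union of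
-- components. And multiplicativity of the determinant turns complementation, relabelling and the
-- removal of the trivial factor into products with explicit matrices.
--
-- The other obstacle is multiplicity: cancelling `x - a` from an identity of functions says nothing
-- at `a` itself. Integrality closes this gap, since a polynomial `f` satisfies `f y ≡ f a` modulo
-- `y - a`. Spectra are therefore kept as relations `c x * χ G x ≡ r x`, with the removed
-- eigenvalues in `c`, and each graph operation transforms such a relation.
--
-- The order of a realization is not prescribed either: comparing the two leading coefficients
-- yields it together with the trace.

module LaplacianSpectra where

  open import Data.Bool using (Bool; true; false; if_then_else_; not; _∧_; T)
  import Data.Bool as Bool
  open import Data.Empty using (⊥; ⊥-elim)
  open import Data.Fin using (Fin; zero; suc; punchIn; _≟_)
  open import Data.Fin.Properties using (any?; punchInᵢ≢i; punchIn-injective)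
  open import Data.Integer as ℤ using (ℤ; +_; _≤_; _<_; _≤?_)
  import Data.Integer.Properties as ℤ
  open import Data.Integer.Tactic.RingSolver using (solve-∀)
  open import Data.List using ([]; upTo; filterᵇ; _∷ʳ_) renaming (_∷_ to _∷ᴸ_)
  open import Data.List.Properties using (upTo-∷ʳ)
  open import Data.Nat as ℕ using (ℕ; zero; suc; z≤n; s≤s)
  import Data.Nat.Divisibility as ℕ
  import Data.Nat.DivMod as ℕ
  import Data.Nat.Properties as ℕ
  open import Data.Nat.Tactic.RingSolver renaming (solve-∀ to ℕ-solve-∀)
  open import Data.Product using (Σ; _,_; proj₁; proj₂)
  open import Data.Sum using (inj₁; inj₂)
  open import Data.Unit using (⊤; tt)
  open import Function using (_∘_; mk⇔; Equivalence)
  open import Relation.Binary.Definitions using (tri<; tri≈; tri>)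
  open import Relation.Binary.PropositionalEquality using (refl; sym; trans; cong; cong₂; subst; subst₂; module ≡-Reasoning)
  open import Relation.Nullary using (¬_; does; yes; no; Dec; ¬?; _×-dec_; contradiction)
  open import Relation.Nullary.Decidable using (dec-true; dec-false)
  open Equivalence using (to; from)
  open ≡-Reasoning

  -- Finite sums and the Kronecker delta

  Vector : ℕ → Set
  Vector m = Fin m → ℤ

  Matrix : ℕ → Set
  Matrix n = Fin n → Vector n

  minor : ∀ {n} → Matrix (suc n) → Fin (suc n) → Matrix n
  minor M c r c' = M (suc r) (punchIn c c')

  Defs-sum-cong : ∀ n {f g : Fin n → ℤ} → (∀ k → f k ≡ g k) → Defs.sumFin n f ≡ Defs.sumFin n g
  Defs-sum-cong zero h = refl
  Defs-sum-cong (suc n) h = cong₂ ℤ._+_ (h zero) (Defs-sum-cong n (h ∘ suc))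

  infixl 6 _+_ _-_
  infixl 7 _*_
  infix 8 -_

  -- Integer arithmetic, sums and determinants compute too eagerly for unification
  -- to see through them, hence the opaque copies.
  opaque
    _+_ _-_ _*_ : ℤ → ℤ → ℤ
    _+_ = ℤ._+_
    _-_ = ℤ._-_
    _*_ = ℤ._*_
    -_ : ℤ → ℤ
    -_ = ℤ.-_
    sumFin : ∀ n → (Fin n → ℤ) → ℤ
    sumFin = Defs.sumFin
    det : ∀ n → Matrix n → ℤ
    det = Defs.det

  opaque
    unfolding _+_

    +-identityˡ : ∀ x → + 0 + x ≡ x
    +-identityˡ = ℤ.+-identityˡ
    +-identityʳ : ∀ x → x + + 0 ≡ x
    +-identityʳ = ℤ.+-identityʳ
    *-identityˡ : ∀ x → + 1 * x ≡ x
    *-identityˡ = ℤ.*-identityˡ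
    *-identityʳ : ∀ x → x * + 1 ≡ x
    *-identityʳ = ℤ.*-identityʳ
    *-zeroˡ : ∀ x → + 0 * x ≡ + 0
    *-zeroˡ = ℤ.*-zeroˡ
    *-zeroʳ : ∀ x → x * + 0 ≡ + 0
    *-zeroʳ = ℤ.*-zeroʳ
    *-comm : ∀ x y → x * y ≡ y * x
    *-comm = ℤ.*-comm
    *-assoc : ∀ x y z → (x * y) * z ≡ x * (y * z)
    *-assoc = ℤ.*-assoc
    *-distribˡ-+ : ∀ x y z → x * (y + z) ≡ x * y + x * z
    *-distribˡ-+ = ℤ.*-distribˡ-+
    -0≡0 : - (+ 0) ≡ + 0
    -0≡0 = refl
    sum-nil : ∀ f → sumFin 0 f ≡ + 0
    sum-nil f = refl
    sum-suc : ∀ n f → sumFin (suc n) f ≡ f zero + sumFin n (f ∘ suc)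
    sum-suc n f = refl
    det-nil : ∀ M → det 0 M ≡ + 1
    det-nil M = refl

  opaque
    unfolding _+_

    sum-cong : ∀ n {f g : Fin n → ℤ} → (∀ k → f k ≡ g k) → sumFin n f ≡ sumFin n g
    sum-cong = Defs-sum-cong

    sum-linear : ∀ n p q (f g : Fin n → ℤ) →
      sumFin n (λ k → p * f k + q * g k) ≡ p * sumFin n f + q * sumFin n g
    sum-linear zero p q f g = zeros p q
      where
      zeros : ∀ p q → + 0 ≡ p * + 0 + q * + 0
      zeros = solve-∀
    sum-linear (suc n) p q f g =
      trans (cong (_+_ (p * f zero + q * g zero)) (sum-linear n p q (f ∘ suc) (g ∘ suc)))
            (regroup p q (f zero) (g zero) _ _)
      where
      regroup : ∀ p q a b x y → p * a + q * b + (p * x + q * y) ≡ p * (a + x) + q * (b + y)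
      regroup = solve-∀

    sum-zero : ∀ n {f : Fin n → ℤ} → (∀ k → f k ≡ + 0) → sumFin n f ≡ + 0
    sum-zero zero h = refl
    sum-zero (suc n) h = cong₂ _+_ (h zero) (sum-zero n (h ∘ suc))

    sum-*ˡ : ∀ n p (f : Fin n → ℤ) → sumFin n (λ k → p * f k) ≡ p * sumFin n f
    sum-*ˡ zero p f = sym (*-zeroʳ p)
    sum-*ˡ (suc n) p f = trans (cong (_+_ (p * f zero)) (sum-*ˡ n p (f ∘ suc))) (sym (*-distribˡ-+ p (f zero) _))

    sum-+ : ∀ n (f g : Fin n → ℤ) → sumFin n (λ k → f k + g k) ≡ sumFin n f + sumFin n g
    sum-+ zero f g = refl
    sum-+ (suc n) f g = trans (cong (_+_ (f zero + g zero)) (sum-+ n (f ∘ suc) (g ∘ suc))) (regroup (f zero) (g zero) _ _)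
      where
      regroup : ∀ a b x y → a + b + (x + y) ≡ a + x + (b + y)
      regroup = solve-∀

    sum-swap : ∀ n m (f : Fin n → Fin m → ℤ) →
      sumFin n (λ i → sumFin m (f i)) ≡ sumFin m (λ j → sumFin n (λ i → f i j))
    sum-swap zero m f = sym (sum-zero m (λ _ → refl))
    sum-swap (suc n) m f =
      trans (cong (_+_ (sumFin m (f zero))) (sum-swap n m (f ∘ suc)))
            (sym (sum-+ m (f zero) _))

  -- Recursive rather than defined through `_≟_`: deleting the first row and column of an identity
  -- matrix then leaves an identity matrix by computation.
  δ : ∀ {n} → Fin n → Fin n → ℤ
  δ zero zero = + 1
  δ zero (suc j) = + 0
  δ (suc i) zero = + 0
  δ (suc i) (suc j) = δ i j

  δ-refl : ∀ {n} (i : Fin n) → δ i i ≡ + 1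
  δ-refl zero = refl
  δ-refl (suc i) = δ-refl i

  δ-≢ : ∀ {n} {i j : Fin n} → i ≢ j → δ i j ≡ + 0
  δ-≢ {i = zero} {zero} ne = ⊥-elim (ne refl)
  δ-≢ {i = zero} {suc j} ne = refl
  δ-≢ {i = suc i} {zero} ne = refl
  δ-≢ {i = suc i} {suc j} ne = δ-≢ (ne ∘ cong suc)

  δ-sym : ∀ {n} (i j : Fin n) → δ i j ≡ δ j i
  δ-sym zero zero = refl
  δ-sym zero (suc j) = refl
  δ-sym (suc i) zero = refl
  δ-sym (suc i) (suc j) = δ-sym i j

  sum-δ : ∀ {n} (i : Fin n) (f : Fin n → ℤ) → sumFin n (λ k → δ i k * f k) ≡ f i
  sum-δ {suc n} zero f = trans (sum-suc n _) (trans (cong₂ _+_ (*-identityˡ (f zero)) (sum-zero n (λ k → *-zeroˡ (f (suc k))))) (+-identityʳ (f zero)))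
  sum-δ {suc n} (suc i) f = trans (sum-suc n _) (trans (cong₂ _+_ (*-zeroˡ (f zero)) (sum-δ i (f ∘ suc))) (+-identityˡ _))

  sum-δʳ : ∀ {n} (j : Fin n) (f : Fin n → ℤ) → sumFin n (λ k → f k * δ k j) ≡ f j
  sum-δʳ {n} j f = trans (sum-cong n (λ k → trans (*-comm (f k) _) (cong (_* f k) (δ-sym k j)))) (sum-δ j f)

  -- Expansion of the determinant along the first row

  sgn : ∀ {n} → Fin n → ℤ
  sgn zero = + 1
  sgn (suc zero) = ℤ.- (+ 1)
  sgn (suc (suc k)) = sgn k

  opaque
    unfolding _+_

    sgn-suc : ∀ {n} (k : Fin n) → sgn (suc k) ≡ - sgn k
    sgn-suc zero = refl
    sgn-suc (suc zero) = refl
    sgn-suc (suc (suc k)) = sgn-suc k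

  -- The sign function of `det` is local to its definition and cannot be named.
  -- Below, the omitted left-hand sides are inferred by unification; the wrapper
  -- keeps `suc n` out of the type of the matrix, so that the dimension at which
  -- the sign is taken can be generalised independently of `n`.
  private
    record Wrapped (n : ℕ) : Set where
      constructor wrap
      field entry : Matrix (suc n)
    open Wrapped

    mutual
      det-expand : ∀ n (B : Wrapped n) → let M = entry B in
        Defs.det (suc n) M ≡ Defs.sumFin (suc n) (λ c → sgn c ℤ.* (M zero c ℤ.* Defs.det n (minor M c)))
      det-expand n B = cong (ℤ._+_ ((+ 1) ℤ.* (entry B zero zero ℤ.* Defs.det n (minor (entry B) zero))))
                            (Defs-sum-cong n (expansion-term n B))

      expansion-term : ∀ n (B : Wrapped n) (k : Fin n) →
        _ ≡ sgn (suc k) ℤ.* (entry B zero (suc k) ℤ.* Defs.det n (minor (entry B) (suc k)))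
      expansion-term n B k with entry B zero (suc k) ℤ.* Defs.det n (minor (entry B) (suc k))
      ... | w = signs-agree-suc n B k w

      signs-agree-suc : ∀ n (B : Wrapped n) (k : Fin n) w → _ ≡ sgn (suc k) ℤ.* w
      signs-agree-suc n B k w with suc n | suc k
      ... | m | c = signs-agree n B m c w

      signs-agree : ∀ n (B : Wrapped n) m (c : Fin m) w → _ ≡ sgn c ℤ.* w
      signs-agree n B _ zero w = refl
      signs-agree n B _ (suc zero) w = refl
      signs-agree n B _ (suc (suc k)) w = signs-agree n B _ k w

  opaque
    unfolding _+_

    det-suc : ∀ n (M : Matrix (suc n)) →
      det (suc n) M ≡ sumFin (suc n) (λ c → sgn c * (M zero c * det n (minor M c)))
    det-suc n M = det-expand n (wrap M)

  det-cong : ∀ n {M N : Matrix n} → (∀ r c → M r c ≡ N r c) → det n M ≡ det n N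
  det-cong zero h = trans (det-nil _) (sym (det-nil _))
  det-cong (suc n) {M} {N} h = begin
    det (suc n) M ≡⟨ det-suc n M ⟩
    _ ≡⟨ sum-cong (suc n) (λ c → cong (sgn c *_) (cong₂ _*_ (h zero c) (det-cong n (λ r c' → h (suc r) (punchIn c c'))))) ⟩
    _ ≡⟨ det-suc n N ⟨
    det (suc n) N ∎

  -- Alternating multilinear forms and the uniqueness of the determinant

  infixr 5 _∷_
  _∷_ : ∀ {A : Set} {n} → A → (Fin n → A) → Fin (suc n) → A
  (a ∷ R) zero = a
  (a ∷ R) (suc r) = R r

  -- Rectangular, because fixing some leading rows of a square matrix leaves fewer rows of the same
  -- length.
  Rows : ℕ → ℕ → Set
  Rows n m = Fin n → Vector m

  _≈_ : ∀ {n m} → Rows n m → Rows n m → Set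
  M ≈ N = ∀ r c → M r c ≡ N r c

  lin : ∀ {m} → ℤ → ℤ → Vector m → Vector m → Vector m
  lin p q a b c = p * a c + q * b c

  -- Matrices are functions and extensionality is not assumed, so invariance under pointwise
  -- equality is carried as a property.
  Congruent : ∀ {n m} → (Rows n m → ℤ) → Set
  Congruent D = ∀ {M N} → M ≈ N → D M ≡ D N

  AlternatingHead : ∀ {n m} → (Rows (suc n) m → ℤ) → Set
  AlternatingHead {zero} D = ⊤
  AlternatingHead {suc n} D = ∀ a R → D (a ∷ a ∷ R) ≡ + 0

  -- Multilinearity and alternation are stated for the head rows only and passed on by fixing the
  -- rows one after another. Alternation is thus demanded for adjacent rows; `form-alternating`
  -- recovers it for the first row and any later one.
  data Form {m : ℕ} : (n : ℕ) → (Rows n m → ℤ) → Set where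
    nil : ∀ {D} → Congruent D → Form 0 D
    cons : ∀ {n D} → Congruent D →
      (∀ p q a b R → D (lin p q a b ∷ R) ≡ p * D (a ∷ R) + q * D (b ∷ R)) →
      AlternatingHead D →
      (∀ a → Form n (λ R → D (a ∷ R))) →
      Form (suc n) D

  form-cong : ∀ {n m D} → Form {m} n D → Congruent D
  form-cong (nil c) = c
  form-cong (cons c _ _ _) = c

  ∷-cong : ∀ {n m} {a b : Vector m} {R S : Rows n m} → (∀ c → a c ≡ b c) → R ≈ S → (a ∷ R) ≈ (b ∷ S)
  ∷-cong h k zero = h
  ∷-cong h k (suc r) = k r

  ∷-η : ∀ {n m} (M : Rows (suc n) m) → M ≈ (M zero ∷ (M ∘ suc))
  ∷-η M zero c = refl
  ∷-η M (suc r) c = refl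

  form-resp : ∀ {n m} {D E : Rows n m → ℤ} → (∀ R → D R ≡ E R) → Form n D → Form n E
  form-resp h (nil c) = nil (λ {M} {N} e → trans (sym (h M)) (trans (c e) (h N)))
  form-resp {suc n} {m} {D} {E} h (cons c l alt t) =
    cons (λ {M} {N} e → trans (sym (h M)) (trans (c e) (h N)))
         (λ p q a b R → trans (sym (h _)) (trans (l p q a b R) (cong₂ (λ x y → p * x + q * y) (h _) (h _))))
         (alt' {n} {D} {E} {h} alt)
         (λ a → form-resp (λ R → h (a ∷ R)) (t a))
    where
    alt' : ∀ {n} {D E : Rows (suc n) m → ℤ} {h : ∀ R → D R ≡ E R} → AlternatingHead D → AlternatingHead E
    alt' {zero} x = tt
    alt' {suc n} {h = h} x a R = trans (sym (h _)) (x a R)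

  form-zero : ∀ n {m} → Form {m} n (λ _ → + 0)
  form-zero zero = nil (λ _ → refl)
  form-zero (suc n) {m} = cons (λ _ → refl) (λ p q _ _ _ → zeros p q) (alt n) (λ _ → form-zero n)
    where
    opaque
      unfolding _+_
      zeros : ∀ p q → + 0 ≡ p * + 0 + q * + 0
      zeros = solve-∀
    alt : ∀ n → AlternatingHead {n} {m} (λ _ → + 0)
    alt zero = tt
    alt (suc n) _ _ = refl

  form-lin : ∀ {n m} p q {D E : Rows n m → ℤ} → Form n D → Form n E → Form n (λ R → p * D R + q * E R)
  form-lin p q (nil c) (nil c') = nil (λ e → cong₂ (λ x y → p * x + q * y) (c e) (c' e))
  form-lin {suc n} {m} p q {D} {E} (cons c l a t) (cons c' l' a' t') =
    cons (λ e → cong₂ (λ x y → p * x + q * y) (c e) (c' e))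
         (λ r s u v R → trans (cong₂ (λ x y → p * x + q * y) (l r s u v R) (l' r s u v R)) (regroup p q r s _ _ _ _))
         (alt n a a')
         (λ u → form-lin p q (t u) (t' u))
    where
    opaque
      unfolding _+_
      regroup : ∀ p q r s w x y z → p * (r * w + s * x) + q * (r * y + s * z) ≡ r * (p * w + q * y) + s * (p * x + q * z)
      regroup = solve-∀
      zeros : ∀ p q → p * + 0 + q * + 0 ≡ + 0
      zeros = solve-∀
    alt : ∀ n {D E : Rows (suc n) m → ℤ} → AlternatingHead D → AlternatingHead E → AlternatingHead (λ R → p * D R + q * E R)
    alt zero _ _ = tt
    alt (suc n) x y u R = trans (cong₂ (λ x y → p * x + q * y) (x u R) (y u R)) (zeros p q)

  form-sum : ∀ {n m} k (s : Fin k → ℤ) (D : Fin k → Rows n m → ℤ) → (∀ i → Form n (D i)) →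
    Form n (λ R → sumFin k (λ i → s i * D i R))
  form-sum {n} zero s D f = form-resp (λ R → sym (sum-nil _)) (form-zero n)
  form-sum (suc k) s D f =
    form-resp (λ R → trans (cong (_+_ (s zero * D zero R)) (*-identityˡ _)) (sym (sum-suc k _)))
              (form-lin (s zero) (+ 1) (f zero) (form-sum k (s ∘ suc) (D ∘ suc) (f ∘ suc)))

  record Linear {m k : ℕ} (φ : Vector m → Vector k) : Set where
    field
      φ-cong : ∀ {a b} → (∀ c → a c ≡ b c) → ∀ c → φ a c ≡ φ b c
      φ-lin  : ∀ p q a b c → φ (lin p q a b) c ≡ lin p q (φ a) (φ b) c
  open Linear

  -- Used with three row maps: deleting a column makes minors into forms, inserting a zero column
  -- drives the induction of `form-unique`, and multiplication by a fixed matrix gives `det-·`.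
  form-∘ : ∀ {n m k} {φ : Vector m → Vector k} {D : Rows n k → ℤ} → Linear φ → Form n D → Form n (λ R → D (φ ∘ R))
  form-∘ L (nil c) = nil (λ e → c (λ r → φ-cong L (e r)))
  form-∘ {suc n} {m} {k} {φ} {D} L (cons c l a t) =
    cons (λ e → c (λ r → φ-cong L (e r)))
         (λ p q u v R → begin
            D (φ ∘ (lin p q u v ∷ R)) ≡⟨ c (split (lin p q u v) R) ⟩
            D (φ (lin p q u v) ∷ (φ ∘ R)) ≡⟨ c (∷-cong (φ-lin L p q u v) (λ _ _ → refl)) ⟩
            D (lin p q (φ u) (φ v) ∷ (φ ∘ R)) ≡⟨ l p q (φ u) (φ v) (φ ∘ R) ⟩
            p * D (φ u ∷ (φ ∘ R)) + q * D (φ v ∷ (φ ∘ R)) ≡⟨ cong₂ (λ x y → p * x + q * y) (c (split u R)) (c (split v R)) ⟨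
            _ ∎)
         (alt n c a)
         (λ u → form-resp (λ R → sym (c (split u R))) (form-∘ L (t (φ u))))
    where
    split : ∀ {n} u (R : Rows n m) → (φ ∘ (u ∷ R)) ≈ (φ u ∷ (φ ∘ R))
    split u R zero _ = refl
    split u R (suc r) _ = refl
    alt : ∀ n {D : Rows (suc n) k → ℤ} → Congruent D → AlternatingHead D → AlternatingHead (λ R → D (φ ∘ R))
    alt zero _ _ = tt
    alt (suc n) c x u R = trans (c λ { zero _ → refl ; (suc zero) _ → refl ; (suc (suc r)) _ → refl }) (x (φ u) (φ ∘ R))

  -- Antisymmetrised sums over ordered pairs of distinct indices, the pair
  -- (c , punchIn c c') being paired with its reversal.
  PairSymmetric : ∀ n → (Fin (suc (suc n)) → Fin (suc n) → ℤ) → Set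
  PairSymmetric zero H = ∀ c → H zero c ≡ H (suc c) zero
  PairSymmetric (suc n) H = (∀ c → H zero c ≡ H (suc c) zero) × PairSymmetric n (λ c d → H (suc c) (suc d))

  signed : ∀ n → (Fin (suc (suc n)) → Fin (suc n) → ℤ) → ℤ
  signed n H = sumFin (suc (suc n)) (λ c → sgn c * sumFin (suc n) (λ d → sgn d * H c d))

  -- The pairs `(zero , c)` and `(suc c , zero)` are reversals of each other and carry the opposite
  -- signs `sgn c` and `sgn (suc c)`, so all pairs involving the first index cancel.
  signed-head : ∀ n H → (∀ c → H zero c ≡ H (suc c) zero) →
    signed n H ≡ sumFin (suc n) (λ c → sgn (suc c) * sumFin n (λ d → sgn (suc d) * H (suc c) (suc d)))
  signed-head n H h = begin
    signed n H ≡⟨ sum-suc (suc n) _ ⟩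
    + 1 * S + sumFin (suc n) (λ c → sgn (suc c) * sumFin (suc n) (λ d → sgn d * H (suc c) d))
      ≡⟨ cong (_+_ (+ 1 * S)) (sum-cong (suc n) λ c → begin
           sgn (suc c) * sumFin (suc n) (λ d → sgn d * H (suc c) d)
             ≡⟨ cong₂ _*_ (sgn-suc c) (sum-suc n _) ⟩
           - sgn c * (+ 1 * H (suc c) zero + U c)
             ≡⟨ cong (λ z → - sgn c * (+ 1 * z + U c)) (h c) ⟨
           - sgn c * (+ 1 * H zero c + U c)
             ≡⟨ spread (sgn c) (H zero c) (U c) ⟩
           - (+ 1) * (sgn c * H zero c) + + 1 * (- sgn c * U c)
             ≡⟨ cong (λ z → - (+ 1) * (sgn c * H zero c) + + 1 * (z * U c)) (sgn-suc c) ⟨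
           - (+ 1) * (sgn c * H zero c) + + 1 * (sgn (suc c) * U c) ∎) ⟩
    + 1 * S + sumFin (suc n) (λ c → - (+ 1) * (sgn c * H zero c) + + 1 * (sgn (suc c) * U c))
      ≡⟨ cong (_+_ (+ 1 * S)) (sum-linear (suc n) (- (+ 1)) (+ 1) (λ c → sgn c * H zero c) (λ c → sgn (suc c) * U c)) ⟩
    + 1 * S + (- (+ 1) * S + + 1 * sumFin (suc n) (λ c → sgn (suc c) * U c))
      ≡⟨ cancel S _ ⟩
    sumFin (suc n) (λ c → sgn (suc c) * U c) ∎
    where
    S : ℤ
    S = sumFin (suc n) (λ d → sgn d * H zero d)
    U : Fin (suc n) → ℤ
    U c = sumFin n (λ d → sgn (suc d) * H (suc c) (suc d))
    opaque
      unfolding _+_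
      spread : ∀ s x t → - s * (+ 1 * x + t) ≡ - (+ 1) * (s * x) + + 1 * (- s * t)
      spread = solve-∀
      cancel : ∀ s t → + 1 * s + (- (+ 1) * s + + 1 * t) ≡ t
      cancel = solve-∀

  signed-symmetric : ∀ n H → PairSymmetric n H → signed n H ≡ + 0
  signed-symmetric zero H h = trans (signed-head zero H h)
    (sum-zero 1 (λ c → trans (cong (sgn (suc c) *_) (sum-nil _)) (*-zeroʳ _)))
  signed-symmetric (suc n) H (h , hs) = begin
    signed (suc n) H ≡⟨ signed-head (suc n) H h ⟩
    _ ≡⟨ sum-cong (suc (suc n)) (λ c → begin
           sgn (suc c) * sumFin (suc n) (λ d → sgn (suc d) * H (suc c) (suc d))
             ≡⟨ cong₂ _*_ (sgn-suc c)
                  (trans (sum-cong (suc n) (λ d → trans (cong (_* H (suc c) (suc d)) (sgn-suc d)) (neg-out (sgn d) _)))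
                         (sum-*ˡ (suc n) (- (+ 1)) (λ d → sgn d * H (suc c) (suc d)))) ⟩
           - sgn c * (- (+ 1) * sumFin (suc n) (λ d → sgn d * H (suc c) (suc d)))
             ≡⟨ neg-neg (sgn c) _ ⟩
           sgn c * sumFin (suc n) (λ d → sgn d * H (suc c) (suc d)) ∎) ⟩
    signed n (λ c d → H (suc c) (suc d)) ≡⟨ signed-symmetric n _ hs ⟩
    + 0 ∎
    where
    opaque
      unfolding _+_
      neg-out : ∀ s x → - s * x ≡ - (+ 1) * (s * x)
      neg-out = solve-∀
      neg-neg : ∀ s x → - s * (- (+ 1) * x) ≡ s * x
      neg-neg = solve-∀

  -- Deleting two columns in either order leaves the same columns. `K` stands for the double minor,
  -- abstracted to any functional of the map selecting the surviving columns; this lets the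
  -- induction put a fixed first column in front through `lift`.
  punch-symmetric : ∀ n (a : Vector (suc (suc n))) (K : (Fin n → Fin (suc (suc n))) → ℤ) →
    (∀ {φ ψ} → (∀ i → φ i ≡ ψ i) → K φ ≡ K ψ) →
    PairSymmetric n (λ c d → a c * (a (punchIn c d) * K (punchIn c ∘ punchIn d)))
  punch-symmetric n a K K-cong = go n a K K-cong
    where
    opaque
      unfolding _+_
      swap : ∀ x y z → x * (y * z) ≡ y * (x * z)
      swap = solve-∀
    head : ∀ n (a : Vector (suc (suc n))) (K : (Fin n → Fin (suc (suc n))) → ℤ) → (∀ {φ ψ} → (∀ i → φ i ≡ ψ i) → K φ ≡ K ψ) →
      ∀ c → a zero * (a (suc c) * K (suc ∘ punchIn c)) ≡ a (suc c) * (a zero * K (punchIn (suc c) ∘ suc))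
    head n a K K-cong c = trans (swap (a zero) _ _) (cong (λ z → a (suc c) * (a zero * z)) (K-cong (λ _ → refl)))
    go : ∀ n (a : Vector (suc (suc n))) (K : (Fin n → Fin (suc (suc n))) → ℤ) → (∀ {φ ψ} → (∀ i → φ i ≡ ψ i) → K φ ≡ K ψ) →
      PairSymmetric n (λ c d → a c * (a (punchIn c d) * K (punchIn c ∘ punchIn d)))
    go zero a K K-cong = head zero a K K-cong
    go (suc n) a K K-cong = head (suc n) a K K-cong , pairs-resp n tail (go n (a ∘ suc) K' λ e → K-cong (lift-cong e))
      where
      lift : (Fin n → Fin (suc (suc n))) → Fin (suc n) → Fin (suc (suc (suc n)))
      lift φ zero = zero
      lift φ (suc i) = suc (φ i)
      lift-cong : ∀ {φ ψ} → (∀ i → φ i ≡ ψ i) → ∀ i → lift φ i ≡ lift ψ i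
      lift-cong e zero = refl
      lift-cong e (suc i) = cong suc (e i)
      K' : (Fin n → Fin (suc (suc n))) → ℤ
      K' φ = K (lift φ)
      tail : ∀ c d → a (suc c) * (a (suc (punchIn c d)) * K' (punchIn c ∘ punchIn d))
        ≡ a (suc c) * (a (suc (punchIn c d)) * K (punchIn (suc c) ∘ punchIn (suc d)))
      tail c d = cong (λ z → a (suc c) * (a (suc (punchIn c d)) * z)) (K-cong λ { zero → refl ; (suc i) → refl })
      pairs-resp : ∀ n {H H' : Fin (suc (suc n)) → Fin (suc n) → ℤ} → (∀ c d → H c d ≡ H' c d) → PairSymmetric n H → PairSymmetric n H'
      pairs-resp zero e p c = trans (sym (e _ _)) (trans (p c) (e _ _))
      pairs-resp (suc n) e (p , ps) = (λ c → trans (sym (e _ _)) (trans (p c) (e _ _))) , pairs-resp n (λ c d → e (suc c) (suc d)) ps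

  del : ∀ {n} → Fin (suc n) → Vector (suc n) → Vector n
  del c v = v ∘ punchIn c

  del-linear : ∀ {n} (c : Fin (suc n)) → Linear (del c)
  del-linear c = record { φ-cong = λ e k → e (punchIn c k) ; φ-lin = λ _ _ _ _ _ → refl }

  -- For a fixed first row the expansion is a combination of minors, which are forms by induction.
  -- For two equal leading rows, expanding twice gives a sum over ordered pairs of columns,
  -- antisymmetric in the pair.
  det-form : ∀ n → Form n (det n)
  det-form zero = nil (det-cong zero)
  det-form (suc n) = cons (det-cong (suc n)) head-linear (alternating n) (λ a →
      form-resp (λ R → trans (sum-cong (suc n) (λ c → *-assoc (sgn c) (a c) _)) (sym (det-suc n (a ∷ R))))
                (form-sum (suc n) (λ c → sgn c * a c) (λ c R → det n (del c ∘ R)) (λ c → form-∘ (del-linear c) (det-form n))))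
    where
    head-linear : ∀ p q a b (R : Rows n (suc n)) → det (suc n) (lin p q a b ∷ R) ≡ p * det (suc n) (a ∷ R) + q * det (suc n) (b ∷ R)
    head-linear p q a b R = begin
      det (suc n) (lin p q a b ∷ R) ≡⟨ det-suc n _ ⟩
      _ ≡⟨ sum-cong (suc n) (λ c → regroup p q (sgn c) (a c) (b c) _) ⟩
      _ ≡⟨ sum-linear (suc n) p q _ _ ⟩
      _ ≡⟨ cong₂ (λ x y → p * x + q * y) (det-suc n (a ∷ R)) (det-suc n (b ∷ R)) ⟨
      _ ∎
      where
      opaque
        unfolding _+_
        regroup : ∀ p q s x y d → s * ((p * x + q * y) * d) ≡ p * (s * (x * d)) + q * (s * (y * d))
        regroup = solve-∀
    alternating : ∀ n → AlternatingHead (det (suc n))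
    alternating zero = tt
    alternating (suc n) a R = begin
      det (suc (suc n)) (a ∷ a ∷ R) ≡⟨ det-suc (suc n) (a ∷ a ∷ R) ⟩
      _ ≡⟨ sum-cong (suc (suc n)) (λ c → cong (sgn c *_) (trans (cong (a c *_) (det-suc n (minor (a ∷ a ∷ R) c)))
              (trans (sym (sum-*ˡ (suc n) (a c) _)) (sum-cong (suc n) (λ d → swap (a c) (sgn d) _))))) ⟩
      signed n (λ c d → a c * (a (punchIn c d) * K (punchIn c ∘ punchIn d)))
        ≡⟨ signed-symmetric n _ (punch-symmetric n a K (λ e → det-cong n (λ r c → cong (R r) (e c)))) ⟩
      + 0 ∎
      where
      K : (Fin n → Fin (suc (suc n))) → ℤ
      K φ = det n (λ r c → R r (φ c))
      opaque
        unfolding _+_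
        swap : ∀ x s y → x * (s * y) ≡ s * (x * y)
        swap = solve-∀

  form-head-zero : ∀ {n m D} → Form {m} (suc n) D → ∀ R → D ((λ _ → + 0) ∷ R) ≡ + 0
  form-head-zero (cons c l _ _) R =
    trans (c (∷-cong (λ _ → sym (zeros (+ 0) (+ 0))) (λ _ _ → refl))) (trans (l (+ 0) (+ 0) (λ _ → + 0) (λ _ → + 0) R) (zeros _ _))
    where
    opaque
      unfolding _+_
      zeros : ∀ x y → + 0 * x + + 0 * y ≡ + 0
      zeros = solve-∀

  form-head-sum : ∀ {n m D} → Form {m} (suc n) D → ∀ k (s : Fin k → ℤ) (v : Fin k → Vector m) R →
    D ((λ c → sumFin k (λ i → s i * v i c)) ∷ R) ≡ sumFin k (λ i → s i * D (v i ∷ R))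
  form-head-sum F zero s v R = trans (form-cong F (∷-cong (λ c → sum-nil _) (λ _ _ → refl))) (trans (form-head-zero F R) (sym (sum-nil _)))
  form-head-sum {D = D} F@(cons c l _ _) (suc k) s v R = begin
    D ((λ j → sumFin (suc k) (λ i → s i * v i j)) ∷ R)
      ≡⟨ c (∷-cong (λ j → trans (sum-suc k _) (cong (_+_ (s zero * v zero j)) (sym (*-identityˡ _)))) (λ _ _ → refl)) ⟩
    D (lin (s zero) (+ 1) (v zero) (λ j → sumFin k (λ i → s (suc i) * v (suc i) j)) ∷ R)
      ≡⟨ l (s zero) (+ 1) _ _ R ⟩
    s zero * D (v zero ∷ R) + + 1 * D ((λ j → sumFin k (λ i → s (suc i) * v (suc i) j)) ∷ R)
      ≡⟨ cong (_+_ (s zero * D (v zero ∷ R))) (trans (*-identityˡ _) (form-head-sum F k (s ∘ suc) (v ∘ suc) R)) ⟩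
    s zero * D (v zero ∷ R) + sumFin k (λ i → s (suc i) * D (v (suc i) ∷ R)) ≡⟨ sum-suc k _ ⟨
    _ ∎

  form-swap : ∀ {n m D} → Form {m} (suc (suc n)) D → ∀ a b R → D (a ∷ b ∷ R) ≡ - D (b ∷ a ∷ R)
  form-swap {D = D} (cons c l alt t) a b R with t (lin (+ 1) (+ 1) a b) | t a | t b
  ... | cons _ ls _ _ | cons _ la _ _ | cons _ lb _ _ = isolate _ _ (begin
    D (a ∷ b ∷ R) + D (b ∷ a ∷ R)
      ≡⟨ expand (D (a ∷ b ∷ R)) (D (b ∷ a ∷ R)) ⟩
    + 1 * (+ 1 * + 0 + + 1 * D (a ∷ b ∷ R)) + + 1 * (+ 1 * D (b ∷ a ∷ R) + + 1 * + 0)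
      ≡⟨ cong₂ (λ x y → + 1 * (+ 1 * x + + 1 * D (a ∷ b ∷ R)) + + 1 * (+ 1 * D (b ∷ a ∷ R) + + 1 * y)) (alt a R) (alt b R) ⟨
    + 1 * (+ 1 * D (a ∷ a ∷ R) + + 1 * D (a ∷ b ∷ R)) + + 1 * (+ 1 * D (b ∷ a ∷ R) + + 1 * D (b ∷ b ∷ R))
      ≡⟨ cong₂ (λ x y → + 1 * x + + 1 * y) (la (+ 1) (+ 1) a b R) (lb (+ 1) (+ 1) a b R) ⟨
    + 1 * D (a ∷ s ∷ R) + + 1 * D (b ∷ s ∷ R)
      ≡⟨ l (+ 1) (+ 1) a b (s ∷ R) ⟨
    D (s ∷ s ∷ R) ≡⟨ alt s R ⟩
    + 0 ∎)
    where
    s = lin (+ 1) (+ 1) a b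
    opaque
      unfolding _+_
      expand : ∀ x y → x + y ≡ + 1 * (+ 1 * + 0 + + 1 * x) + + 1 * (+ 1 * y + + 1 * + 0)
      expand = solve-∀
      shift : ∀ x y → x ≡ x + y + - y
      shift = solve-∀
    isolate : ∀ x y → x + y ≡ + 0 → x ≡ - y
    isolate x y e = trans (shift x y) (trans (cong (_+ - y) e) (+-identityˡ _))

  form-alternating : ∀ {n m D} → Form {m} (suc n) D → ∀ k a R → (∀ c → R k c ≡ a c) → D (a ∷ R) ≡ + 0
  form-alternating {suc n} {D = D} (cons c l alt t) zero a R h =
    trans (c (∷-cong (λ _ → refl) (λ { zero j → h j ; (suc r) j → refl }))) (alt a (R ∘ suc))
  form-alternating {suc n} {D = D} F@(cons c l alt t) (suc k) a R h = begin
    D (a ∷ R) ≡⟨ c (∷-cong (λ _ → refl) (∷-η R)) ⟩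
    D (a ∷ R zero ∷ (R ∘ suc)) ≡⟨ form-swap F a (R zero) (R ∘ suc) ⟩
    - D (R zero ∷ a ∷ (R ∘ suc)) ≡⟨ trans (cong -_ (form-alternating (t (R zero)) k a (R ∘ suc) h)) -0≡0 ⟩
    + 0 ∎

  -- Here `D` is typically a form with a leading row `e` already fixed, so that one more row equal
  -- to `e` gives zero. With `e` a unit vector this clears a whole column at once.
  form-shift : ∀ {n m} {D : Rows n m → ℤ} → Form n D → (e : Vector m) → (∀ R k → (∀ c → R k c ≡ e c) → D R ≡ + 0) →
    ∀ (f : Fin n → ℤ) (R S : Rows n m) → (∀ r c → R r c ≡ f r * e c + S r c) → D R ≡ D S
  form-shift (nil c) e van f R S h = c (λ ())
  form-shift {suc n} {D = D} (cons c l alt t) e van f R S h = begin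
    D R ≡⟨ c (λ { zero j → trans (h zero j) (cong (_+_ (f zero * e j)) (sym (*-identityˡ _))) ; (suc r) j → refl }) ⟩
    D (lin (f zero) (+ 1) e (S zero) ∷ (R ∘ suc)) ≡⟨ l (f zero) (+ 1) e (S zero) (R ∘ suc) ⟩
    f zero * D (e ∷ (R ∘ suc)) + + 1 * D (S zero ∷ (R ∘ suc))
      ≡⟨ cong₂ (λ x y → f zero * x + + 1 * y) (van _ zero (λ _ → refl))
           (form-shift (t (S zero)) e (λ R' k e' → van (S zero ∷ R') (suc k) e') (f ∘ suc) (R ∘ suc) (S ∘ suc) (h ∘ suc)) ⟩
    f zero * + 0 + + 1 * D (S zero ∷ (S ∘ suc)) ≡⟨ tidy (f zero) _ ⟩
    D (S zero ∷ (S ∘ suc)) ≡⟨ c (∷-η S) ⟨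
    D S ∎
    where
    opaque
      unfolding _+_
      tidy : ∀ f x → f * + 0 + + 1 * x ≡ x
      tidy = solve-∀

  ins : ∀ {n} → Fin (suc n) → Vector n → Vector (suc n)
  ins zero v zero = + 0
  ins zero v (suc j) = v j
  ins {suc n} (suc k) v zero = v zero
  ins {suc n} (suc k) v (suc j) = ins k (v ∘ suc) j

  ins-linear : ∀ {n} (k : Fin (suc n)) → Linear (ins k)
  ins-linear k = record { φ-cong = c k ; φ-lin = l k }
    where
    c : ∀ {n} (k : Fin (suc n)) {a b : Vector n} → (∀ c → a c ≡ b c) → ∀ c → ins k a c ≡ ins k b c
    c zero e zero = refl
    c zero e (suc j) = e j
    c {suc n} (suc k) e zero = e zero
    c {suc n} (suc k) e (suc j) = c k (e ∘ suc) j
    opaque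
      unfolding _+_
      zeros : ∀ p q → + 0 ≡ p * + 0 + q * + 0
      zeros = solve-∀
    l : ∀ {n} (k : Fin (suc n)) p q (a b : Vector n) c → ins k (lin p q a b) c ≡ lin p q (ins k a) (ins k b) c
    l zero p q a b zero = zeros p q
    l zero p q a b (suc j) = refl
    l {suc n} (suc k) p q a b zero = refl
    l {suc n} (suc k) p q a b (suc j) = l k p q (a ∘ suc) (b ∘ suc) j

  ins-del : ∀ {n} (k : Fin (suc n)) (v : Vector (suc n)) c → v c ≡ v k * δ k c + ins k (del k v) c
  ins-del {n} zero v zero = tidy (v zero)
    where
    opaque
      unfolding _+_
      tidy : ∀ x → x ≡ x * + 1 + + 0
      tidy = solve-∀
  ins-del zero v (suc j) = tidy (v zero) (v (suc j))
    where
    opaque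
      unfolding _+_
      tidy : ∀ y x → x ≡ y * + 0 + x
      tidy = solve-∀
  ins-del {suc n} (suc k) v zero = tidy (v (suc k)) (v zero)
    where
    opaque
      unfolding _+_
      tidy : ∀ y x → x ≡ y * + 0 + x
      tidy = solve-∀
  ins-del {suc n} (suc k) v (suc j) = ins-del k (v ∘ suc) j

  -- The rows are those of the identity with row `k` moved to the front, a product of `k` adjacent
  -- transpositions.
  identity-rotate : ∀ {n D} → Form {suc n} (suc n) D → ∀ k → D (δ k ∷ (ins k ∘ δ)) ≡ sgn k * D δ
  identity-rotate {n} {D} F zero =
    trans (form-cong F λ { zero c → refl ; (suc r) zero → refl ; (suc r) (suc c) → refl }) (sym (*-identityˡ _))
  identity-rotate {suc n} {D} F@(cons _ _ _ t) (suc k) = begin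
    D (δ (suc k) ∷ (ins (suc k) ∘ δ))
      ≡⟨ form-cong F (λ { zero c → refl ; (suc zero) c → first k c ; (suc (suc r)) c → refl }) ⟩
    D (δ (suc k) ∷ δ zero ∷ (λ r → ins (suc k) (δ (suc r))))
      ≡⟨ form-swap F _ _ _ ⟩
    - D (δ zero ∷ δ (suc k) ∷ (λ r → ins (suc k) (δ (suc r))))
      ≡⟨ cong -_ (form-cong F λ { zero c → refl ; (suc zero) zero → refl ; (suc zero) (suc c) → refl
                                ; (suc (suc r)) zero → refl ; (suc (suc r)) (suc c) → refl }) ⟩
    - D (δ zero ∷ (ins zero ∘ (δ k ∷ (ins k ∘ δ))))
      ≡⟨ cong -_ (identity-rotate (form-∘ (ins-linear zero) (t (δ zero))) k) ⟩
    - (sgn k * D (δ zero ∷ (ins zero ∘ δ)))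
      ≡⟨ cong (λ z → - (sgn k * z)) (form-cong F λ { zero c → refl ; (suc r) zero → refl ; (suc r) (suc c) → refl }) ⟩
    - (sgn k * D δ) ≡⟨ pull (sgn k) (D δ) ⟩
    - sgn k * D δ ≡⟨ cong (_* D δ) (sgn-suc k) ⟨
    sgn (suc k) * D δ ∎
    where
    first : ∀ {n} (k : Fin (suc n)) c → ins (suc k) (δ zero) c ≡ δ zero c
    first k zero = refl
    first k (suc c) = zeros k c
      where
      zeros : ∀ {n} (k : Fin (suc n)) c → ins k (λ _ → + 0) c ≡ + 0
      zeros zero zero = refl
      zeros zero (suc c) = refl
      zeros {suc n} (suc k) zero = refl
      zeros {suc n} (suc k) (suc c) = zeros k c
    opaque
      unfolding _+_
      pull : ∀ s d → - (s * d) ≡ - s * d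
      pull = solve-∀

  -- The first row is expanded into unit vectors. Once it is `δ k`, column `k` of the other rows can
  -- be cleared, and the rest is a form in the rows of the minor, to which the induction hypothesis
  -- applies.
  form-unique : ∀ n {D} → Form {n} n D → ∀ M → D M ≡ det n M * D δ
  form-unique zero F M = trans (form-cong F (λ ())) (sym (trans (cong (_* _) (det-nil M)) (*-identityˡ _)))
  form-unique (suc n) {D} F@(cons c l alt t) M = begin
    D M ≡⟨ c (λ { zero j → sym (sum-δʳ j (M zero)) ; (suc r) j → refl }) ⟩
    D ((λ j → sumFin (suc n) (λ k → M zero k * δ k j)) ∷ (M ∘ suc))
      ≡⟨ form-head-sum F (suc n) (M zero) δ (M ∘ suc) ⟩
    sumFin (suc n) (λ k → M zero k * D (δ k ∷ (M ∘ suc)))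
      ≡⟨ sum-cong (suc n) (λ k → trans (cong (M zero k *_) (expand k)) (regroup (M zero k) (det n (minor M k)) (sgn k) (D δ))) ⟩
    sumFin (suc n) (λ k → D δ * (sgn k * (M zero k * det n (minor M k))))
      ≡⟨ sum-*ˡ (suc n) (D δ) _ ⟩
    D δ * sumFin (suc n) (λ k → sgn k * (M zero k * det n (minor M k)))
      ≡⟨ cong (D δ *_) (det-suc n M) ⟨
    D δ * det (suc n) M ≡⟨ *-comm (D δ) _ ⟩
    det (suc n) M * D δ ∎
    where
    opaque
      unfolding _+_
      regroup : ∀ m d s e → m * (d * (s * e)) ≡ e * (s * (m * d))
      regroup = solve-∀
    expand : ∀ k → D (δ k ∷ (M ∘ suc)) ≡ det n (minor M k) * (sgn k * D δ)
    expand k = begin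
      D (δ k ∷ (M ∘ suc))
        ≡⟨ form-shift (t (δ k)) (δ k) (λ R i e → form-alternating F i (δ k) R e) (λ r → M (suc r) k)
             (M ∘ suc) (ins k ∘ minor M k) (λ r → ins-del k (M (suc r))) ⟩
      D (δ k ∷ (ins k ∘ minor M k)) ≡⟨ form-unique n (form-∘ (ins-linear k) (t (δ k))) (minor M k) ⟩
      det n (minor M k) * D (δ k ∷ (ins k ∘ δ)) ≡⟨ cong (det n (minor M k) *_) (identity-rotate F k) ⟩
      _ ∎

  -- Special determinants and multiplicativity

  -- The expansion runs along rows, so facts about the first column take a mutual induction: every
  -- minor other than the first one retains that column.
  det-zero-column : ∀ n (M : Matrix (suc n)) → (∀ r → M r zero ≡ + 0) → det (suc n) M ≡ + 0
  det-lower-zero : ∀ n (M : Matrix (suc n)) → (∀ r → M (suc r) zero ≡ + 0) →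
    det (suc n) M ≡ M zero zero * det n (λ r c → M (suc r) (suc c))

  det-lower-zero n M h = begin
    det (suc n) M ≡⟨ trans (det-suc n M) (sum-suc n _) ⟩
    + 1 * (M zero zero * det n (λ r c → M (suc r) (suc c))) + _
      ≡⟨ cong₂ _+_ (*-identityˡ _) (sum-zero n (vanish n M h)) ⟩
    _ ≡⟨ +-identityʳ _ ⟩
    _ ∎
    where
    vanish : ∀ n (M : Matrix (suc n)) → (∀ r → M (suc r) zero ≡ + 0) →
      ∀ c → sgn (suc c) * (M zero (suc c) * det n (minor M (suc c))) ≡ + 0
    vanish (suc n) M h c = trans (cong (λ z → sgn (suc c) * (M zero (suc c) * z)) (det-zero-column n (minor M (suc c)) h))
      (trans (cong (sgn (suc c) *_) (*-zeroʳ _)) (*-zeroʳ _))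
  det-zero-column n M h = trans (det-lower-zero n M (h ∘ suc)) (trans (cong (_* det n (λ r c → M (suc r) (suc c))) (h zero)) (*-zeroˡ _))

  det-unit-row : ∀ n (M : Matrix (suc n)) → (∀ c → M zero (suc c) ≡ + 0) →
    det (suc n) M ≡ M zero zero * det n (λ r c → M (suc r) (suc c))
  det-unit-row n M h = trans (trans (det-suc n M) (sum-suc n _)) (trans (cong₂ _+_ (*-identityˡ _)
    (sum-zero n (λ c → trans (cong (λ z → sgn (suc c) * (z * det n (minor M (suc c)))) (h c)) (trans (cong (sgn (suc c) *_) (*-zeroˡ _)) (*-zeroʳ _))))) (+-identityʳ _))

  det-identity : ∀ n → det n δ ≡ + 1
  det-identity zero = det-nil _
  det-identity (suc n) = trans (det-unit-row n δ (λ _ → refl)) (trans (*-identityˡ _) (det-identity n))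

  infixl 7 _·_
  _·_ : ∀ {n} → Matrix n → Matrix n → Matrix n
  _·_ {n} A B r c = sumFin n (λ k → A r k * B k c)

  -- For fixed `B`, the left-hand side is a form in the rows of `A` with value `det n B` at the
  -- identity.
  det-· : ∀ n (A B : Matrix n) → det n (A · B) ≡ det n A * det n B
  det-· n A B = trans (form-unique n (form-∘ times-linear (det-form n)) A)
    (cong (det n A *_) (det-cong n (λ r c → sum-δ r (λ k → B k c))))
    where
    times : Vector n → Vector n
    times v c = sumFin n (λ k → v k * B k c)
    times-linear : Linear times
    times-linear = record
      { φ-cong = λ e c → sum-cong n (λ k → cong (_* B k c) (e k))
      ; φ-lin = λ p q a b c → trans (sum-cong n (λ k → distribute p q (a k) (b k) (B k c))) (sum-linear n p q _ _) }
      where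
      opaque
        unfolding _+_
        distribute : ∀ p q a b x → (p * a + q * b) * x ≡ p * (a * x) + q * (b * x)
        distribute = solve-∀


  infixr 9 _^_
  _^_ : ℤ → ℕ → ℤ
  x ^ zero = + 1
  x ^ suc n = x * x ^ n

  det-scale : ∀ n a (M : Matrix n) → det n (λ r c → a * M r c) ≡ a ^ n * det n M
  det-scale zero a M = trans (det-nil _) (sym (trans (*-identityˡ _) (det-nil M)))
  det-scale (suc n) a M = begin
    det (suc n) (λ r c → a * M r c) ≡⟨ det-suc n _ ⟩
    _ ≡⟨ sum-cong (suc n) (λ c → trans (cong (λ z → sgn c * (a * M zero c * z)) (det-scale n a (minor M c)))
           (regroup (sgn c) a (M zero c) (a ^ n) _)) ⟩
    _ ≡⟨ sum-*ˡ (suc n) (a ^ suc n) _ ⟩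
    _ ≡⟨ cong (a ^ suc n *_) (det-suc n M) ⟨
    _ ∎
    where
    opaque
      unfolding _+_
      regroup : ∀ s a m p d → s * (a * m * (p * d)) ≡ a * p * (s * (m * d))
      regroup = solve-∀

  -- Diagonally dominant matrices

  opaque
    unfolding _+_

    +-≥0 : ∀ {x y} → + 0 ≤ x → + 0 ≤ y → + 0 ≤ x + y
    +-≥0 = ℤ.+-mono-≤
    +->0 : ∀ {x y} → + 0 < x → + 0 ≤ y → + 0 < x + y
    +->0 = ℤ.+-mono-<-≤
    *-≥0 : ∀ {x y} → + 0 ≤ x → + 0 ≤ y → + 0 ≤ x * y
    *-≥0 {x} {y} (ℤ.+≤+ {n = m} _) (ℤ.+≤+ {n = n} _) = subst (+ 0 ≤_) (ℤ.pos-* m n) (ℤ.+≤+ ℕ.z≤n)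
    *->0 : ∀ {x y} → + 0 < x → + 0 < y → + 0 < x * y
    *->0 {x} {y} p q = subst (_< x * y) (ℤ.*-zeroʳ x) (ℤ.*-monoˡ-<-pos x {{ℤ.positive p}} q)
    *->0⁻ : ∀ {x y} → + 0 < x → + 0 < x * y → + 0 < y
    *->0⁻ {x} {y} p q = ℤ.*-cancelˡ-<-nonNeg x {{ℤ.nonNegative (ℤ.<⇒≤ p)}} (subst (_< x * y) (sym (ℤ.*-zeroʳ x)) q)
    *-zero-product : ∀ x y → x * y ≡ + 0 → x ≡ + 0 ⊎ y ≡ + 0
    *-zero-product x y = ℤ.i*j≡0⇒i≡0∨j≡0 x
    -‿injective : ∀ x → - x ≡ + 0 → x ≡ + 0
    -‿injective x e = trans (sym (ℤ.neg-involutive x)) (cong ℤ.-_ e)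
    -‿>0 : ∀ {x y} → y < x → + 0 < x - y
    -‿>0 {x} {y} p = subst (_< x - y) (ℤ.+-inverseʳ y) (ℤ.+-monoˡ-< (ℤ.- y) p)
    +-mono-≤ : ∀ {x y u v} → x ≤ y → u ≤ v → x + u ≤ y + v
    +-mono-≤ = ℤ.+-mono-≤
    pos-suc : ∀ n → + 1 + + n ≡ + suc n
    pos-suc n = refl

  +-zero-parts : ∀ {x y} → + 0 ≤ x → + 0 ≤ y → x + y ≡ + 0 → x ≡ + 0 × y ≡ + 0
  +-zero-parts {x} {y} p q e = left , trans (sym (trans (cong (_+ y) left) (+-identityˡ y))) e
    where
    left : x ≡ + 0
    left with ℤ.<-cmp (+ 0) x
    ... | tri< 0<x _ _ = ⊥-elim (ℤ.<-irrefl (sym e) (+->0 0<x q))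
    ... | tri≈ _ 0≡x _ = sym 0≡x
    ... | tri> _ _ x<0 = ⊥-elim (ℤ.<-irrefl refl (ℤ.<-≤-trans x<0 p))

  *-cancel-zero : ∀ {x y} → x ≢ + 0 → x * y ≡ + 0 → y ≡ + 0
  *-cancel-zero {x} {y} ne e with *-zero-product x y e
  ... | inj₁ z = ⊥-elim (ne z)
  ... | inj₂ z = z

  >0⇒≢0 : ∀ {x} → + 0 < x → x ≢ + 0
  >0⇒≢0 p e = ℤ.<-irrefl (sym e) p

  ^->0 : ∀ {x} n → + 0 < x → + 0 < x ^ n
  ^->0 zero p = ℤ.+<+ (ℕ.s≤s ℕ.z≤n)
  ^->0 (suc n) p = *->0 p (^->0 n p)

  sum-≥0 : ∀ n {f : Fin n → ℤ} → (∀ k → + 0 ≤ f k) → + 0 ≤ sumFin n f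
  sum-≥0 zero {f} h = subst (+ 0 ≤_) (sym (sum-nil f)) ℤ.≤-refl
  sum-≥0 (suc n) {f} h = subst (+ 0 ≤_) (sym (sum-suc n f)) (+-≥0 (h zero) (sum-≥0 n (h ∘ suc)))

  sum-≡0 : ∀ n {f : Fin n → ℤ} → (∀ k → + 0 ≤ f k) → sumFin n f ≡ + 0 → ∀ k → f k ≡ + 0
  sum-≡0 (suc n) {f} h e k with +-zero-parts (h zero) (sum-≥0 n (h ∘ suc)) (trans (sym (sum-suc n f)) e)
  sum-≡0 (suc n) h e zero | p , q = p
  sum-≡0 (suc n) h e (suc k) | p , q = sum-≡0 n (h ∘ suc) q k

  sum-mono : ∀ n {f g : Fin n → ℤ} → (∀ k → f k ≤ g k) → sumFin n f ≤ sumFin n g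
  sum-mono zero {f} {g} h = ℤ.≤-reflexive (trans (sum-nil f) (sym (sum-nil g)))
  sum-mono (suc n) {f} {g} h = subst₂ _≤_ (sym (sum-suc n f)) (sym (sum-suc n g)) (+-mono-≤ (h zero) (sum-mono n (h ∘ suc)))

  sum-neg : ∀ n (f : Fin n → ℤ) → sumFin n (λ k → - f k) ≡ - sumFin n f
  sum-neg n f = trans (sum-cong n (λ k → neg (f k))) (trans (sum-*ˡ n (- (+ 1)) f) (sym (neg _)))
    where
    opaque
      unfolding _+_
      neg : ∀ x → - x ≡ - (+ 1) * x
      neg = solve-∀

  record DominantZ (n : ℕ) (M : Matrix n) : Set where
    field
      off-diagonal : ∀ u v → u ≢ v → + 0 ≤ - M u v
      row-sum      : ∀ u → + 0 ≤ sumFin n (M u)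
  open DominantZ

  -- The combinatorial obstruction to a positive determinant: the diagonal block on such a set
  -- annihilates the all-ones vector. For a Laplacian, the set is a union of components.
  record ClosedSet (n : ℕ) (M : Matrix n) : Set where
    field
      member    : Fin n → Bool
      witness   : Fin n
      witness∈  : member witness ≡ true
      row-zero  : ∀ u → member u ≡ true → sumFin n (M u) ≡ + 0
      no-exit   : ∀ u v → member u ≡ true → member v ≡ false → M u v ≡ + 0
  open ClosedSet

  module Schur {n : ℕ} (M : Matrix (suc n)) where
    pivot : ℤ
    pivot = M zero zero

    -- The Schur complement multiplied by the pivot, which keeps the elimination within ℤ; this is
    -- where the powers of the pivot in `det-schur` come from.
    schur : Matrix n
    schur r c = pivot * M (suc r) (suc c) + - M (suc r) zero * M zero (suc c)

    elimination : Matrix (suc n)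
    elimination zero c = δ zero c
    elimination (suc r) zero = - M (suc r) zero
    elimination (suc r) (suc c) = pivot * δ r c

    det-elimination : det (suc n) elimination ≡ pivot ^ n
    det-elimination = begin
      det (suc n) elimination ≡⟨ det-unit-row n elimination (λ _ → refl) ⟩
      + 1 * det n (λ r c → pivot * δ r c) ≡⟨ *-identityˡ _ ⟩
      det n (λ r c → pivot * δ r c) ≡⟨ det-scale n pivot δ ⟩
      pivot ^ n * det n δ ≡⟨ trans (cong (pivot ^ n *_) (det-identity n)) (*-identityʳ _) ⟩
      pivot ^ n ∎

    eliminated-row : ∀ r c → (elimination · M) (suc r) c ≡ - M (suc r) zero * M zero c + pivot * M (suc r) c
    eliminated-row r c = trans (sum-suc n _) (cong (_+_ (- M (suc r) zero * M zero c))
      (trans (sum-cong n (λ k → *-assoc pivot (δ r k) _))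
        (trans (sum-*ˡ n pivot _) (cong (pivot *_) (sum-δ r (λ k → M (suc k) c))))))

    det-schur : pivot ^ n * det (suc n) M ≡ pivot * det n schur
    det-schur = begin
      pivot ^ n * det (suc n) M ≡⟨ cong (_* det (suc n) M) det-elimination ⟨
      det (suc n) elimination * det (suc n) M ≡⟨ det-· (suc n) elimination M ⟨
      det (suc n) (elimination · M)
        ≡⟨ det-lower-zero n (elimination · M) (λ r → trans (eliminated-row r zero) (cancel (M (suc r) zero) pivot)) ⟩
      (elimination · M) zero zero * det n (λ r c → (elimination · M) (suc r) (suc c))
        ≡⟨ cong₂ _*_ (sum-δ zero (λ k → M k zero)) (det-cong n (λ r c → trans (eliminated-row r (suc c)) (swap _ _))) ⟩
      pivot * det n schur ∎
      where
      opaque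
        unfolding _+_
        cancel : ∀ x p → - x * p + p * x ≡ + 0
        cancel = solve-∀
        swap : ∀ x y → x + y ≡ y + x
        swap = solve-∀

    schur-row-sum : ∀ r → sumFin n (schur r) ≡ pivot * sumFin (suc n) (M (suc r)) + - M (suc r) zero * sumFin (suc n) (M zero)
    schur-row-sum r = begin
      sumFin n (schur r) ≡⟨ sum-linear n pivot (- M (suc r) zero) _ _ ⟩
      pivot * sumFin n (M (suc r) ∘ suc) + - M (suc r) zero * sumFin n (M zero ∘ suc)
        ≡⟨ extend pivot (M (suc r) zero) _ _ ⟩
      pivot * (M (suc r) zero + sumFin n (M (suc r) ∘ suc)) + - M (suc r) zero * (pivot + sumFin n (M zero ∘ suc))
        ≡⟨ cong₂ (λ x y → pivot * x + - M (suc r) zero * y) (sum-suc n (M (suc r))) (sum-suc n (M zero)) ⟨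
      _ ∎
      where
      opaque
        unfolding _+_
        extend : ∀ p x s t → p * s + - x * t ≡ p * (x + s) + - x * (p + t)
        extend = solve-∀

    schur-entry : ∀ r c → - schur r c ≡ pivot * - M (suc r) (suc c) + - M (suc r) zero * - M zero (suc c)
    schur-entry r c = identity _ _ _ _
      where
      opaque
        unfolding _+_
        identity : ∀ p m x y → - (p * m + - x * y) ≡ p * - m + - x * - y
        identity = solve-∀

    head-split : pivot ≡ sumFin (suc n) (M zero) + sumFin n (λ c → - M zero (suc c))
    head-split = trans (identity pivot _) (cong₂ _+_ (sym (sum-suc n (M zero))) (sym (sum-neg n _)))
      where
      opaque
        unfolding _+_
        identity : ∀ p s → p ≡ p + s + - s
        identity = solve-∀

  -- Gaussian elimination on the first row and column preserves the hypotheses, and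
  -- a closed set of the Schur complement lifts back.
  det-dichotomy : ∀ n M → DominantZ n M → + 0 < det n M ⊎ ClosedSet n M
  det-dichotomy zero M Z = inj₁ (subst (+ 0 <_) (sym (det-nil M)) (ℤ.+<+ (ℕ.s≤s ℕ.z≤n)))
  det-dichotomy (suc n) M Z = by-pivot (ℤ.<-cmp (+ 0) pivot)
    where
    open Schur M
    column-≥0 : ∀ r → + 0 ≤ - M (suc r) zero
    column-≥0 r = off-diagonal Z (suc r) zero λ ()
    row-≥0 : ∀ c → + 0 ≤ - M zero (suc c)
    row-≥0 c = off-diagonal Z zero (suc c) λ ()
    pivot-≥0 : + 0 ≤ pivot
    pivot-≥0 = subst (+ 0 ≤_) (sym head-split) (+-≥0 (row-sum Z zero) (sum-≥0 n row-≥0))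
    distinct : ∀ {r c : Fin n} → r ≢ c → Fin.suc r ≢ suc c
    distinct ne refl = ne refl
    schur-Z : DominantZ n schur
    schur-Z = record
      { off-diagonal = λ r c ne → subst (+ 0 ≤_) (sym (schur-entry r c))
          (+-≥0 (*-≥0 pivot-≥0 (off-diagonal Z _ _ (distinct ne))) (*-≥0 (column-≥0 r) (row-≥0 c)))
      ; row-sum = λ r → subst (+ 0 ≤_) (sym (schur-row-sum r))
          (+-≥0 (*-≥0 pivot-≥0 (row-sum Z (suc r))) (*-≥0 (column-≥0 r) (row-sum Z zero))) }
    -- By `head-split` the pivot is a sum of nonnegative terms, so a zero pivot makes the whole
    -- first row vanish and the first index alone is closed.
    zero-pivot : pivot ≡ + 0 → ClosedSet (suc n) M
    zero-pivot e = record
      { member = λ { zero → true ; (suc _) → false } ; witness = zero ; witness∈ = refl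
      ; row-zero = λ { zero _ → proj₁ parts }
      ; no-exit = λ { zero (suc c) _ _ → -‿injective _ (sum-≡0 n row-≥0 (proj₂ parts) c) } }
      where
      parts = +-zero-parts (row-sum Z zero) (sum-≥0 n row-≥0) (trans (sym head-split) e)
    lift : + 0 < pivot → ClosedSet n schur → ClosedSet (suc n) M
    lift p C = by-exit (any? (λ r → (member C r Bool.≟ true) ×-dec ¬? (M (suc r) zero ℤ.≟ + 0)))
      where
      -- Row sums and negated off-diagonal entries of the Schur complement are sums of two
      -- nonnegative terms; when such a sum is zero, both terms are.
      row-parts : ∀ r → member C r ≡ true → sumFin (suc n) (M (suc r)) ≡ + 0 × - M (suc r) zero * sumFin (suc n) (M zero) ≡ + 0
      row-parts r m with +-zero-parts (*-≥0 pivot-≥0 (row-sum Z (suc r))) (*-≥0 (column-≥0 r) (row-sum Z zero))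
                           (trans (sym (schur-row-sum r)) (row-zero C r m))
      ... | a , b = *-cancel-zero (>0⇒≢0 p) a , b
      entry-parts : ∀ r c → member C r ≡ true → member C c ≡ false → M (suc r) (suc c) ≡ + 0 × - M (suc r) zero * - M zero (suc c) ≡ + 0
      entry-parts r c m m' with +-zero-parts (*-≥0 pivot-≥0 (off-diagonal Z _ _ (distinct r≢c))) (*-≥0 (column-≥0 r) (row-≥0 c))
                           (trans (sym (schur-entry r c)) (trans (cong -_ (no-exit C r c m m')) -0≡0))
        where
        r≢c : r ≢ c
        r≢c refl with trans (sym m) m'
        ... | ()
      ... | a , b = -‿injective _ (*-cancel-zero (>0⇒≢0 p) a) , b
      by-exit : Dec (∃[ r ] (member C r ≡ true × ¬ M (suc r) zero ≡ + 0)) → ClosedSet (suc n) M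
      -- A nonzero entry of row `r` in the first column can be cancelled from the vanishing
      -- products: the first row then sums to zero and does not leave the set either, so its index
      -- joins the set.
      by-exit (yes (r , m , ne)) = record
        { member = true ∷ member C ; witness = zero ; witness∈ = refl
        ; row-zero = λ { zero _ → *-cancel-zero (ne ∘ -‿injective _) (proj₂ (row-parts r m)) ; (suc u) mu → proj₁ (row-parts u mu) }
        ; no-exit = λ { zero (suc c) _ mc → -‿injective _ (*-cancel-zero (ne ∘ -‿injective _) (proj₂ (entry-parts r c m mc)))
                      ; (suc u) (suc c) mu mc → proj₁ (entry-parts u c mu mc) } }
      -- No member has an entry in the first column, so the first index can stay outside.
      by-exit (no none) = record
        { member = false ∷ member C ; witness = suc (witness C) ; witness∈ = witness∈ C
        ; row-zero = λ { (suc u) mu → proj₁ (row-parts u mu) }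
        ; no-exit = λ { (suc u) zero mu _ → exit-zero u mu ; (suc u) (suc c) mu mc → proj₁ (entry-parts u c mu mc) } }
        where
        exit-zero : ∀ u → member C u ≡ true → M (suc u) zero ≡ + 0
        exit-zero u mu with M (suc u) zero ℤ.≟ + 0
        ... | yes e = e
        ... | no ne = ⊥-elim (none (u , mu , ne))
    by-schur : + 0 < pivot → + 0 < det n schur ⊎ ClosedSet n schur → + 0 < det (suc n) M ⊎ ClosedSet (suc n) M
    by-schur p (inj₁ d) = inj₁ (*->0⁻ (^->0 n p) (subst (+ 0 <_) (sym det-schur) (*->0 p d)))
    by-schur p (inj₂ C) = inj₂ (lift p C)
    by-pivot : _ → + 0 < det (suc n) M ⊎ ClosedSet (suc n) M
    by-pivot (tri< p _ _) = by-schur p (det-dichotomy n schur schur-Z)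
    by-pivot (tri≈ _ e _) = inj₂ (zero-pivot (sym e))
    by-pivot (tri> _ _ q) = ⊥-elim (ℤ.<-irrefl refl (ℤ.<-≤-trans q pivot-≥0))

  det-strict : ∀ n M → (∀ u v → u ≢ v → + 0 ≤ - M u v) → (∀ u → + 0 < sumFin n (M u)) → + 0 < det n M
  det-strict n M off rows with det-dichotomy n M (record { off-diagonal = off ; row-sum = λ u → ℤ.<⇒≤ (rows u) })
  ... | inj₁ d = d
  ... | inj₂ C = ⊥-elim (>0⇒≢0 (rows (witness C)) (row-zero C (witness C) (witness∈ C)))

  -- Laplacian matrices

  edge : Bool → ℤ
  edge true = + 1
  edge false = + 0

  edge-≥0 : ∀ b → + 0 ≤ edge b
  edge-≥0 true = ℤ.+≤+ ℕ.z≤n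
  edge-≥0 false = ℤ.+≤+ ℕ.z≤n

  adjacency : ∀ {n} → SimpleGraph n → Matrix n
  adjacency G u v = edge (adj G u v)

  deg : ∀ {n} → SimpleGraph n → Fin n → ℤ
  deg {n} G u = sumFin n (adjacency G u)

  lap : ∀ {n} → SimpleGraph n → Matrix n
  lap G u v = δ u v * deg G u - adjacency G u v

  characteristic : ∀ {n} → SimpleGraph n → ℤ → Matrix n
  characteristic G x u v = x * δ u v - lap G u v

  χ : ∀ {n} → SimpleGraph n → ℤ → ℤ
  χ {n} G x = det n (characteristic G x)

  -- The passage from the given definitions, with their decidable equality, to `δ` and the opaque
  -- arithmetic; all later arguments concern `χ`.
  charPolyL-χ : ∀ {n} (G : SimpleGraph n) x → charPolyL G x ≡ χ G x
  charPolyL-χ {n} G x = trans folded (det-cong n entrywise)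
    where
    opaque
      unfolding _+_
      folded : charPolyL G x ≡ det n (λ u v → (if does (u ≟ v) then x else + 0) - laplacian G u v)
      folded = refl
    opaque
      unfolding _+_
      degree-deg : ∀ u → degree G u ≡ deg G u
      degree-deg u = sum-cong n (λ w → unfold-edge (adj G u w))
        where
        unfold-edge : ∀ b → (if b then + 1 else + 0) ≡ edge b
        unfold-edge true = refl
        unfold-edge false = refl
    opaque
      unfolding _+_
      diagonal : ∀ x d → x - d ≡ x * + 1 - (+ 1 * d - + 0)
      diagonal = solve-∀
      minus-edge : ∀ b d → (if b then - (+ 1) else + 0) ≡ + 0 * d - edge b
      minus-edge true d = refl
      minus-edge false d = refl
      neg-one : ∀ b → (if b then ℤ.- (+ 1) else + 0) ≡ (if b then - (+ 1) else + 0)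
      neg-one b = refl
      off : ∀ x y → + 0 - y ≡ x * + 0 - y
      off = solve-∀
    entrywise : ∀ u v → (if does (u ≟ v) then x else + 0) - laplacian G u v ≡ characteristic G x u v
    entrywise u v with u ≟ v
    ... | yes refl = begin
      x - degree G u ≡⟨ cong (_-_ (x)) (degree-deg u) ⟩
      x - deg G u ≡⟨ diagonal x (deg G u) ⟩
      x * + 1 - (+ 1 * deg G u - edge false)
        ≡⟨ cong₂ (λ d b → x * d - (d * deg G u - edge b)) (δ-refl u) (irrefl G u) ⟨
      characteristic G x u u ∎
    ... | no u≢v = begin
      + 0 - (if adj G u v then ℤ.- (+ 1) else + 0)
        ≡⟨ cong (_-_ (+ 0)) (trans (neg-one (adj G u v)) (minus-edge (adj G u v) (deg G u))) ⟩
      + 0 - (+ 0 * deg G u - adjacency G u v) ≡⟨ off x _ ⟩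
      x * + 0 - (+ 0 * deg G u - adjacency G u v)
        ≡⟨ cong (λ d → x * d - (d * deg G u - adjacency G u v)) (δ-≢ u≢v) ⟨
      characteristic G x u v ∎

  sum-− : ∀ n (f g : Fin n → ℤ) → sumFin n (λ k → f k - g k) ≡ sumFin n f - sumFin n g
  sum-− n f g = trans (sum-cong n (λ k → as-linear (f k) (g k))) (trans (sum-linear n (+ 1) (- (+ 1)) f g) (sym (as-linear _ _)))
    where
    opaque
      unfolding _+_
      as-linear : ∀ x y → x - y ≡ + 1 * x + - (+ 1) * y
      as-linear = solve-∀

  opaque
    unfolding _+_
    x-x≡0 : ∀ x → x - x ≡ + 0
    x-x≡0 = ℤ.+-inverseʳ

  sum-δ-row : ∀ {n} (u : Fin n) → sumFin n (δ u) ≡ + 1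
  sum-δ-row {n} u = trans (sum-cong n (λ k → sym (*-identityʳ (δ u k)))) (sum-δ u (λ _ → + 1))

  module _ {n : ℕ} (G : SimpleGraph n) where

    adjacency-sym : ∀ u v → adjacency G u v ≡ adjacency G v u
    adjacency-sym u v = cong edge (symm G u v)

    lap-sym : ∀ u v → lap G u v ≡ lap G v u
    lap-sym u v with u ≟ v
    ... | yes refl = refl
    ... | no ne = cong₂ _-_ (trans (cong (_* deg G u) (δ-≢ ne)) (trans (*-zeroˡ _) (sym (trans (cong (_* deg G v) (δ-≢ (ne ∘ sym))) (*-zeroˡ _)))))
                          (adjacency-sym u v)

    lap-off : ∀ {u v} → u ≢ v → lap G u v ≡ - adjacency G u v
    lap-off {u} {v} ne = trans (cong (λ d → d * deg G u - adjacency G u v) (δ-≢ ne)) (identity _ _)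
      where
      opaque
        unfolding _+_
        identity : ∀ d a → + 0 * d - a ≡ - a
        identity = solve-∀

    lap-row-sum : ∀ u → sumFin n (lap G u) ≡ + 0
    lap-row-sum u = begin
      sumFin n (lap G u) ≡⟨ sum-− n (λ v → δ u v * deg G u) (adjacency G u) ⟩
      sumFin n (λ v → δ u v * deg G u) - deg G u ≡⟨ cong (_- deg G u) (sum-δ u (λ _ → deg G u)) ⟩
      deg G u - deg G u ≡⟨ x-x≡0 _ ⟩
      + 0 ∎

    lap-column-sum : ∀ v → sumFin n (λ u → lap G u v) ≡ + 0
    lap-column-sum v = trans (sum-cong n (λ u → lap-sym u v)) (lap-row-sum v)

  form-head-scale : ∀ {n m D} → Form {m} (suc n) D → ∀ x a R → D ((λ c → x * a c) ∷ R) ≡ x * D (a ∷ R)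
  form-head-scale {D = D} (cons c l _ _) x a R =
    trans (c (∷-cong (λ j → add-zero x (a j)) (λ _ _ → refl))) (trans (l x (+ 0) a a R) (sym (add-zero x _)))
    where
    opaque
      unfolding _+_
      add-zero : ∀ x y → x * y ≡ x * y + + 0 * y
      add-zero = solve-∀

  -- Multiplication from the left by this matrix adds all other rows to the first.
  gather : ∀ k → Matrix (suc k)
  gather k = (λ _ → + 1) ∷ (λ r → δ (suc r))

  det-gather : ∀ k → det (suc k) (gather k) ≡ + 1
  det-gather k = trans (det-lower-zero k (gather k) (λ _ → refl)) (trans (*-identityˡ _) (det-identity k))

  gather-· : ∀ k (M : Matrix (suc k)) → (gather k · M) ≈ ((λ c → sumFin (suc k) (λ u → M u c)) ∷ (M ∘ suc))
  gather-· k M zero c = sum-cong (suc k) (λ u → *-identityˡ (M u c))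
  gather-· k M (suc r) c = sum-δ (suc r) (λ u → M u c)

  det-gathered : ∀ k (M : Matrix (suc k)) → det (suc k) M ≡ det (suc k) ((λ c → sumFin (suc k) (λ u → M u c)) ∷ (M ∘ suc))
  det-gathered k M = begin
    det (suc k) M ≡⟨ trans (cong (_* det (suc k) M) (det-gather k)) (*-identityˡ _) ⟨
    det (suc k) (gather k) * det (suc k) M ≡⟨ det-· (suc k) (gather k) M ⟨
    det (suc k) (gather k · M) ≡⟨ det-cong (suc k) (gather-· k M) ⟩
    _ ∎

  -- The quotient of the characteristic polynomial by its trivial factor x.
  χ⁺-matrix : ∀ {k} → SimpleGraph (suc k) → ℤ → Matrix (suc k)
  χ⁺-matrix G x = (λ _ → + 1) ∷ (characteristic G x ∘ suc)

  χ⁺ : ∀ {k} → SimpleGraph (suc k) → ℤ → ℤ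
  χ⁺ {k} G x = det (suc k) (χ⁺-matrix G x)

  -- The columns of the Laplacian sum to zero, so gathering turns the first row of `xI - L` into the
  -- constant row `x`, from which `x` is factored out.
  χ-χ⁺ : ∀ {k} (G : SimpleGraph (suc k)) x → χ G x ≡ x * χ⁺ G x
  χ-χ⁺ {k} G x = begin
    det (suc k) (characteristic G x) ≡⟨ det-gathered k (characteristic G x) ⟩
    _ ≡⟨ det-cong (suc k) (∷-cong column (λ _ _ → refl)) ⟩
    det (suc k) ((λ _ → x * + 1) ∷ (characteristic G x ∘ suc))
      ≡⟨ form-head-scale (det-form (suc k)) x (λ _ → + 1) (characteristic G x ∘ suc) ⟩
    x * χ⁺ G x ∎
    where
    column : ∀ c → sumFin (suc k) (λ u → x * δ u c - lap G u c) ≡ x * + 1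
    column c = begin
      sumFin (suc k) (λ u → x * δ u c - lap G u c) ≡⟨ sum-− (suc k) _ _ ⟩
      sumFin (suc k) (λ u → x * δ u c) - sumFin (suc k) (λ u → lap G u c)
        ≡⟨ cong₂ _-_ (sum-δʳ c (λ _ → x)) (lap-column-sum G c) ⟩
      x - + 0 ≡⟨ tidy x ⟩
      x * + 1 ∎
      where
      opaque
        unfolding _+_
        tidy : ∀ x → x - + 0 ≡ x * + 1
        tidy = solve-∀

  sum-ones : ∀ n → sumFin n (λ _ → + 1) ≡ + n
  sum-ones zero = sum-nil _
  sum-ones (suc n) = trans (sum-suc n _) (trans (cong (_+_ (+ 1)) (sum-ones n)) (pos-suc n))

  -- Complements and disconnected graphs

  complement : ∀ {n} → SimpleGraph n → SimpleGraph n
  complement {n} G = record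
    { adj = λ u v → not (does (u ≟ v)) ∧ not (adj G u v)
    ; symm = λ u v → cong₂ (λ a b → not a ∧ not b) (does-sym u v) (symm G u v)
    ; irrefl = λ v → cong (λ b → not b ∧ not (adj G v v)) (dec-true (v ≟ v) refl) }
    where
    does-sym : ∀ (u v : Fin n) → does (u ≟ v) ≡ does (v ≟ u)
    does-sym u v with u ≟ v
    ... | yes refl = sym (dec-true (u ≟ u) refl)
    ... | no ne = sym (dec-false (v ≟ u) (ne ∘ sym))

  module _ {n : ℕ} (G : SimpleGraph n) where

    adjacency-complement : ∀ u v → adjacency (complement G) u v ≡ + 1 - δ u v - adjacency G u v
    adjacency-complement u v with u ≟ v
    ... | yes refl = sym (trans (cong₂ (λ d b → + 1 - d - edge b) (δ-refl u) (irrefl G u)) computed)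
      where
      opaque
        unfolding _+_
        computed : + 1 - + 1 - + 0 ≡ + 0
        computed = refl
    ... | no ne = sym (trans (cong (λ d → + 1 - d - adjacency G u v) (δ-≢ ne)) (negated (adj G u v)))
      where
      opaque
        unfolding _+_
        negated : ∀ b → + 1 - + 0 - edge b ≡ edge (not b)
        negated true = refl
        negated false = refl

    deg-complement : ∀ u → deg (complement G) u ≡ + n - + 1 - deg G u
    deg-complement u = begin
      deg (complement G) u ≡⟨ sum-cong n (adjacency-complement u) ⟩
      _ ≡⟨ trans (sum-− n _ _) (cong (_- deg G u) (sum-− n _ _)) ⟩
      sumFin n (λ _ → + 1) - sumFin n (δ u) - deg G u ≡⟨ cong₂ (λ a b → a - b - deg G u) (sum-ones n) (sum-δ-row u) ⟩
      _ ∎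

    lap-complement : ∀ u v → lap (complement G) u v ≡ + n * δ u v - + 1 - lap G u v
    lap-complement u v = trans (cong₂ (λ d a → δ u v * d - a) (deg-complement u) (adjacency-complement u v)) (identity _ _ _ _)
      where
      opaque
        unfolding _+_
        identity : ∀ e n d a → e * (n - + 1 - d) - (+ 1 - e - a) ≡ n * e - + 1 - (e * d - a)
        identity = solve-∀

  -- With `n` the order and `J` the all-ones matrix, the complement has Laplacian `nI - J - L`. The
  -- all-ones first row of `χ⁺-matrix` absorbs `J`, so the two matrices differ by the left factor
  -- `E`, which negates the other `k` rows and adds the first one to them.
  χ⁺-complement : ∀ {k} (G : SimpleGraph (suc k)) x → χ⁺ (complement G) x ≡ (- (+ 1)) ^ k * χ⁺ G (+ suc k - x)
  χ⁺-complement {k} G x = begin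
    det (suc k) (χ⁺-matrix (complement G) x) ≡⟨ det-cong (suc k) entries ⟩
    det (suc k) (E · χ⁺-matrix G y) ≡⟨ det-· (suc k) E _ ⟩
    det (suc k) E * χ⁺ G y ≡⟨ cong (_* χ⁺ G y) det-E ⟩
    (- (+ 1)) ^ k * χ⁺ G y ∎
    where
    y = + suc k - x
    E : Matrix (suc k)
    E zero c = δ zero c
    E (suc r) zero = + 1
    E (suc r) (suc c) = - (+ 1) * δ r c
    det-E : det (suc k) E ≡ (- (+ 1)) ^ k
    det-E = begin
      det (suc k) E ≡⟨ det-unit-row k E (λ _ → refl) ⟩
      + 1 * det k (λ r c → - (+ 1) * δ r c) ≡⟨ *-identityˡ _ ⟩
      _ ≡⟨ det-scale k (- (+ 1)) δ ⟩
      (- (+ 1)) ^ k * det k δ ≡⟨ trans (cong ((- (+ 1)) ^ k *_) (det-identity k)) (*-identityʳ _) ⟩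
      _ ∎
    opaque
      unfolding _+_
      identity : ∀ n x e l → x * e - (n * e - + 1 - l) ≡ + 1 * + 1 + - (+ 1) * ((n - x) * e - l)
      identity = solve-∀
    entries : χ⁺-matrix (complement G) x ≈ (E · χ⁺-matrix G y)
    entries zero c = sym (sum-δ zero (λ u → χ⁺-matrix G y u c))
    entries (suc r) c = begin
      x * δ (suc r) c - lap (complement G) (suc r) c ≡⟨ cong (_-_ (x * δ (suc r) c)) (lap-complement G (suc r) c) ⟩
      _ ≡⟨ identity (+ suc k) x (δ (suc r) c) (lap G (suc r) c) ⟩
      + 1 * + 1 + - (+ 1) * characteristic G y (suc r) c
        ≡⟨ cong (λ z → + 1 * + 1 + - (+ 1) * z) (sum-δ r (λ u → characteristic G y (suc u) c)) ⟨
      + 1 * + 1 + - (+ 1) * sumFin k (λ u → δ r u * characteristic G y (suc u) c)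
        ≡⟨ cong (_+_ (+ 1 * + 1)) (trans (sym (sum-*ˡ k (- (+ 1)) _)) (sum-cong k (λ u → sym (*-assoc _ _ _)))) ⟩
      + 1 * + 1 + sumFin k (λ u → - (+ 1) * δ r u * characteristic G y (suc u) c)
        ≡⟨ sum-suc k _ ⟨
      _ ∎

  -- The trivial eigenvalue 0 of either graph does not take part in the reflection; hence the extra
  -- factors on both sides.
  χ-complement : ∀ {k} (G : SimpleGraph (suc k)) x →
    (+ suc k - x) * χ (complement G) x ≡ (- (+ 1)) ^ k * (x * χ G (+ suc k - x))
  χ-complement {k} G x = begin
    y * χ (complement G) x ≡⟨ cong (y *_) (trans (χ-χ⁺ (complement G) x) (cong (x *_) (χ⁺-complement G x))) ⟩
    y * (x * (s * χ⁺ G y)) ≡⟨ regroup y x s _ ⟩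
    s * (x * (y * χ⁺ G y)) ≡⟨ cong (λ z → s * (x * z)) (χ-χ⁺ G y) ⟨
    s * (x * χ G y) ∎
    where
    y = + suc k - x
    s = (- (+ 1)) ^ k
    opaque
      unfolding _+_
      regroup : ∀ y x s g → y * (x * (s * g)) ≡ s * (x * (y * g))
      regroup = solve-∀

  -- A two-colouring of the vertices whose colour classes are unions of components.
  record Splitting {n : ℕ} (G : SimpleGraph n) : Set where
    field
      colour : Fin n → Bool
      closed : ∀ u v → colour u ≢ colour v → adj G u v ≡ false
  open Splitting

  -- Both colours occur, so the graph is disconnected. Vertex `zero` serves as reference because it
  -- is the vertex grounded in `split-at-double-zero`.
  record ProperSplitting {k : ℕ} (G : SimpleGraph (suc k)) : Set where
    field
      splitting : Splitting G
      other     : Fin (suc k)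
      differs   : colour splitting other ≢ colour splitting zero
  open ProperSplitting

  -1^-≢0 : ∀ k → (- (+ 1)) ^ k ≢ + 0
  -1^-≢0 zero ()
  -1^-≢0 (suc k) e with *-zero-product (- (+ 1)) _ e
  ... | inj₁ z = contradiction z neg-one≢0
    where
    opaque
      unfolding _+_
      neg-one≢0 : - (+ 1) ≢ + 0
      neg-one≢0 ()
  ... | inj₂ z = -1^-≢0 k z

  opaque
    unfolding _+_
    *-1 : ∀ x → - (+ 1) * x ≡ - x
    *-1 = solve-∀
    neg-neg : ∀ x → - - x ≡ x
    neg-neg = solve-∀

  -- Matrix-tree theorem: up to sign and the factor n, χ⁺ at 0 is the determinant of
  -- the Laplacian with its first diagonal entry increased by one.
  split-at-double-zero : ∀ {k} (G : SimpleGraph (suc k)) → χ⁺ G (+ 0) ≡ + 0 → ProperSplitting G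
  split-at-double-zero {k} G e = from-dichotomy (det-dichotomy (suc k) grounded dominant)
    where
    E₀₀ : Matrix (suc k)
    E₀₀ = δ zero ∷ (λ _ _ → + 0)
    grounded : Matrix (suc k)
    grounded u v = lap G u v + E₀₀ u v
    reduced : Matrix k
    reduced r c = lap G (suc r) (suc c)
    x+0 : ∀ {x y} → y ≡ + 0 → x + y ≡ x
    x+0 refl = +-identityʳ _
    E₀₀-column : ∀ c → sumFin (suc k) (λ u → E₀₀ u c) ≡ δ zero c
    E₀₀-column c = trans (sum-suc k _) (x+0 (sum-zero k (λ _ → refl)))
    det-grounded : det (suc k) grounded ≡ det k reduced
    det-grounded = begin
      det (suc k) grounded ≡⟨ det-gathered k grounded ⟩
      _ ≡⟨ det-cong (suc k) (∷-cong (λ c → trans (sum-+ (suc k) _ _) (cong₂ _+_ (lap-column-sum G c) (E₀₀-column c)))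
             (λ r c → +-identityʳ (lap G (suc r) c))) ⟩
      det (suc k) ((λ c → + 0 + δ zero c) ∷ (λ r → lap G (suc r)))
        ≡⟨ det-unit-row k _ (λ _ → +-identityˡ _) ⟩
      (+ 0 + + 1) * det k reduced ≡⟨ trans (cong (_* det k reduced) (+-identityˡ _)) (*-identityˡ _) ⟩
      det k reduced ∎
    -- Multiplication from the right by this matrix replaces the first column by the row sums, which
    -- are `+ suc k` for the row of ones and zero for the Laplacian rows.
    column-sums : Matrix (suc k)
    column-sums u zero = + 1
    column-sums u (suc c) = δ u (suc c)
    det-column-sums : det (suc k) column-sums ≡ + 1
    det-column-sums = trans (det-unit-row k column-sums (λ _ → refl)) (trans (*-identityˡ _) (det-identity k))
    X : Matrix (suc k)
    X = χ⁺-matrix G (+ 0)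
    X-row : ∀ r c → X (suc r) c ≡ - lap G (suc r) c
    X-row r c = identity _ _
      where
      opaque
        unfolding _+_
        identity : ∀ d l → + 0 * d - l ≡ - l
        identity = solve-∀
    χ⁺-reduced : χ⁺ G (+ 0) ≡ + suc k * ((- (+ 1)) ^ k * det k reduced)
    χ⁺-reduced = begin
      det (suc k) X ≡⟨ trans (cong (det (suc k) X *_) det-column-sums) (*-identityʳ _) ⟨
      det (suc k) X * det (suc k) column-sums ≡⟨ det-· (suc k) X column-sums ⟨
      det (suc k) (X · column-sums) ≡⟨ det-lower-zero k _ (λ r → begin
          sumFin (suc k) (λ u → X (suc r) u * + 1) ≡⟨ sum-cong (suc k) (λ u → trans (*-identityʳ _) (X-row r u)) ⟩
          sumFin (suc k) (λ u → - lap G (suc r) u) ≡⟨ sum-neg (suc k) _ ⟩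
          - sumFin (suc k) (lap G (suc r)) ≡⟨ trans (cong -_ (lap-row-sum G (suc r))) -0≡0 ⟩
          + 0 ∎) ⟩
      (X · column-sums) zero zero * det k (λ r c → (X · column-sums) (suc r) (suc c))
        ≡⟨ cong₂ _*_ (trans (sum-cong (suc k) (λ _ → *-identityʳ (+ 1))) (sum-ones (suc k)))
                     (det-cong k (λ r c → trans (sum-δʳ (suc c) (X (suc r))) (trans (X-row r (suc c)) (sym (*-1 _))))) ⟩
      + suc k * det k (λ r c → - (+ 1) * reduced r c) ≡⟨ cong (+ suc k *_) (det-scale k (- (+ 1)) reduced) ⟩
      _ ∎
    grounded-zero : det (suc k) grounded ≡ + 0
    grounded-zero = trans det-grounded (*-cancel-zero (-1^-≢0 k) (*-cancel-zero (λ ()) (trans (sym χ⁺-reduced) e)))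
    E₀₀-off : ∀ u v → u ≢ v → E₀₀ u v ≡ + 0
    E₀₀-off zero v ne = δ-≢ ne
    E₀₀-off (suc u) v ne = refl
    grounded-off : ∀ u v → u ≢ v → grounded u v ≡ - adjacency G u v
    grounded-off u v ne = trans (cong₂ _+_ (lap-off G ne) (E₀₀-off u v ne)) (+-identityʳ _)
    grounded-row : ∀ u → sumFin (suc k) (grounded u) ≡ sumFin (suc k) (E₀₀ u)
    grounded-row u = trans (sum-+ (suc k) _ _) (trans (cong (_+ sumFin (suc k) (E₀₀ u)) (lap-row-sum G u)) (+-identityˡ _))
    E₀₀-≥0 : ∀ u → + 0 ≤ sumFin (suc k) (E₀₀ u)
    E₀₀-≥0 zero = subst (+ 0 ≤_) (sym (sum-δ-row {suc k} zero)) (ℤ.+≤+ ℕ.z≤n)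
    E₀₀-≥0 (suc u) = ℤ.≤-reflexive (sym (sum-zero (suc k) (λ _ → refl)))
    dominant : DominantZ (suc k) grounded
    dominant = record
      { off-diagonal = λ u v ne → subst (+ 0 ≤_) (sym (trans (cong -_ (grounded-off u v ne)) (neg-neg _))) (edge-≥0 (adj G u v))
      ; row-sum = λ u → subst (+ 0 ≤_) (sym (grounded-row u)) (E₀₀-≥0 u) }
    from-dichotomy : + 0 < det (suc k) grounded ⊎ ClosedSet (suc k) grounded → ProperSplitting G
    from-dichotomy (inj₁ p) = ⊥-elim (>0⇒≢0 p grounded-zero)
    from-dichotomy (inj₂ C) = record
      { splitting = record { colour = member C ; closed = closed-under }
      ; other = witness C
      ; differs = λ e → ground∉ (trans (sym e) (witness∈ C)) }
      where
      -- The grounded row sums to one, so a closed set misses vertex `zero`; being inhabited, it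
      -- gives a colouring with both colours.
      ground∉ : member C zero ≢ true
      ground∉ m with trans (sym (row-zero C zero m)) (trans (grounded-row zero) (sum-δ-row {suc k} zero))
      ... | ()
      edge-zero : ∀ b → - edge b ≡ + 0 → b ≡ false
      edge-zero false _ = refl
      edge-zero true e with trans (sym (neg-neg (+ 1))) (trans (cong -_ e) -0≡0)
      ... | ()
      exit : ∀ u v → member C u ≡ true → member C v ≡ false → adj G u v ≡ false
      exit u v mu mv = edge-zero _ (trans (sym (grounded-off u v u≢v)) (no-exit C u v mu mv))
        where
        u≢v : u ≢ v
        u≢v refl with trans (sym mu) mv
        ... | ()
      closed-under : ∀ u v → member C u ≢ member C v → adj G u v ≡ false
      closed-under u v ne with member C u in eu | member C v in ev
      ... | true | true = ⊥-elim (ne refl)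
      ... | false | false = ⊥-elim (ne refl)
      ... | true | false = exit u v eu ev
      ... | false | true = trans (symm G u v) (exit v u ev eu)

  same : Bool → Bool → ℤ
  same true b = edge b
  same false b = edge (not b)

  class-size : ∀ {n} {G : SimpleGraph n} → Splitting G → Fin n → ℤ
  class-size {n} S u = sumFin n (λ v → same (colour S u) (colour S v))

  -- With J the matrix of the partition, LJ = 0, so (xI - L)(xI - J) = x(xI - L - J),
  -- and xI - L - J is strictly diagonally dominant when x exceeds all class sizes.
  eigenvalue≤class : ∀ {n} (G : SimpleGraph n) (S : Splitting G) x → + 0 < x → χ G x ≡ + 0 → ∃[ u ] (x ≤ class-size S u)
  eigenvalue≤class {n} G S x x>0 e with any? (λ u → x ≤? class-size S u)
  ... | yes found = found
  ... | no none = ⊥-elim (>0⇒≢0 (*->0 (^->0 n x>0) det-Z) scaled-zero)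
    where
    J Z : Matrix n
    J u v = same (colour S u) (colour S v)
    Z u v = characteristic G x u v - J u v
    L = lap G
    row : ∀ u → sumFin n (Z u) ≡ x - class-size S u
    row u = begin
      sumFin n (Z u) ≡⟨ sum-− n _ _ ⟩
      sumFin n (λ v → x * δ u v - L u v) - class-size S u
        ≡⟨ cong (_- class-size S u) (trans (sum-− n _ _) (cong₂ _-_ (trans (sum-*ˡ n x _) (cong (x *_) (sum-δ-row u))) (lap-row-sum G u))) ⟩
      x * + 1 - + 0 - class-size S u ≡⟨ cong (_- class-size S u) (tidy x) ⟩
      x - class-size S u ∎
      where
      opaque
        unfolding _+_
        tidy : ∀ x → x * + 1 - + 0 ≡ x
        tidy = solve-∀
    same-refl : ∀ b → same b b ≡ + 1
    same-refl true = refl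
    same-refl false = refl
    same-≢ : ∀ a b → a ≢ b → same a b ≡ + 0
    same-≢ true true ne = ⊥-elim (ne refl)
    same-≢ true false ne = refl
    same-≢ false true ne = refl
    same-≢ false false ne = ⊥-elim (ne refl)
    opaque
      unfolding _+_
      edge≤1 : ∀ b → + 0 ≤ + 1 - edge b
      edge≤1 true = ℤ.+≤+ ℕ.z≤n
      edge≤1 false = ℤ.+≤+ ℕ.z≤n
      off-identity : ∀ x a j → - (x * + 0 - - a - j) ≡ j - a
      off-identity = solve-∀
    -- Off the diagonal `Z` is the adjacency matrix minus `J`, which is nonpositive because edges
    -- join vertices of one colour only.
    adjacency≤J : ∀ u v → + 0 ≤ J u v - adjacency G u v
    adjacency≤J u v with colour S u Bool.≟ colour S v
    ... | yes eq = subst (λ z → + 0 ≤ z - adjacency G u v)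
                     (sym (trans (cong (λ b → same b (colour S v)) eq) (same-refl (colour S v)))) (edge≤1 (adj G u v))
    ... | no ne = subst (+ 0 ≤_) (sym (trans (cong₂ (λ j b → j - edge b) (same-≢ _ _ ne) (closed S u v ne)) (x-x≡0 (+ 0)))) ℤ.≤-refl
    det-Z : + 0 < det n Z
    det-Z = det-strict n Z
      (λ u v ne → subst (+ 0 ≤_) (sym (trans (cong -_ (cong₂ (λ d l → x * d - l - J u v) (δ-≢ ne) (lap-off G ne))) (off-identity x _ _)))
                    (adjacency≤J u v))
      (λ u → subst (+ 0 <_) (sym (row u)) (-‿>0 (ℤ.≰⇒> (λ le → none (u , le)))))
    LJ : ∀ u v → sumFin n (λ w → L u w * J w v) ≡ + 0
    LJ u v = begin
      sumFin n (λ w → L u w * J w v) ≡⟨ sum-cong n (λ w → trans (constant w) (*-comm _ _)) ⟩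
      sumFin n (λ w → J u v * L u w) ≡⟨ sum-*ˡ n (J u v) (L u) ⟩
      J u v * sumFin n (L u) ≡⟨ trans (cong (J u v *_) (lap-row-sum G u)) (*-zeroʳ _) ⟩
      + 0 ∎
      where
      constant : ∀ w → L u w * J w v ≡ L u w * J u v
      constant w with colour S u Bool.≟ colour S w
      ... | yes eq = cong (λ b → L u w * same b (colour S v)) (sym eq)
      ... | no ne = trans (vanish (J w v)) (sym (vanish (J u v)))
        where
        vanish : ∀ j → L u w * j ≡ + 0
        vanish j = trans (cong (_* j) (trans (lap-off G (λ eq → ne (cong (colour S) eq)))
                     (trans (cong (λ b → - edge b) (closed S u w ne)) -0≡0))) (*-zeroˡ j)
    product : (characteristic G x · (λ u v → x * δ u v - J u v)) ≈ (λ u v → x * Z u v)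
    product u v = begin
      sumFin n (λ w → characteristic G x u w * (x * δ w v - J w v))
        ≡⟨ sum-cong n (λ w → expand x (δ w v) (δ u w) (L u w) (J w v)) ⟩
      sumFin n (λ w → x * (characteristic G x u w * δ w v - δ u w * J w v) + L u w * J w v)
        ≡⟨ trans (sum-+ n _ _) (trans (cong₂ _+_ (sum-*ˡ n x _) (LJ u v)) (+-identityʳ _)) ⟩
      x * sumFin n (λ w → characteristic G x u w * δ w v - δ u w * J w v)
        ≡⟨ cong (x *_) (trans (sum-− n _ _) (cong₂ _-_ (sum-δʳ v (characteristic G x u)) (sum-δ u (λ w → J w v)))) ⟩
      x * Z u v ∎
      where
      opaque
        unfolding _+_
        expand : ∀ x d d' l j → (x * d' - l) * (x * d - j) ≡ x * ((x * d' - l) * d - d' * j) + l * j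
        expand = solve-∀
    scaled-zero : x ^ n * det n Z ≡ + 0
    scaled-zero = begin
      x ^ n * det n Z ≡⟨ det-scale n x Z ⟨
      det n (λ u v → x * Z u v) ≡⟨ det-cong n product ⟨
      det n (characteristic G x · (λ u v → x * δ u v - J u v)) ≡⟨ det-· n _ _ ⟩
      χ G x * _ ≡⟨ trans (cong (_* det n (λ u v → x * δ u v - J u v)) e) (*-zeroˡ _) ⟩
      + 0 ∎

  -- Splitting off isolated vertices

  sum-punchIn : ∀ k (w : Fin (suc k)) (f : Fin (suc k) → ℤ) → f w + sumFin k (f ∘ punchIn w) ≡ sumFin (suc k) f
  sum-punchIn k zero f = sym (sum-suc k f)
  sum-punchIn (suc k) (suc w) f = begin
    f (suc w) + sumFin (suc k) (f ∘ punchIn (suc w)) ≡⟨ cong (_+_ (f (suc w))) (sum-suc k _) ⟩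
    f (suc w) + (f zero + sumFin k (f ∘ suc ∘ punchIn w)) ≡⟨ swap _ _ _ ⟩
    f zero + (f (suc w) + sumFin k (f ∘ suc ∘ punchIn w)) ≡⟨ cong (_+_ (f zero)) (sum-punchIn k w (f ∘ suc)) ⟩
    f zero + sumFin (suc k) (f ∘ suc) ≡⟨ sum-suc (suc k) f ⟨
    sumFin (suc (suc k)) f ∎
    where
    opaque
      unfolding _+_
      swap : ∀ x y z → x + (y + z) ≡ y + (x + z)
      swap = solve-∀

  relabel : ∀ {n m} → (Fin m → Fin n) → SimpleGraph n → SimpleGraph m
  relabel σ G = record
    { adj = λ u v → adj G (σ u) (σ v) ; symm = λ u v → symm G (σ u) (σ v) ; irrefl = λ v → irrefl G (σ v) }

  -- Conjugation by the permutation matrix P of σ; only P Pᵀ = I is needed.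
  det-relabel : ∀ n (σ : Fin n → Fin n) → (∀ {u v} → σ u ≡ σ v → u ≡ v) → (M : Matrix n) →
    det n (λ u v → M (σ u) (σ v)) ≡ det n M
  det-relabel n σ inj M = begin
    det n (λ u v → M (σ u) (σ v)) ≡⟨ det-cong n (λ u v → trans (sum-δ (σ u) _) (trans (sum-cong n (λ y → *-comm (M (σ u) y) _)) (sum-δ (σ v) (M (σ u))))) ⟨
    det n (P · (M · Pᵀ)) ≡⟨ trans (det-· n P _) (cong (det n P *_) (det-· n M Pᵀ)) ⟩
    det n P * (det n M * det n Pᵀ) ≡⟨ regroup _ _ _ ⟩
    det n P * det n Pᵀ * det n M ≡⟨ cong (_* det n M) (trans (sym (det-· n P Pᵀ)) (trans (det-cong n PPᵀ) (det-identity n))) ⟩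
    + 1 * det n M ≡⟨ *-identityˡ _ ⟩
    det n M ∎
    where
    P Pᵀ : Matrix n
    P u z = δ (σ u) z
    Pᵀ z v = δ (σ v) z
    PPᵀ : (P · Pᵀ) ≈ δ
    PPᵀ u v = trans (sum-δ (σ u) (δ (σ v))) (δ-injective u v)
      where
      δ-injective : ∀ u v → δ (σ v) (σ u) ≡ δ u v
      δ-injective u v with u ≟ v
      ... | yes refl = trans (δ-refl (σ u)) (sym (δ-refl u))
      ... | no ne = trans (δ-≢ (ne ∘ sym ∘ inj)) (sym (δ-≢ ne))
    opaque
      unfolding _+_
      regroup : ∀ p m q → p * (m * q) ≡ p * q * m
      regroup = solve-∀

  χ-cong : ∀ {n} (G H : SimpleGraph n) → (∀ u v → adj G u v ≡ adj H u v) → ∀ x → χ G x ≡ χ H x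
  χ-cong {n} G H e x = det-cong n (λ u v → cong (_-_ (x * δ u v)) (cong₂ (λ d b → δ u v * d - edge b)
    (sum-cong n (λ w → cong edge (e u w))) (e u v)))

  χ-isolated : ∀ {k} (G : SimpleGraph (suc k)) → (∀ v → adj G zero v ≡ false) → ∀ x → χ G x ≡ x * χ (relabel suc G) x
  χ-isolated {k} G iso x = trans (det-unit-row k (characteristic G x) first-row)
    (cong₂ _*_ corner (det-cong k (λ u v → cong (_-_ (x * δ u v)) (cong (λ d → δ u v * d - adjacency G (suc u) (suc v)) (deg-rest u)))))
    where
    opaque
      unfolding _+_
      zeros : ∀ x d → x * + 0 - (+ 0 * d - + 0) ≡ + 0
      zeros = solve-∀
      ones : ∀ x → x * + 1 - (+ 1 * + 0 - + 0) ≡ x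
      ones = solve-∀
    first-row : ∀ c → characteristic G x zero (suc c) ≡ + 0
    first-row c = trans (cong (λ b → x * + 0 - (+ 0 * deg G zero - edge b)) (iso (suc c))) (zeros x _)
    corner : characteristic G x zero zero ≡ x
    corner = trans (cong₂ (λ d b → x * + 1 - (+ 1 * d - edge b)) (sum-zero (suc k) (λ v → cong edge (iso v))) (iso zero)) (ones x)
    deg-rest : ∀ u → deg G (suc u) ≡ deg (relabel suc G) u
    deg-rest u = trans (sum-suc k _) (trans (cong (λ b → edge b + deg (relabel suc G) u) (trans (symm G (suc u) zero) (iso (suc u)))) (+-identityˡ _))

  χ-delete-isolated : ∀ {k} (G : SimpleGraph (suc k)) w → (∀ v → adj G w v ≡ false) → ∀ x → χ G x ≡ x * χ (relabel (punchIn w) G) x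
  χ-delete-isolated {k} G w iso x = begin
    χ G x ≡⟨ det-relabel (suc k) σ σ-injective (characteristic G x) ⟨
    det (suc k) (λ u v → characteristic G x (σ u) (σ v)) ≡⟨ det-cong (suc k) entries ⟨
    χ (relabel σ G) x ≡⟨ χ-isolated (relabel σ G) (λ v → iso (σ v)) x ⟩
    x * χ (relabel (punchIn w) G) x ∎
    where
    σ : Fin (suc k) → Fin (suc k)
    σ = w ∷ punchIn w
    σ-injective : ∀ {u v} → σ u ≡ σ v → u ≡ v
    σ-injective {zero} {zero} e = refl
    σ-injective {zero} {suc v} e = ⊥-elim (punchInᵢ≢i w v (sym e))
    σ-injective {suc u} {zero} e = ⊥-elim (punchInᵢ≢i w u e)
    σ-injective {suc u} {suc v} e = cong suc (punchIn-injective w u v e)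
    δ-σ : ∀ u v → δ u v ≡ δ (σ u) (σ v)
    δ-σ u v with u ≟ v
    ... | yes refl = trans (δ-refl u) (sym (δ-refl (σ u)))
    ... | no ne = trans (δ-≢ ne) (sym (δ-≢ (ne ∘ σ-injective)))
    deg-σ : ∀ u → deg (relabel σ G) u ≡ deg G (σ u)
    deg-σ u = trans (sum-suc k _) (sum-punchIn k w (adjacency G (σ u)))
    entries : ∀ u v → characteristic (relabel σ G) x u v ≡ characteristic G x (σ u) (σ v)
    entries u v = cong₂ (λ e d → x * e - (e * d - adjacency G (σ u) (σ v))) (δ-σ u v) (deg-σ u)

  class-bound : ∀ {k} {G : SimpleGraph k} (S : Splitting G) u w → colour S w ≢ colour S u → class-size S u + + 1 ≤ + k
  class-bound {k} S u w ne = subst₂ _≤_ (trans (sum-+ k _ _) (cong (_+_ (class-size S u)) (sum-δ-row w))) (sum-ones k) (sum-mono k pointwise)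
    where
    opaque
      unfolding _+_
      same≤1 : ∀ a b → same a b + + 0 ≤ + 1
      same≤1 true true = ℤ.≤-refl
      same≤1 true false = ℤ.+≤+ ℕ.z≤n
      same≤1 false true = ℤ.+≤+ ℕ.z≤n
      same≤1 false false = ℤ.≤-refl
    same-≢ : ∀ a b → b ≢ a → same a b + + 1 ≤ + 1
    same-≢ true true ne = ⊥-elim (ne refl)
    same-≢ true false ne = ℤ.≤-reflexive (+-identityˡ _)
    same-≢ false true ne = ℤ.≤-reflexive (+-identityˡ _)
    same-≢ false false ne = ⊥-elim (ne refl)
    pointwise : ∀ z → same (colour S u) (colour S z) + δ w z ≤ + 1
    pointwise z with w ≟ z
    ... | yes refl = subst (λ d → same (colour S u) (colour S z) + d ≤ + 1) (sym (δ-refl z)) (same-≢ (colour S u) (colour S z) ne)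
    ... | no w≢z = subst (λ d → same (colour S u) (colour S z) + d ≤ + 1) (sym (δ-≢ w≢z)) (same≤1 (colour S u) (colour S z))

  class-bound₂ : ∀ {k} {G : SimpleGraph k} (S : Splitting G) u w v → w ≢ v → colour S w ≢ colour S u → colour S v ≢ colour S u →
    class-size S u + + 1 + + 1 ≤ + k
  class-bound₂ {k} S u w v w≢v cw cv =
    subst₂ _≤_ (trans (sum-+ k _ _) (cong₂ _+_ (trans (sum-+ k _ _) (cong (_+_ (class-size S u)) (sum-δ-row w))) (sum-δ-row v)))
      (sum-ones k) (sum-mono k pointwise)
    where
    opaque
      unfolding _+_
      same≤1 : ∀ a b → same a b + + 0 + + 0 ≤ + 1
      same≤1 true true = ℤ.≤-refl
      same≤1 true false = ℤ.+≤+ ℕ.z≤n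
      same≤1 false true = ℤ.+≤+ ℕ.z≤n
      same≤1 false false = ℤ.≤-refl
      same-≢₁ : ∀ a b → b ≢ a → same a b + + 1 + + 0 ≤ + 1
      same-≢₁ true true ne = ⊥-elim (ne refl)
      same-≢₁ true false ne = ℤ.≤-refl
      same-≢₁ false true ne = ℤ.≤-refl
      same-≢₁ false false ne = ⊥-elim (ne refl)
      same-≢₂ : ∀ a b → b ≢ a → same a b + + 0 + + 1 ≤ + 1
      same-≢₂ true true ne = ⊥-elim (ne refl)
      same-≢₂ true false ne = ℤ.≤-refl
      same-≢₂ false true ne = ℤ.≤-refl
      same-≢₂ false false ne = ⊥-elim (ne refl)
    at : Fin k → ℤ → ℤ → Set
    at z d e = same (colour S u) (colour S z) + d + e ≤ + 1
    pointwise : ∀ z → at z (δ w z) (δ v z)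
    pointwise z with w ≟ z | v ≟ z
    ... | yes refl | yes refl = ⊥-elim (w≢v refl)
    ... | yes refl | no v≢z = subst₂ (at z) (sym (δ-refl z)) (sym (δ-≢ v≢z)) (same-≢₁ (colour S u) (colour S z) cw)
    ... | no w≢z | yes refl = subst₂ (at z) (sym (δ-≢ w≢z)) (sym (δ-refl z)) (same-≢₂ (colour S u) (colour S z) cv)
    ... | no w≢z | no v≢z = subst₂ (at z) (sym (δ-≢ w≢z)) (sym (δ-≢ v≢z)) (same≤1 (colour S u) (colour S z))

  opaque
    unfolding _+_
    <+1 : ∀ x → ¬ (x + + 1 ≤ x)
    <+1 x p = ℤ.<-irrefl refl (ℤ.suc[i]≤j⇒i<j (subst (_≤ x) (ℤ.+-comm x (+ 1)) p))
    suc+1 : ∀ k → + k + + 1 + + 1 ≡ + suc k + + 1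
    suc+1 k = trans (ℤ.+-assoc (+ k) (+ 1) (+ 1)) (trans (ℤ.+-comm (+ k) (+ 2)) (ℤ.+-comm (+ 1) (+ suc k)))
    +1-mono : ∀ {x y} → x ≤ y → x + + 1 ≤ y + + 1
    +1-mono = ℤ.+-monoˡ-≤ (+ 1)

  outside : ∀ {k} {G : SimpleGraph (suc k)} (P : ProperSplitting G) u → ∃[ w ] (colour (splitting P) w ≢ colour (splitting P) u)
  outside P u with colour (splitting P) zero Bool.≟ colour (splitting P) u
  ... | no ne = zero , ne
  ... | yes eq = other P , λ e → differs P (trans e (sym eq))

  -- An eigenvalue equal to the order would force a colour class to contain every vertex, yet both
  -- colours occur.
  no-full-eigenvalue : ∀ {k} (G : SimpleGraph (suc k)) → χ⁺ G (+ 0) ≡ + 0 → χ G (+ suc k) ≢ + 0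
  no-full-eigenvalue {k} G e₀ e with split-at-double-zero G e₀
  ... | P with eigenvalue≤class G (splitting P) (+ suc k) (ℤ.+<+ (ℕ.s≤s ℕ.z≤n)) e
  ... | u , le with outside P u
  ... | w , ne = <+1 (+ suc k) (ℤ.≤-trans (+1-mono le) (class-bound (splitting P) u w ne))

  -- Some colour class misses at most one vertex, and it does miss a vertex `w`. A neighbour of `w`
  -- would have the colour of `w` and be a second vertex outside the class, so `w` is isolated.
  isolated-from-eigenvalue : ∀ {k} (G : SimpleGraph (suc (suc k))) → χ⁺ G (+ 0) ≡ + 0 → χ G (+ suc k) ≡ + 0 →
    Σ (SimpleGraph (suc k)) (λ H → ∀ x → χ G x ≡ x * χ H x)
  isolated-from-eigenvalue {k} G e₀ e with split-at-double-zero G e₀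
  ... | P with eigenvalue≤class G (splitting P) (+ suc k) (ℤ.+<+ (ℕ.s≤s ℕ.z≤n)) e
  ... | u , le with outside P u
  ... | w , ne = relabel (punchIn w) G , χ-delete-isolated G w isolated
    where
    S = splitting P
    isolated : ∀ v → adj G w v ≡ false
    isolated v with adj G w v in e
    ... | false = refl
    ... | true = ⊥-elim (<+1 (+ suc (suc k))
          (ℤ.≤-trans (ℤ.≤-reflexive (sym (suc+1 (suc k)))) (ℤ.≤-trans (+1-mono (+1-mono le)) (class-bound₂ S u w v w≢v ne v≢u))))
      where
      same-colour : colour S w ≡ colour S v
      same-colour with colour S w Bool.≟ colour S v
      ... | yes eq = eq
      ... | no ne′ with trans (sym e) (closed S w v ne′)
      ... | ()
      w≢v : w ≢ v
      w≢v refl with trans (sym e) (irrefl G w)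
      ... | ()
      v≢u : colour S v ≢ colour S u
      v≢u eq = ne (trans same-colour eq)

  -- Polynomial functions

  -- Stands in for being a polynomial with integer coefficients.
  Smooth : (ℤ → ℤ) → Set
  Smooth f = ∀ a → Σ (ℤ → ℤ) λ h → ∀ x → f x ≡ f a + (x - a) * h x

  smooth-resp : ∀ {f g} → (∀ x → f x ≡ g x) → Smooth f → Smooth g
  smooth-resp e F a with F a
  ... | h , eq = h , λ x → trans (sym (e x)) (trans (eq x) (cong (_+ (x - a) * h x) (e a)))

  smooth-const : ∀ c → Smooth (λ _ → c)
  smooth-const c a = (λ _ → + 0) , λ x → identity c (x - a)
    where
    opaque
      unfolding _+_
      identity : ∀ c y → c ≡ c + y * + 0
      identity = solve-∀

  smooth-id : Smooth (λ x → x)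
  smooth-id a = (λ _ → + 1) , λ x → identity x a
    where
    opaque
      unfolding _+_
      identity : ∀ x a → x ≡ a + (x - a) * + 1
      identity = solve-∀

  smooth-+ : ∀ {f g} → Smooth f → Smooth g → Smooth (λ x → f x + g x)
  smooth-+ F G a with F a | G a
  ... | h , p | k , q = (λ x → h x + k x) , λ x → trans (cong₂ _+_ (p x) (q x)) (identity _ _ (x - a) _ _)
    where
    opaque
      unfolding _+_
      identity : ∀ f g y h k → f + y * h + (g + y * k) ≡ f + g + y * (h + k)
      identity = solve-∀

  smooth-* : ∀ {f g} → Smooth f → Smooth g → Smooth (λ x → f x * g x)
  smooth-* {f} {g} F G a with F a | G a
  ... | h , p | k , q = (λ x → f a * k x + h x * g a + (x - a) * (h x * k x)) ,
      λ x → trans (cong₂ _*_ (p x) (q x)) (identity (f a) (g a) (x - a) (h x) (k x))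
    where
    opaque
      unfolding _+_
      identity : ∀ f g y h k → (f + y * h) * (g + y * k) ≡ f * g + y * (f * k + h * g + y * (h * k))
      identity = solve-∀

  smooth-− : ∀ {f g} → Smooth f → Smooth g → Smooth (λ x → f x - g x)
  smooth-− {f} {g} F G = smooth-resp (λ x → identity (f x) (g x)) (smooth-+ F (smooth-* (smooth-const (- (+ 1))) G))
    where
    opaque
      unfolding _+_
      identity : ∀ x y → x + - (+ 1) * y ≡ x - y
      identity = solve-∀

  smooth-∘ : ∀ {f g} → Smooth f → Smooth g → Smooth (λ x → f (g x))
  smooth-∘ {f} {g} F G a with F (g a) | G a
  ... | h , p | k , q = (λ x → k x * h (g x)) , λ x → trans (p (g x)) (cong (_+_ (f (g a)))
      (trans (cong (_* h (g x)) (trans (cong (_- g a) (q x)) (cancel (g a) ((x - a) * k x)))) (*-assoc _ _ _)))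
    where
    opaque
      unfolding _+_
      cancel : ∀ y z → y + z - y ≡ z
      cancel = solve-∀

  smooth-sum : ∀ n {f : Fin n → ℤ → ℤ} → (∀ k → Smooth (f k)) → Smooth (λ x → sumFin n (λ k → f k x))
  smooth-sum zero F = smooth-resp (λ x → sym (sum-nil _)) (smooth-const (+ 0))
  smooth-sum (suc n) F = smooth-resp (λ x → sym (sum-suc n _)) (smooth-+ (F zero) (smooth-sum n (F ∘ suc)))

  smooth-det : ∀ n {M : ℤ → Matrix n} → (∀ u v → Smooth (λ x → M x u v)) → Smooth (λ x → det n (M x))
  smooth-det zero F = smooth-resp (λ x → sym (det-nil _)) (smooth-const (+ 1))
  smooth-det (suc n) F = smooth-resp (λ x → sym (det-suc n _)) (smooth-sum (suc n) λ c →
    smooth-* (smooth-const (sgn c)) (smooth-* (F zero c) (smooth-det n (λ u v → F (suc u) (punchIn c v)))))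


  smooth-root : ∀ a → Smooth (λ x → x - a)
  smooth-root a = smooth-− smooth-id (smooth-const a)

  smooth-characteristic : ∀ {n} (G : SimpleGraph n) u v → Smooth (λ x → characteristic G x u v)
  smooth-characteristic G u v = smooth-− (smooth-* smooth-id (smooth-const _)) (smooth-const _)

  smooth-χ : ∀ {n} (G : SimpleGraph n) → Smooth (χ G)
  smooth-χ {n} G = smooth-det n (smooth-characteristic G)

  smooth-χ⁺ : ∀ {k} (G : SimpleGraph (suc k)) → Smooth (χ⁺ G)
  smooth-χ⁺ {k} G = smooth-det (suc k) λ { zero v → smooth-const (+ 1) ; (suc u) v → smooth-characteristic G (suc u) v }

  divisible-by-larger : ∀ c h → c ≡ + suc ℤ.∣ c ∣ * h → c ≡ + 0
  divisible-by-larger c h e = ℤ.∣i∣≡0⇒i≡0 (small (ℤ.∣ c ∣) (ℕ.divides ℤ.∣ h ∣ (trans absolute (ℕ.*-comm (suc ℤ.∣ c ∣) ℤ.∣ h ∣))))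
    where
    opaque
      unfolding _+_
      absolute : ℤ.∣ c ∣ ≡ suc ℤ.∣ c ∣ ℕ.* ℤ.∣ h ∣
      absolute = trans (cong ℤ.∣_∣ e) (ℤ.abs-* (+ suc ℤ.∣ c ∣) h)
    small : ∀ k → suc k ℕ.∣ k → k ≡ 0
    small zero d = refl
    small (suc k) d = ⊥-elim (ℕ.<-irrefl refl (ℕ.∣⇒≤ d))

  -- Only the point `a` is in question. Since `f` vanishes at `y = a + (|f a| + 1)`, the number
  -- `y - a` divides `f a`; it exceeds `|f a|`, so `f a` is zero.
  smooth-vanish : ∀ {f} → Smooth f → ∀ a → (∀ x → (x - a) * f x ≡ + 0) → ∀ x → f x ≡ + 0
  smooth-vanish {f} F a e x with *-zero-product (x - a) (f x) (e x)
  ... | inj₂ z = z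
  ... | inj₁ z with F a
  ... | h , p = trans (cong f (x≡a x a z)) (divisible-by-larger (f a) (- h y) (isolate (f a) (h y) (begin
      f a + + suc N * h y ≡⟨ cong (λ d → f a + d * h y) (difference a (+ suc N)) ⟨
      f a + (y - a) * h y ≡⟨ p y ⟨
      f y ≡⟨ *-cancel-zero (λ z → contradiction (trans (sym (difference a (+ suc N))) z) λ ()) (e y) ⟩
      + 0 ∎)))
    where
    N = ℤ.∣ f a ∣
    y = a + + suc N
    opaque
      unfolding _+_
      difference : ∀ a n → a + n - a ≡ n
      difference = solve-∀
      x≡a : ∀ x a → x - a ≡ + 0 → x ≡ a
      x≡a x a = ℤ.i-j≡0⇒i≡j x a
      shift : ∀ f n h → f ≡ (f + n * h) + n * - h
      shift = solve-∀
      isolate : ∀ f h → f + + suc N * h ≡ + 0 → f ≡ + suc N * - h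
      isolate f h e = trans (shift f (+ suc N) h) (trans (cong (_+ + suc N * - h) e) (ℤ.+-identityˡ _))

  smooth-cancel : ∀ {f g} → Smooth f → Smooth g → ∀ a → (∀ x → (x - a) * f x ≡ (x - a) * g x) → ∀ x → f x ≡ g x
  smooth-cancel {f} {g} F G a e x = equal _ _ (smooth-vanish (smooth-− F G) a (λ x → trans (distribute (x - a) (f x) (g x)) (trans (cong (_- (x - a) * g x) (e x)) (x-x≡0 _))) x)
    where
    opaque
      unfolding _+_
      distribute : ∀ y f g → y * (f - g) ≡ y * f - y * g
      distribute = solve-∀
      equal : ∀ x y → x - y ≡ + 0 → x ≡ y
      equal x y = ℤ.i-j≡0⇒i≡j x y

  smooth-cancel-x : ∀ {f g} → Smooth f → Smooth g → (∀ x → x * f x ≡ x * g x) → ∀ x → f x ≡ g x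
  smooth-cancel-x {f} {g} F G e = smooth-cancel F G (+ 0) (λ x → trans (cong (_* f x) (x-0 x)) (trans (e x) (cong (_* g x) (sym (x-0 x)))))
    where
    opaque
      unfolding _+_
      x-0 : ∀ x → x - + 0 ≡ x
      x-0 = solve-∀

  -- Degree bounds, leading coefficients and the trace

  -- Horner form with `d` coefficients; the degree is thus strictly below `d`, and `d = 0` leaves
  -- only the zero function.
  Poly< : ℕ → (ℤ → ℤ) → Set
  Poly< zero f = ∀ x → f x ≡ + 0
  Poly< (suc d) f = Σ ℤ λ c → Σ (ℤ → ℤ) λ g → Poly< d g × (∀ x → f x ≡ c + x * g x)

  poly-resp : ∀ d {f g} → (∀ x → f x ≡ g x) → Poly< d f → Poly< d g
  poly-resp zero e F x = trans (sym (e x)) (F x)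
  poly-resp (suc d) e (c , h , H , p) = c , h , H , λ x → trans (sym (e x)) (p x)

  poly-smooth : ∀ d {f} → Poly< d f → Smooth f
  poly-smooth zero F = smooth-resp (sym ∘ F) (smooth-const (+ 0))
  poly-smooth (suc d) (c , g , G , p) = smooth-resp (sym ∘ p) (smooth-+ (smooth-const c) (smooth-* smooth-id (poly-smooth d G)))

  poly-lin : ∀ d p q {f g} → Poly< d f → Poly< d g → Poly< d (λ x → p * f x + q * g x)
  poly-lin zero p q F G x = trans (cong₂ (λ a b → p * a + q * b) (F x) (G x)) (zeros p q)
    where
    opaque
      unfolding _+_
      zeros : ∀ p q → p * + 0 + q * + 0 ≡ + 0
      zeros = solve-∀
  poly-lin (suc d) p q (c , h , H , e) (c' , h' , H' , e') =
    p * c + q * c' , (λ x → p * h x + q * h' x) , poly-lin d p q H H' ,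
    λ x → trans (cong₂ (λ a b → p * a + q * b) (e x) (e' x)) (regroup p q c c' x (h x) (h' x))
    where
    opaque
      unfolding _+_
      regroup : ∀ p q c c' x h h' → p * (c + x * h) + q * (c' + x * h') ≡ p * c + q * c' + x * (p * h + q * h')
      regroup = solve-∀

  poly-scale : ∀ d p {f} → Poly< d f → Poly< d (λ x → p * f x)
  poly-scale d p {f} F = poly-resp d (λ x → identity p (f x)) (poly-lin d p (+ 0) F F)
    where
    opaque
      unfolding _+_
      identity : ∀ p y → p * y + + 0 * y ≡ p * y
      identity = solve-∀

  poly-+ : ∀ d {f g} → Poly< d f → Poly< d g → Poly< d (λ x → f x + g x)
  poly-+ d F G = poly-resp d (λ x → cong₂ _+_ (*-identityˡ _) (*-identityˡ _)) (poly-lin d (+ 1) (+ 1) F G)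

  poly-zero : ∀ d → Poly< d (λ _ → + 0)
  poly-zero zero x = refl
  poly-zero (suc d) = + 0 , _ , poly-zero d , λ x → sym (trans (+-identityˡ _) (*-zeroʳ x))

  poly-const : ∀ d c → Poly< (suc d) (λ _ → c)
  poly-const d c = c , _ , poly-zero d , λ x → sym (trans (cong (_+_ c) (*-zeroʳ x)) (+-identityʳ c))

  poly-x* : ∀ d {f} → Poly< d f → Poly< (suc d) (λ x → x * f x)
  poly-x* d {f} F = + 0 , f , F , λ x → sym (+-identityˡ _)

  poly-suc : ∀ d {f} → Poly< d f → Poly< (suc d) f
  poly-suc zero F = + 0 , _ , poly-zero 0 , λ x → trans (F x) (sym (trans (+-identityˡ _) (*-zeroʳ x)))
  poly-suc (suc d) (c , g , G , p) = c , g , poly-suc d G , p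

  poly-weaken : ∀ {d e f} → d ℕ.≤ e → Poly< d f → Poly< e f
  poly-weaken {d} {zero} ℕ.z≤n F = F
  poly-weaken {zero} {suc e} {f} ℕ.z≤n F = poly-suc e (poly-weaken {zero} {e} {f} ℕ.z≤n F)
  poly-weaken {suc d} {suc e} (ℕ.s≤s le) (c , g , G , p) = c , g , poly-weaken le G , p

  poly-affine* : ∀ d p q {f} → Poly< d f → Poly< (suc d) (λ x → (p + q * x) * f x)
  poly-affine* d p q {f} F = poly-resp (suc d) (λ x → identity p q x (f x)) (poly-lin (suc d) p q (poly-suc d F) (poly-x* d F))
    where
    opaque
      unfolding _+_
      identity : ∀ p q x y → p * y + q * (x * y) ≡ (p + q * x) * y
      identity = solve-∀

  poly-power : ∀ d → Poly< (suc d) (λ x → x ^ d)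
  poly-power zero = poly-const 0 (+ 1)
  poly-power (suc d) = poly-x* (suc d) (poly-power d)

  poly-sum : ∀ n d {f : Fin n → ℤ → ℤ} → (∀ k → Poly< d (f k)) → Poly< d (λ x → sumFin n (λ k → f k x))
  poly-sum zero d F = poly-resp d (λ x → sym (sum-nil _)) (poly-zero d)
  poly-sum (suc n) d F = poly-resp d (λ x → sym (sum-suc n _)) (poly-+ d (F zero) (poly-sum n d (F ∘ suc)))

  Affine : (ℤ → ℤ) → Set
  Affine f = ∃[ p ] ∃[ q ] (∀ x → f x ≡ p + q * x)

  poly-det : ∀ n {M : ℤ → Matrix n} → (∀ u v → Affine (λ x → M x u v)) → Poly< (suc n) (λ x → det n (M x))
  poly-det zero A = poly-resp 1 (λ x → sym (det-nil _)) (poly-const 0 (+ 1))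
  poly-det (suc n) {M} A = poly-resp (suc (suc n)) (λ x → sym (det-suc n (M x))) (poly-sum (suc n) (suc (suc n)) term)
    where
    term : ∀ c → Poly< (suc (suc n)) (λ x → sgn c * (M x zero c * det n (minor (M x) c)))
    term c with A zero c
    ... | p , q , e = poly-scale (suc (suc n)) (sgn c) (poly-resp (suc (suc n)) (λ x → cong (_* det n (minor (M x) c)) (sym (e x)))
                        (poly-affine* (suc n) p q (poly-det n (λ u v → A (suc u) (punchIn c v)))))

  -- One better than `poly-det`. The gain keeps the off-diagonal terms of `monic-det` away from the
  -- coefficient that holds the trace.
  poly-det-constant-row : ∀ n {M : ℤ → Matrix n} → (∀ u v → Affine (λ x → M x u v)) →
    ∀ k (b : Vector n) → (∀ v x → M x k v ≡ b v) → Poly< n (λ x → det n (M x))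
  poly-det-constant-row (suc n) {M} A k b h = poly-resp (suc n) (λ x → sym (det-suc n (M x))) (poly-sum (suc n) (suc n) (term k h))
    where
    term : ∀ k → (∀ v x → M x k v ≡ b v) → ∀ c → Poly< (suc n) (λ x → sgn c * (M x zero c * det n (minor (M x) c)))
    term zero h c = poly-scale (suc n) (sgn c) (poly-resp (suc n) (λ x → cong (_* det n (minor (M x) c)) (sym (h c x)))
                      (poly-scale (suc n) (b c) (poly-det n (λ u v → A (suc u) (punchIn c v)))))
    term (suc k) h c with A zero c
    ... | p , q , e = poly-scale (suc n) (sgn c) (poly-resp (suc n) (λ x → cong (_* det n (minor (M x) c)) (sym (e x)))
                        (poly-affine* n p q (poly-det-constant-row n (λ u v → A (suc u) (punchIn c v)) k (b ∘ punchIn c) (λ v → h (punchIn c v)))))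

  -- f is monic of degree n, and -t is the coefficient of x^(n-1).
  Monic : ℕ → ℤ → (ℤ → ℤ) → Set
  Monic n t f = Poly< n (λ x → x * f x - (x - t) * x ^ n)

  -- The factor `x - b` adds `b` to the sum of the roots, and a remainder of degree below `n`
  -- reaches neither of the two leading coefficients.
  monic-step : ∀ {n t f} b {R} → Monic n t f → Poly< n R → Monic (suc n) (b + t) (λ x → (x - b) * f x + R x)
  monic-step {n} {t} {f} b {R} F P = poly-resp (suc n) (λ x → identity x b t (x ^ n) (f x) (R x))
    (poly-+ (suc n) (poly-+ (suc n) (poly-affine* n (- b) (+ 1) F) (poly-scale (suc n) (b * t) (poly-power n))) (poly-x* n P))
    where
    opaque
      unfolding _+_
      identity : ∀ x b t w f r → (- b + + 1 * x) * (x * f - (x - t) * w) + b * t * w + x * r ≡ x * ((x - b) * f + r) - (x - (b + t)) * (x * w)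
      identity = solve-∀

  monic-resp : ∀ {n t f g} → (∀ x → f x ≡ g x) → Monic n t f → Monic n t g
  monic-resp {n} e F = poly-resp n (λ x → cong (λ y → x * y - _) (e x)) F

  monic-one : Monic 0 (+ 0) (λ _ → + 1)
  monic-one = identity
    where
    opaque
      unfolding _+_
      identity : ∀ x → x * + 1 - (x - + 0) * + 1 ≡ + 0
      identity = solve-∀

  monic-det : ∀ n (B : Matrix n) → Monic n (sumFin n (λ u → B u u)) (λ x → det n (λ u v → x * δ u v - B u v))
  monic-det zero B = subst (λ t → Monic 0 t (λ x → det 0 (λ u v → x * δ u v - B u v))) (sym (sum-nil _)) (monic-resp (λ x → sym (det-nil _)) monic-one)
  monic-det (suc n) B = subst (λ t → Monic (suc n) t (λ x → det (suc n) (M x))) (sym (sum-suc n _))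
    (monic-resp (λ x → begin
       (x - b) * _ + sumFin n (tail x) ≡⟨ cong (_+ sumFin n (tail x)) (corner x b _) ⟩
       + 1 * ((x * + 1 - b) * _) + sumFin n (tail x) ≡⟨ sum-suc n _ ⟨
       _ ≡⟨ det-suc n _ ⟨
       _ ∎)
     (monic-step b (monic-det n (λ u v → B (suc u) (suc v))) (poly-sum n n lower)))
    where
    b = B zero zero
    M : ℤ → Matrix (suc n)
    M x u v = x * δ u v - B u v
    tail : ℤ → Fin n → ℤ
    tail x c = sgn (suc c) * (M x zero (suc c) * det n (minor (M x) (suc c)))
    opaque
      unfolding _+_
      corner : ∀ x b d → (x - b) * d ≡ + 1 * ((x * + 1 - b) * d)
      corner = solve-∀
      off : ∀ x b → x * + 0 - b ≡ - b
      off = solve-∀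
      affine : ∀ x d b → x * d - b ≡ - b + d * x
      affine = solve-∀
    -- Row `c` of this minor is row `suc c` of the matrix without its diagonal entry, hence free of
    -- `x`.
    lower : ∀ c → Poly< n (λ x → tail x c)
    lower c = poly-scale n (sgn (suc c)) (poly-resp n (λ x → cong (_* det n (minor (M x) (suc c))) (sym (off x (B zero (suc c)))))
      (poly-scale n (- B zero (suc c)) (poly-det-constant-row n
        (λ u v → - B (suc u) (punchIn (suc c) v) , δ (suc u) (punchIn (suc c) v) , λ x → affine x _ _)
        c (λ v → - B (suc c) (punchIn (suc c) v))
        (λ v x → trans (cong (λ d → x * d - B (suc c) (punchIn (suc c) v)) (δ-≢ (punchInᵢ≢i (suc c) v ∘ sym))) (off x _)))))

  -- Evaluation at zero removes the constant term of `r`; then a factor `x` is cancelled and the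
  -- degree drops.
  top-zero : ∀ d a {r} → Poly< d r → (∀ x → a * x ^ d + r x ≡ + 0) → a ≡ + 0
  top-zero zero a {r} P e = trans (sym (trans (cong₂ _+_ (*-identityʳ a) (P (+ 0))) (+-identityʳ a))) (e (+ 0))
  top-zero (suc d) a {r} (c , g , G , p) e = top-zero d a G (smooth-cancel-x smooth-sum′ (smooth-const (+ 0)) quotient)
    where
    smooth-sum′ : Smooth (λ x → a * x ^ d + g x)
    smooth-sum′ = smooth-+ (smooth-* (smooth-const a) (poly-smooth (suc d) (poly-power d))) (poly-smooth d G)
    opaque
      unfolding _+_
      at-zero : ∀ a w c h → a * (+ 0 * w) + (c + + 0 * h) ≡ c
      at-zero = solve-∀
      regroup : ∀ x a w g → x * (a * w + g) ≡ a * (x * w) + (+ 0 + x * g)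
      regroup = solve-∀
    c≡0 : c ≡ + 0
    c≡0 = trans (sym (at-zero a ((+ 0) ^ d) c (g (+ 0)))) (trans (cong (_+_ (a * (+ 0) ^ suc d)) (sym (p (+ 0)))) (e (+ 0)))
    quotient : ∀ x → x * (a * x ^ d + g x) ≡ x * + 0
    quotient x = begin
      x * (a * x ^ d + g x) ≡⟨ regroup x a (x ^ d) (g x) ⟩
      a * x ^ suc d + (+ 0 + x * g x) ≡⟨ cong (λ c → a * x ^ suc d + (c + x * g x)) c≡0 ⟨
      a * x ^ suc d + (c + x * g x) ≡⟨ cong (_+_ (a * x ^ suc d)) (p x) ⟨
      a * x ^ suc d + r x ≡⟨ e x ⟩
      + 0 ≡⟨ *-zeroʳ x ⟨
      x * + 0 ∎

  monic-≮ : ∀ {n m s t f} → n ℕ.< m → Monic n s f → ¬ Monic m t f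
  monic-≮ {n} {m} {s} {t} {f} n<m F G = contradiction (top-zero (suc m) (+ 1) P (λ x → identity x t s (x ^ m) (x ^ n) (f x))) λ ()
    where
    P : Poly< (suc m) (λ x → (- t) * x ^ m + (- (+ 1)) * ((- s + + 1 * x) * x ^ n) + ((x * f x - (x - t) * x ^ m) + (- (+ 1)) * (x * f x - (x - s) * x ^ n)))
    P = poly-+ (suc m) (poly-lin (suc m) (- t) (- (+ 1)) (poly-power m) (poly-weaken (ℕ.s≤s n<m) (poly-affine* (suc n) (- s) (+ 1) (poly-power n))))
          (poly-+ (suc m) (poly-suc m G) (poly-scale (suc m) (- (+ 1)) (poly-weaken (ℕ.m≤n⇒m≤1+n (ℕ.<⇒≤ n<m)) F)))
    opaque
      unfolding _+_
      identity : ∀ x t s w z f → + 1 * (x * w) + ((- t) * w + (- (+ 1)) * ((- s + + 1 * x) * z) + ((x * f - (x - t) * w) + (- (+ 1)) * (x * f - (x - s) * z))) ≡ + 0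
      identity = solve-∀

  -- Applied to a characteristic polynomial and a product over roots: the degree reveals the order
  -- of the graph, the second coefficient its trace.
  monic-unique : ∀ {n m s t f} → Monic n s f → Monic m t f → n ≡ m × s ≡ t
  monic-unique {n} {m} {s} {t} {f} F G with ℕ.<-cmp n m
  ... | tri< n<m _ _ = ⊥-elim (monic-≮ {f = f} n<m F G)
  ... | tri> _ _ m<n = ⊥-elim (monic-≮ {f = f} m<n G F)
  ... | tri≈ _ refl _ = refl , equal _ _ (top-zero n (s - t) (poly-lin n (- (+ 1)) (+ 1) F G) (λ x → identity x s t (x ^ n) (f x)))
    where
    opaque
      unfolding _+_
      equal : ∀ x y → x - y ≡ + 0 → x ≡ y
      equal x y = ℤ.i-j≡0⇒i≡j x y
      identity : ∀ x s t w f → (s - t) * w + (- (+ 1) * (x * f - (x - s) * w) + + 1 * (x * f - (x - t) * w)) ≡ + 0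
      identity = solve-∀

  handshake : ∀ n (A : Matrix n) → (∀ u v → A u v ≡ A v u) → (∀ u → A u u ≡ + 0) → ∃[ e ] (sumFin n (λ u → sumFin n (A u)) ≡ e + e)
  handshake zero A s d = + 0 , trans (sum-nil _) (sym (+-identityˡ _))
  handshake (suc n) A s d with handshake n (λ u v → A (suc u) (suc v)) (λ u v → s (suc u) (suc v)) (d ∘ suc)
  ... | e , p = sumFin n (A zero ∘ suc) + e , (begin
    sumFin (suc n) (λ u → sumFin (suc n) (A u)) ≡⟨ trans (sum-suc n _) (cong₂ _+_ (sum-suc n _) (sum-cong n (λ u → sum-suc n _))) ⟩
    A zero zero + a + sumFin n (λ u → A (suc u) zero + sumFin n (A (suc u) ∘ suc))
      ≡⟨ cong₂ (λ z w → z + a + w) (d zero) (trans (sum-+ n _ _) (cong₂ _+_ (sum-cong n (λ u → s (suc u) zero)) p)) ⟩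
    + 0 + a + (a + (e + e)) ≡⟨ regroup a e ⟩
    a + e + (a + e) ∎)
    where
    a = sumFin n (A zero ∘ suc)
    opaque
      unfolding _+_
      regroup : ∀ a e → + 0 + a + (a + (e + e)) ≡ a + e + (a + e)
      regroup = solve-∀

  monic-χ : ∀ {n} (G : SimpleGraph n) → ∃[ e ] Monic n (e + e) (χ G)
  monic-χ {n} G with handshake n (adjacency G) (adjacency-sym G) (λ u → cong edge (irrefl G u))
  ... | e , p = e , subst (λ t → Monic n t (χ G)) (trans (sum-cong n trace) p) (monic-det n (lap G))
    where
    trace : ∀ u → lap G u u ≡ deg G u
    trace u = trans (cong₂ (λ d b → d * deg G u - edge b) (δ-refl u) (irrefl G u)) (identity (deg G u))
      where
      opaque
        unfolding _+_
        identity : ∀ d → + 1 * d - + 0 ≡ d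
        identity = solve-∀

  -- Excluded and realized spectra

  -- x (x - 1) ⋯ (x - n)
  falling : ℕ → ℤ → ℤ
  falling zero x = x
  falling (suc n) x = (x - + suc n) * falling n x

  falling-shift : ∀ n x → falling (suc n) x ≡ x * falling n (x - + 1)
  falling-shift zero x = *-comm _ x
  falling-shift (suc n) x = begin
    (x - + suc (suc n)) * falling (suc n) x ≡⟨ cong₂ (λ k z → (x - k) * z) (sym (pos-suc (suc n))) (falling-shift n x) ⟩
    (x - (+ 1 + + suc n)) * (x * falling n (x - + 1)) ≡⟨ identity x (+ suc n) _ ⟩
    x * ((x - + 1 - + suc n) * falling n (x - + 1)) ∎
    where
    opaque
      unfolding _+_
      identity : ∀ x n f → (x - (+ 1 + n)) * (x * f) ≡ x * ((x - + 1 - n) * f)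
      identity = solve-∀

  falling-reflect : ∀ n x → falling n (+ n - x) ≡ (- (+ 1)) ^ suc n * falling n x
  falling-reflect zero x = identity x
    where
    opaque
      unfolding _+_
      identity : ∀ x → + 0 - x ≡ - (+ 1) * + 1 * x
      identity = solve-∀
  falling-reflect (suc n) x = begin
    (+ suc n - x - + suc n) * falling n (+ suc n - x)
      ≡⟨ cong₂ _*_ (cancel (+ suc n) x) (cong (falling n) (trans (cong (_- x) (sym (pos-suc n))) (regroup (+ n) x))) ⟩
    - x * falling n (+ n - (x - + 1)) ≡⟨ cong (- x *_) (falling-reflect n (x - + 1)) ⟩
    - x * ((- (+ 1)) ^ suc n * falling n (x - + 1)) ≡⟨ pull x ((- (+ 1)) ^ suc n) _ ⟩
    (- (+ 1)) ^ suc (suc n) * (x * falling n (x - + 1)) ≡⟨ cong ((- (+ 1)) ^ suc (suc n) *_) (falling-shift n x) ⟨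
    (- (+ 1)) ^ suc (suc n) * falling (suc n) x ∎
    where
    opaque
      unfolding _+_
      cancel : ∀ n x → n - x - n ≡ - x
      cancel = solve-∀
      regroup : ∀ n x → + 1 + n - x ≡ n - (x - + 1)
      regroup = solve-∀
      pull : ∀ x s f → - x * (s * f) ≡ - (+ 1) * s * (x * f)
      pull = solve-∀

  falling-root : ∀ n → falling n (+ n) ≡ + 0
  falling-root zero = refl
  falling-root (suc n) = trans (cong (_* falling n (+ suc n)) (x-x≡0 (+ suc n))) (*-zeroˡ _)

  smooth-falling : ∀ n → Smooth (falling n)
  smooth-falling zero = smooth-id
  smooth-falling (suc n) = smooth-* (smooth-root (+ suc n)) (smooth-falling n)

  smooth-reflect : ∀ a → Smooth (λ x → a - x)
  smooth-reflect a = smooth-− (smooth-const a) smooth-id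

  smooth-cancel-reflected : ∀ {f g} → Smooth f → Smooth g → ∀ a → (∀ x → (a - x) * f x ≡ (a - x) * g x) → ∀ x → f x ≡ g x
  smooth-cancel-reflected {f} {g} F G a e = smooth-cancel F G a (λ x → trans (flip x a (f x)) (trans (cong -_ (e x)) (sym (flip x a (g x)))))
    where
    opaque
      unfolding _+_
      flip : ∀ x a y → (x - a) * y ≡ - ((a - x) * y)
      flip = solve-∀

  -- One factor `x` is the trivial one and is cancelled between functions; the other is then
  -- evaluated at zero, where `c` does not vanish.
  double-zero : ∀ {k} (G : SimpleGraph (suc k)) {c q : ℤ → ℤ} → Smooth c → Smooth q → c (+ 0) ≢ + 0 →
    (∀ x → c x * χ G x ≡ x * (x * q x)) → χ⁺ G (+ 0) ≡ + 0
  double-zero G {c} {q} C Q c0 e = *-cancel-zero c0 (trans (quotient (+ 0)) (*-zeroˡ _))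
    where
    opaque
      unfolding _+_
      swap : ∀ x c y → x * (c * y) ≡ c * (x * y)
      swap = solve-∀
    quotient : ∀ x → c x * χ⁺ G x ≡ x * q x
    quotient = smooth-cancel-x (smooth-* C (smooth-χ⁺ G)) (smooth-* smooth-id Q)
      (λ x → trans (swap x (c x) _) (trans (cong (c x *_) (sym (χ-χ⁺ G x))) (e x)))

  -- Complementation reflects the missing eigenvalues in `c` along with the roots of `r`, so the
  -- relation keeps its shape without division by `c`.
  complement-relation : ∀ {m} (G : SimpleGraph (suc m)) (c r : ℤ → ℤ) → (∀ x → c x * χ G x ≡ r x) → ∀ x → let y = + suc m - x in
    y * (c y * χ (complement G) x) ≡ (- (+ 1)) ^ m * (x * r y)
  complement-relation {m} G c r e x = begin
    y * (c y * χ (complement G) x) ≡⟨ swap y (c y) _ ⟩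
    c y * (y * χ (complement G) x) ≡⟨ cong (c y *_) (χ-complement G x) ⟩
    c y * ((- (+ 1)) ^ m * (x * χ G y)) ≡⟨ regroup (c y) ((- (+ 1)) ^ m) x (χ G y) ⟩
    (- (+ 1)) ^ m * (x * (c y * χ G y)) ≡⟨ cong (λ z → (- (+ 1)) ^ m * (x * z)) (e y) ⟩
    (- (+ 1)) ^ m * (x * r y) ∎
    where
    y = + suc m - x
    opaque
      unfolding _+_
      swap : ∀ x c y → x * (c * y) ≡ c * (x * y)
      swap = solve-∀
      regroup : ∀ c s x g → c * (s * (x * g)) ≡ s * (x * (c * g))
      regroup = solve-∀

  -- The complement of G is an isolated vertex plus H', the complement of H' is an
  -- isolated vertex plus Γ', and Γ' would be disconnected with an eigenvalue equal
  -- to its order.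
  no-realization : ∀ k (G : SimpleGraph (suc (suc (suc k)))) {c : ℤ → ℤ} → Smooth c →
    c (+ 1) ≢ + 0 → c (+ suc (suc k)) ≢ + 0 → c (+ suc (suc (suc k))) ≢ + 0 →
    ¬ (∀ x → c x * χ G x ≡ (x - + 1) * falling (suc (suc (suc k))) x)
  no-realization k G {c} C c1 cm cn e =
    step₁ (isolated-from-eigenvalue H
      (double-zero H C₁ (smooth-* (smooth-const t₁) (smooth-* (smooth-root (+ m)) (smooth-∘ (smooth-falling (suc k)) (smooth-root (+ 1)))))
        (cn ∘ trans (cong c (sym (x-0 (+ n)))))
        (λ x → trans (H-relation x) (trans (cong (λ z → t₁ * (x * ((x - + m) * z))) (falling-shift (suc k) x)) (pull t₁ x (x - + m) _))))
      (*-cancel-zero (c1 ∘ trans (cong c (sym n-m)))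
        (trans (H-relation (+ m)) (trans (cong (λ z → t₁ * (+ m * (z * falling m (+ m)))) (x-x≡0 (+ m))) (zeros t₁ (+ m) _)))))
    where
    n m : ℕ
    n = suc (suc (suc k))
    m = suc (suc k)
    H : SimpleGraph n
    H = complement G
    s₁ t₁ : ℤ
    s₁ = (- (+ 1)) ^ m
    t₁ = s₁ * (- (+ 1)) ^ suc n
    c₁ : ℤ → ℤ
    c₁ x = c (+ n - x)
    C₁ : Smooth c₁
    C₁ = smooth-∘ C (smooth-reflect (+ n))
    opaque
      unfolding _+_
      x-0 : ∀ x → x - + 0 ≡ x
      x-0 = solve-∀
      zeros : ∀ t m f → t * (m * (+ 0 * f)) ≡ + 0
      zeros = solve-∀
      zeros′ : ∀ t f → t * (f * + 0) ≡ + 0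
      zeros′ = solve-∀
      n-m : + n - + m ≡ + 1
      n-m = trans (cong (ℤ._- + m) (ℤ.pos-+ 1 m)) (one (+ m))
        where
        one : ∀ m → + 1 + m - m ≡ + 1
        one = solve-∀
      -- The two successive complements, of orders `n` and `m = n - 1`, reflect twice and so shift
      -- by one: `c₂ x` is `c (x + 1)`.
      n-[m-x] : ∀ x → + n - (+ m - x) ≡ x + + 1
      n-[m-x] x = trans (cong (ℤ._- (+ m - x)) (ℤ.pos-+ 1 m)) (one (+ m) x)
        where
        one : ∀ m x → + 1 + m - (m - x) ≡ x + + 1
        one = solve-∀
      pull : ∀ t x a f → t * (x * (a * (x * f))) ≡ x * (x * (t * (a * f)))
      pull = solve-∀
      H-identity : ∀ s s' x m f → s * (x * ((+ 1 + m - x - + 1) * (s' * ((x - (+ 1 + m)) * f)))) ≡ (+ 1 + m - x) * (s * s' * (x * ((x - m) * f)))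
      H-identity = solve-∀
    -- The eigenvalue `n` of `G` becomes a zero besides the trivial one, and the double eigenvalue 1
    -- becomes the double eigenvalue `m`.
    H-relation : ∀ x → c₁ x * χ H x ≡ t₁ * (x * ((x - + m) * falling m x))
    H-relation = smooth-cancel-reflected (smooth-* C₁ (smooth-χ H))
      (smooth-* (smooth-const t₁) (smooth-* smooth-id (smooth-* (smooth-root (+ m)) (smooth-falling m)))) (+ n) (λ x → begin
        (+ n - x) * (c₁ x * χ H x) ≡⟨ complement-relation G c (λ x → (x - + 1) * falling n x) e x ⟩
        s₁ * (x * ((+ n - x - + 1) * falling n (+ n - x))) ≡⟨ cong (λ z → s₁ * (x * ((+ n - x - + 1) * z))) (falling-reflect n x) ⟩
        s₁ * (x * ((+ n - x - + 1) * ((- (+ 1)) ^ suc n * ((x - + n) * falling m x))))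
          ≡⟨ subst (λ N → s₁ * (x * ((N - x - + 1) * ((- (+ 1)) ^ suc n * ((x - N) * falling m x)))) ≡ (N - x) * (t₁ * (x * ((x - + m) * falling m x))))
               (pos-suc m) (H-identity s₁ _ x (+ m) (falling m x)) ⟩
        (+ n - x) * (t₁ * (x * ((x - + m) * falling m x))) ∎)
    step₁ : Σ (SimpleGraph m) (λ H' → ∀ x → χ H x ≡ x * χ H' x) → ⊥
    step₁ (H' , H-H') =
      step₂ (isolated-from-eigenvalue Γ
        (double-zero Γ C₂ (smooth-* (smooth-const t₂) (smooth-falling (suc k)))
          (λ z → c1 (trans (sym (cong c (trans (n-[m-x] (+ 0)) (+-identityˡ _)))) z))
          (λ x → trans (Γ-relation x) (pull₂ t₂ x _)))
        (*-cancel-zero (λ z → cm (trans (sym c₂-top) z))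
          (trans (Γ-relation (+ suc k)) (trans (cong (λ z → t₂ * (+ suc k * (+ suc k * z))) (falling-root (suc k))) (zeros₂ t₂ _)))))
      where
      H'-relation : ∀ x → c₁ x * χ H' x ≡ t₁ * ((x - + m) * falling m x)
      H'-relation = smooth-cancel-x (smooth-* C₁ (smooth-χ H')) (smooth-* (smooth-const t₁) (smooth-* (smooth-root (+ m)) (smooth-falling m)))
        (λ x → trans (swap x (c₁ x) _) (trans (cong (c₁ x *_) (sym (H-H' x))) (trans (H-relation x) (swap t₁ x _))))
        where
        opaque
          unfolding _+_
          swap : ∀ x c y → x * (c * y) ≡ c * (x * y)
          swap = solve-∀
      Γ : SimpleGraph m
      Γ = complement H'
      c₂ : ℤ → ℤ
      c₂ x = c₁ (+ m - x)
      C₂ : Smooth c₂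
      C₂ = smooth-∘ C₁ (smooth-reflect (+ m))
      s₂ t₂ : ℤ
      s₂ = (- (+ 1)) ^ suc k
      t₂ = s₂ * t₁ * (- (+ 1)) ^ suc m
      c₂-top : c₂ (+ suc k) ≡ c (+ m)
      c₂-top = cong c (trans (n-[m-x] (+ suc k)) (trans (swap (+ suc k)) (pos-suc (suc k))))
        where
        opaque
          unfolding _+_
          swap : ∀ x → x + + 1 ≡ + 1 + x
          swap = solve-∀
      opaque
        unfolding _+_
        pull₂ : ∀ t x f → t * (x * (x * f)) ≡ x * (x * (t * f))
        pull₂ = solve-∀
        zeros₂ : ∀ t y → t * (y * (y * + 0)) ≡ + 0
        zeros₂ = solve-∀
        Γ-identity : ∀ s t s' x m f → s * (x * (t * ((m - x - m) * (s' * ((x - m) * f))))) ≡ (m - x) * (s * t * s' * (x * (x * f)))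
        Γ-identity = solve-∀
      -- Since `m` is the order of `H'`, its double eigenvalue `m` becomes two zeros of `Γ` besides
      -- the trivial one.
      Γ-relation : ∀ x → c₂ x * χ Γ x ≡ t₂ * (x * (x * falling (suc k) x))
      Γ-relation = smooth-cancel-reflected (smooth-* C₂ (smooth-χ Γ))
        (smooth-* (smooth-const t₂) (smooth-* smooth-id (smooth-* smooth-id (smooth-falling (suc k))))) (+ m) (λ x → begin
          (+ m - x) * (c₂ x * χ Γ x) ≡⟨ complement-relation H' c₁ (λ x → t₁ * ((x - + m) * falling m x)) H'-relation x ⟩
          s₂ * (x * (t₁ * ((+ m - x - + m) * falling m (+ m - x))))
            ≡⟨ cong (λ z → s₂ * (x * (t₁ * ((+ m - x - + m) * z)))) (falling-reflect m x) ⟩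
          s₂ * (x * (t₁ * ((+ m - x - + m) * ((- (+ 1)) ^ suc m * ((x - + m) * falling (suc k) x)))))
            ≡⟨ Γ-identity s₂ t₁ _ x (+ m) _ ⟩
          (+ m - x) * (t₂ * (x * (x * falling (suc k) x))) ∎)
      step₂ : Σ (SimpleGraph (suc k)) (λ Γ' → ∀ x → χ Γ x ≡ x * χ Γ' x) → ⊥
      -- One zero went with the isolated vertex; `Γ'` keeps two zeros and the eigenvalue `suc k`,
      -- now equal to its order.
      step₂ (Γ' , Γ-Γ') = no-full-eigenvalue Γ'
        (double-zero Γ' C₂ (smooth-* (smooth-const t₂) (smooth-∘ (smooth-falling k) (smooth-root (+ 1))))
          (λ z → c1 (trans (sym (cong c (trans (n-[m-x] (+ 0)) (+-identityˡ _)))) z))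
          (λ x → trans (Γ'-relation x) (trans (cong (λ z → t₂ * (x * z)) (falling-shift k x)) (pull₂ t₂ x _))))
        (*-cancel-zero (λ z → cm (trans (sym c₂-top) z))
          (trans (Γ'-relation (+ suc k)) (trans (cong (λ z → t₂ * (+ suc k * z)) (falling-root (suc k))) (zeros′ t₂ _))))
        where
        Γ'-relation : ∀ x → c₂ x * χ Γ' x ≡ t₂ * (x * falling (suc k) x)
        Γ'-relation = smooth-cancel-x (smooth-* C₂ (smooth-χ Γ')) (smooth-* (smooth-const t₂) (smooth-* smooth-id (smooth-falling (suc k))))
          (λ x → trans (swap x (c₂ x) _) (trans (cong (c₂ x *_) (sym (Γ-Γ' x))) (trans (Γ-relation x) (swap t₂ x _))))
          where
          opaque
            unfolding _+_
            swap : ∀ x c y → x * (c * y) ≡ c * (x * y)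
            swap = solve-∀

  -- Disjoint unions, cones and their spectra

  empty : SimpleGraph 0
  empty = record { adj = λ () ; symm = λ () ; irrefl = λ () }

  K₁∪_ : ∀ {n} → SimpleGraph n → SimpleGraph (suc n)
  K₁∪_ {n} G = record { adj = a ; symm = s ; irrefl = r }
    where
    a : Fin (suc n) → Fin (suc n) → Bool
    a zero _ = false
    a (suc u) zero = false
    a (suc u) (suc v) = adj G u v
    s : ∀ u v → a u v ≡ a v u
    s zero zero = refl
    s zero (suc v) = refl
    s (suc u) zero = refl
    s (suc u) (suc v) = symm G u v
    r : ∀ v → a v v ≡ false
    r zero = refl
    r (suc v) = irrefl G v

  χ-K₁∪ : ∀ {n} (G : SimpleGraph n) x → χ (K₁∪ G) x ≡ x * χ G x
  χ-K₁∪ G x = trans (χ-isolated (K₁∪ G) (λ _ → refl) x) (cong (x *_) (χ-cong (relabel suc (K₁∪ G)) G (λ _ _ → refl) x))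

  K₂∪_ : ∀ {n} → SimpleGraph n → SimpleGraph (suc (suc n))
  K₂∪_ {n} G = record { adj = a ; symm = s ; irrefl = r }
    where
    a : Fin (suc (suc n)) → Fin (suc (suc n)) → Bool
    a zero (suc zero) = true
    a (suc zero) zero = true
    a (suc (suc u)) (suc (suc v)) = adj G u v
    a zero zero = false
    a zero (suc (suc v)) = false
    a (suc zero) (suc v) = false
    a (suc (suc u)) zero = false
    a (suc (suc u)) (suc zero) = false
    s : ∀ u v → a u v ≡ a v u
    s zero zero = refl
    s zero (suc zero) = refl
    s zero (suc (suc v)) = refl
    s (suc zero) zero = refl
    s (suc zero) (suc zero) = refl
    s (suc zero) (suc (suc v)) = refl
    s (suc (suc u)) zero = refl
    s (suc (suc u)) (suc zero) = refl
    s (suc (suc u)) (suc (suc v)) = symm G u v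
    r : ∀ v → a v v ≡ false
    r zero = refl
    r (suc zero) = refl
    r (suc (suc v)) = irrefl G v

  deg-K₂ : ∀ {n} (G : SimpleGraph n) → deg (K₂∪ G) zero ≡ + 1 × deg (K₂∪ G) (suc zero) ≡ + 1 × (∀ u → deg (K₂∪ G) (suc (suc u)) ≡ deg G u)
  deg-K₂ {n} G =
      expand zero (trans (cong (λ z → + 0 + (+ 1 + z)) (sum-zero n (λ _ → refl))) (trans (+-identityˡ _) (+-identityʳ _)))
    , expand (suc zero) (trans (cong (λ z → + 1 + (+ 0 + z)) (sum-zero n (λ _ → refl))) (trans (cong (_+_ (+ 1)) (+-identityˡ _)) (+-identityʳ _)))
    , λ u → expand (suc (suc u)) (trans (+-identityˡ _) (+-identityˡ _))
    where
    A = adjacency (K₂∪ G)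
    expand : ∀ u {d} → A u zero + (A u (suc zero) + sumFin n (λ v → A u (suc (suc v)))) ≡ d → deg (K₂∪ G) u ≡ d
    expand u e = trans (sum-suc (suc n) (A u)) (trans (cong (_+_ (A u zero)) (sum-suc n _)) e)

  χ-K₂∪ : ∀ {n} (G : SimpleGraph n) x → χ (K₂∪ G) x ≡ x * ((x - + 2) * χ G x)
  χ-K₂∪ {n} G x = begin
    det (suc (suc n)) M ≡⟨ trans (det-suc (suc n) M) (trans (sum-suc (suc n) _) (cong (_+_ (+ 1 * (M zero zero * det (suc n) (minor M zero)))) (sum-suc n _))) ⟩
    + 1 * (M zero zero * det (suc n) (minor M zero)) + (sgn {suc (suc n)} (suc zero) * (M zero (suc zero) * det (suc n) (minor M (suc zero)))
      + sumFin n (λ c → sgn c * (M zero (suc (suc c)) * det (suc n) (minor M (suc (suc c))))))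
      ≡⟨ cong₂ (λ a b → + 1 * a + b) (cong₂ _*_ (diagonal zero (proj₁ degrees)) minor₀)
           (cong₂ (λ a b → sgn {suc (suc n)} (suc zero) * a + b) (cong₂ _*_ (bond _) minor₁)
             (sum-zero n (λ c → trans (cong (λ z → sgn c * (z * det (suc n) (minor M (suc (suc c))))) (off _)) (zeros (sgn c) _)))) ⟩
    + 1 * ((x - + 1) * ((x - + 1) * χ G x)) + (sgn {suc (suc n)} (suc zero) * (+ 1 * (+ 1 * χ G x)) + + 0)
      ≡⟨ identity x (χ G x) ⟩
    x * ((x - + 2) * χ G x) ∎
    where
    M : Matrix (suc (suc n))
    M = characteristic (K₂∪ G) x
    degrees = deg-K₂ G
    opaque
      unfolding _+_
      off : ∀ d → x * + 0 - (+ 0 * d - + 0) ≡ + 0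
      off = off′ x
        where
        off′ : ∀ x d → x * + 0 - (+ 0 * d - + 0) ≡ + 0
        off′ = solve-∀
      bond : ∀ d → x * + 0 - (+ 0 * d - + 1) ≡ + 1
      bond = bond′ x
        where
        bond′ : ∀ x d → x * + 0 - (+ 0 * d - + 1) ≡ + 1
        bond′ = solve-∀
      one : ∀ x → x * + 1 - (+ 1 * + 1 - + 0) ≡ x - + 1
      one = solve-∀
      zeros : ∀ s d → s * (+ 0 * d) ≡ + 0
      zeros = solve-∀
      identity : ∀ x c → + 1 * ((x - + 1) * ((x - + 1) * c)) + (ℤ.- (+ 1) * (+ 1 * (+ 1 * c)) + + 0) ≡ x * ((x - + 2) * c)
      identity = solve-∀
    diagonal : ∀ u → deg (K₂∪ G) u ≡ + 1 → x * + 1 - (+ 1 * deg (K₂∪ G) u - + 0) ≡ x - + 1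
    diagonal u e = trans (cong (λ d → x * + 1 - (+ 1 * d - + 0)) e) (one x)
    rest : det n (λ u v → M (suc (suc u)) (suc (suc v))) ≡ χ G x
    rest = det-cong n (λ u v → cong (λ d → x * δ u v - (δ u v * d - adjacency G u v)) (proj₂ (proj₂ degrees) u))
    minor₀ : det (suc n) (minor M zero) ≡ (x - + 1) * χ G x
    minor₀ = trans (det-unit-row n (minor M zero) (λ c → off _)) (cong₂ _*_ (diagonal (suc zero) (proj₁ (proj₂ degrees))) rest)
    minor₁ : det (suc n) (minor M (suc zero)) ≡ + 1 * χ G x
    minor₁ = trans (det-unit-row n (minor M (suc zero)) (λ c → off _)) (cong₂ _*_ (bond _) rest)

  -- The join with a single vertex, written through complements so that its spectrum follows from
  -- `χ-complement` and `χ-K₁∪`.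
  cone : ∀ {n} → SimpleGraph n → SimpleGraph (suc n)
  cone G = complement (K₁∪ complement G)

  sign-square : ∀ k → (- (+ 1)) ^ k * (- (+ 1)) ^ k ≡ + 1
  sign-square zero = *-identityˡ _
  sign-square (suc k) = trans (identity _) (sign-square k)
    where
    opaque
      unfolding _+_
      identity : ∀ s → - (+ 1) * s * (- (+ 1) * s) ≡ s * s
      identity = solve-∀

  -- Reflections at the orders `k + 1` and `k + 2` move the nontrivial eigenvalues up by one, and
  -- the apex contributes `k + 2`. The factor `x - 1` removes the shifted trivial zero of `G`.
  χ-cone : ∀ {k} (G : SimpleGraph (suc k)) x → (x - + 1) * χ (cone G) x ≡ x * ((x - + suc (suc k)) * χ G (x - + 1))
  χ-cone {k} G x = begin
    (x - + 1) * χ (cone G) x ≡⟨ cong ((x - + 1) *_) (reduced x) ⟩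
    (x - + 1) * (s' * (x * χ (complement G) y)) ≡⟨ cong (λ d → d * (s' * (x * χ (complement G) y))) m-y ⟨
    (+ m - y) * (s' * (x * χ (complement G) y)) ≡⟨ swap (+ m - y) s' x _ ⟩
    s' * (x * ((+ m - y) * χ (complement G) y)) ≡⟨ cong (λ z → s' * (x * z)) (χ-complement G y) ⟩
    s' * (x * (s * (y * χ G (+ m - y)))) ≡⟨ cong (λ d → s' * (x * (s * (y * χ G d)))) m-y ⟩
    s' * (x * (s * (y * χ G (x - + 1)))) ≡⟨ regroup s x (+ suc m) (χ G (x - + 1)) ⟩
    s * s * (x * ((x - + suc m) * χ G (x - + 1))) ≡⟨ trans (cong (_* (x * ((x - + suc m) * χ G (x - + 1)))) (sign-square k)) (*-identityˡ _) ⟩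
    x * ((x - + suc m) * χ G (x - + 1)) ∎
    where
    m = suc k
    y = + suc m - x
    s = (- (+ 1)) ^ k
    s' = - (+ 1) * s
    opaque
      unfolding _+_
      swap : ∀ d s x c → d * (s * (x * c)) ≡ s * (x * (d * c))
      swap = solve-∀
      regroup : ∀ s x n c → - (+ 1) * s * (x * (s * ((n - x) * c))) ≡ s * s * (x * ((x - n) * c))
      regroup = solve-∀
      pull : ∀ s x y c → s * (x * (y * c)) ≡ y * (s * (x * c))
      pull = solve-∀
      drop : ∀ m x → m - (+ 1 + m - x) ≡ x - + 1
      drop = solve-∀
    m-y : + m - y ≡ x - + 1
    m-y = trans (cong (λ n → + m - (n - x)) (sym (pos-suc m))) (drop (+ m) x)
    reduced : ∀ x → χ (cone G) x ≡ s' * (x * χ (complement G) (+ suc m - x))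
    reduced = smooth-cancel-reflected (smooth-χ (cone G))
      (smooth-* (smooth-const s') (smooth-* smooth-id (smooth-∘ (smooth-χ (complement G)) (smooth-reflect (+ suc m))))) (+ suc m)
      (λ x → trans (χ-complement (K₁∪ complement G) x) (trans (cong (λ z → s' * (x * z)) (χ-K₁∪ (complement G) _)) (pull s' x _ _)))

  cone-connected : ∀ {n} (G : SimpleGraph n) → Connected (cone G)
  cone-connected G zero zero = here
  cone-connected G zero (suc v) = step here refl
  cone-connected G (suc u) zero = step here refl
  cone-connected G (suc u) (suc v) = step {v = zero} (step here refl) refl

  -- The Laplacian spectrum of G is {0, …, n} with i removed.
  Omits : ∀ {n} → ℕ → SimpleGraph n → Set
  Omits {n} i G = ∀ x → (x - + i) * χ G x ≡ falling n x

  omits-K₁ : Omits 1 (K₁∪ empty)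
  omits-K₁ x = cong ((x - + 1) *_) (trans (χ-K₁∪ empty x) (trans (cong (x *_) (det-nil _)) (*-identityʳ x)))

  omits-K₂ : Omits 1 (K₂∪ empty)
  omits-K₂ x = trans (cong ((x - + 1) *_) (trans (χ-K₂∪ empty x) (cong (λ z → x * ((x - + 2) * z)) (det-nil _)))) (identity x)
    where
    opaque
      unfolding _+_
      identity : ∀ x → (x - + 1) * (x * ((x - + 2) * + 1)) ≡ (x - + 2) * ((x - + 1) * x)
      identity = solve-∀

  opaque
    unfolding _+_
    shift-suc : ∀ x i → x - + suc i ≡ x - + 1 - + i
    shift-suc x i = trans (cong (ℤ._-_ x) (ℤ.pos-+ 1 i)) (identity x (+ i))
      where
      identity : ∀ x i → x - (+ 1 + i) ≡ x - + 1 - i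
      identity = solve-∀

  -- The isolated vertex supplies a nontrivial zero, which the cone lifts to 1; the range up to
  -- `k + 1` is lifted to `k + 2`, and the apex adds `k + 3`.
  omits-cone-K₁ : ∀ {k i} (G : SimpleGraph (suc k)) → Omits i G → Omits (suc i) (cone (K₁∪ G))
  omits-cone-K₁ {k} {i} G e = smooth-cancel (smooth-* (smooth-root (+ suc i)) (smooth-χ (cone (K₁∪ G)))) (smooth-falling (3 ℕ.+ k)) (+ 1) (λ x →
    let y = x - + 1 ; d = x - + (3 ℕ.+ k) in begin
    y * ((x - + suc i) * χ (cone (K₁∪ G)) x) ≡⟨ swap y (x - + suc i) _ ⟩
    (x - + suc i) * (y * χ (cone (K₁∪ G)) x) ≡⟨ cong₂ _*_ (shift-suc x i) (trans (χ-cone (K₁∪ G) x) (cong (λ z → x * (d * z)) (χ-K₁∪ G y))) ⟩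
    (y - + i) * (x * (d * (y * χ G y))) ≡⟨ regroup (y - + i) x d y _ ⟩
    y * (d * (x * ((y - + i) * χ G y))) ≡⟨ cong (λ z → y * (d * (x * z))) (e y) ⟩
    y * (d * (x * falling (suc k) y)) ≡⟨ cong (λ z → y * (d * z)) (falling-shift (suc k) x) ⟨
    y * falling (3 ℕ.+ k) x ∎)
    where
    opaque
      unfolding _+_
      swap : ∀ x c y → x * (c * y) ≡ c * (x * y)
      swap = solve-∀
      regroup : ∀ a x d y c → a * (x * (d * (y * c))) ≡ y * (d * (x * (a * c)))
      regroup = solve-∀

  -- The eigenvalue 2 of `K₂` fills the gap of `G`; besides the trivial zero the union has
  -- `0, …, k + 1`, which the complement of order `k + 3` sends to `2, …, k + 3`.
  omits-complement-K₂ : ∀ {k} (G : SimpleGraph (suc k)) → Omits 2 G → Omits 1 (complement (K₂∪ G))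
  omits-complement-K₂ {k} G e x = begin
    (x - + 1) * χ (complement (K₂∪ G)) x ≡⟨ cong ((x - + 1) *_) (reduced x) ⟩
    (x - + 1) * (s * (x * falling (suc k) (+ N - x))) ≡⟨ cong (λ z → (x - + 1) * (s * (x * z))) (trans (cong (falling (suc k)) N-x) (falling-reflect (suc k) _)) ⟩
    (x - + 1) * (s * (x * (s * falling (suc k) (x - + 1 - + 1)))) ≡⟨ regroup (x - + 1) s x _ ⟩
    s * s * (x * ((x - + 1) * falling (suc k) (x - + 1 - + 1))) ≡⟨ trans (cong (_* (x * ((x - + 1) * falling (suc k) (x - + 1 - + 1)))) (sign-square (2 ℕ.+ k))) (*-identityˡ _) ⟩
    x * ((x - + 1) * falling (suc k) (x - + 1 - + 1)) ≡⟨ cong (x *_) (falling-shift (suc k) (x - + 1)) ⟨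
    x * falling (2 ℕ.+ k) (x - + 1) ≡⟨ falling-shift (2 ℕ.+ k) x ⟨
    falling (3 ℕ.+ k) x ∎
    where
    N = 3 ℕ.+ k
    s = (- (+ 1)) ^ (2 ℕ.+ k)
    opaque
      unfolding _+_
      regroup : ∀ y s x f → y * (s * (x * (s * f))) ≡ s * s * (x * (y * f))
      regroup = solve-∀
      pull : ∀ s x y c → s * (x * (y * c)) ≡ y * (s * (x * c))
      pull = solve-∀
      two-steps : ∀ k x → + 1 + (+ 1 + k) - x ≡ k - (x - + 1 - + 1)
      two-steps = solve-∀
    N-x : + N - x ≡ + suc k - (x - + 1 - + 1)
    N-x = trans (cong (_- x) (sym (trans (cong (_+_ (+ 1)) (pos-suc (suc k))) (pos-suc (2 ℕ.+ k))))) (two-steps (+ suc k) x)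
    reduced : ∀ x → χ (complement (K₂∪ G)) x ≡ s * (x * falling (suc k) (+ N - x))
    reduced = smooth-cancel-reflected (smooth-χ (complement (K₂∪ G)))
      (smooth-* (smooth-const s) (smooth-* smooth-id (smooth-∘ (smooth-falling (suc k)) (smooth-reflect (+ N))))) (+ N)
      (λ x → trans (χ-complement (K₂∪ G) x) (trans (cong (λ z → s * (x * z)) (trans (χ-K₂∪ G _) (cong ((+ N - x) *_) (e (+ N - x))))) (pull s x _ _)))

  -- After `K₂` has filled the gap, the cone lifts `0, …, k + 1` to `1, …, k + 2` and adds `k + 4`;
  -- the new gap is in between.
  omits-cone-K₂ : ∀ {k} (G : SimpleGraph (suc k)) → Omits 2 G → Omits (3 ℕ.+ k) (cone (K₂∪ G))
  omits-cone-K₂ {k} G e = smooth-cancel (smooth-* (smooth-root (+ (3 ℕ.+ k))) (smooth-χ (cone (K₂∪ G)))) (smooth-falling (4 ℕ.+ k)) (+ 1) (λ x →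
    let y = x - + 1 ; b = x - + (3 ℕ.+ k) ; d = x - + (4 ℕ.+ k) in begin
    y * (b * χ (cone (K₂∪ G)) x) ≡⟨ swap y b _ ⟩
    b * (y * χ (cone (K₂∪ G)) x) ≡⟨ cong (b *_) (trans (χ-cone (K₂∪ G) x) (cong (λ z → x * (d * z)) (trans (χ-K₂∪ G y) (cong (y *_) (e y))))) ⟩
    b * (x * (d * (y * falling (suc k) y))) ≡⟨ regroup b x d y _ ⟩
    y * (d * (b * (x * falling (suc k) y))) ≡⟨ cong (λ z → y * (d * (b * z))) (falling-shift (suc k) x) ⟨
    y * falling (4 ℕ.+ k) x ∎)
    where
    opaque
      unfolding _+_
      swap : ∀ x c y → x * (c * y) ≡ c * (x * y)
      swap = solve-∀
      regroup : ∀ a x d y c → a * (x * (d * (y * c))) ≡ y * (d * (a * (x * c)))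
      regroup = solve-∀

  -- The Laplacian spectrum of G is {0, …, n} with 1 doubled and i and j removed.
  OmitsDoubling : ∀ {n} → ℕ → ℕ → SimpleGraph n → Set
  OmitsDoubling {n} i j G = ∀ x → (x - + i) * (x - + j) * χ G x ≡ (x - + 1) * falling n x

  -- Two isolated vertices give two nontrivial zeros and thus a double eigenvalue 1. The second one
  -- raises the order without raising the largest eigenvalue of `G`, which opens the gap just below
  -- the order.
  omits-doubling-K₁ : ∀ {k i} (G : SimpleGraph (suc k)) → Omits i G → OmitsDoubling (suc i) (3 ℕ.+ k) (cone (K₁∪ K₁∪ G))
  omits-doubling-K₁ {k} {i} G e = smooth-cancel
    (smooth-* (smooth-* (smooth-root (+ suc i)) (smooth-root (+ (3 ℕ.+ k)))) (smooth-χ (cone (K₁∪ K₁∪ G))))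
    (smooth-* (smooth-root (+ 1)) (smooth-falling (4 ℕ.+ k))) (+ 1) (λ x →
    let y = x - + 1 ; b = x - + (3 ℕ.+ k) ; d = x - + (4 ℕ.+ k) in begin
    y * ((x - + suc i) * b * χ (cone (K₁∪ K₁∪ G)) x) ≡⟨ swap y _ _ ⟩
    (x - + suc i) * b * (y * χ (cone (K₁∪ K₁∪ G)) x)
      ≡⟨ cong₂ (λ a z → a * b * z) (shift-suc x i) (trans (χ-cone (K₁∪ K₁∪ G) x) (cong (λ z → x * (d * z)) (trans (χ-K₁∪ (K₁∪ G) y) (cong (y *_) (χ-K₁∪ G y))))) ⟩
    (y - + i) * b * (x * (d * (y * (y * χ G y)))) ≡⟨ regroup (y - + i) b x d y _ ⟩
    y * (y * (d * (b * (x * ((y - + i) * χ G y))))) ≡⟨ cong (λ z → y * (y * (d * (b * (x * z))))) (e y) ⟩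
    y * (y * (d * (b * (x * falling (suc k) y)))) ≡⟨ cong (λ z → y * (y * (d * (b * z)))) (falling-shift (suc k) x) ⟨
    y * (y * falling (4 ℕ.+ k) x) ∎)
    where
    opaque
      unfolding _+_
      swap : ∀ x c y → x * (c * y) ≡ c * (x * y)
      swap = solve-∀
      regroup : ∀ a b x d y c → a * b * (x * (d * (y * (y * c)))) ≡ y * (y * (d * (b * (x * (a * c)))))
      regroup = solve-∀

  -- Serves the removal of `n - 2` and `n - 1`: a gap of a graph of order `n - 3` lies below that
  -- order, so `omits-doubling-K₁` yields only gaps up to `n - 3`.
  omits-doubling-K₂ : ∀ {k} (G : SimpleGraph (suc k)) → Omits 2 G → OmitsDoubling (3 ℕ.+ k) (4 ℕ.+ k) (cone (K₁∪ K₂∪ G))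
  omits-doubling-K₂ {k} G e = smooth-cancel
    (smooth-* (smooth-* (smooth-root (+ (3 ℕ.+ k))) (smooth-root (+ (4 ℕ.+ k)))) (smooth-χ (cone (K₁∪ K₂∪ G))))
    (smooth-* (smooth-root (+ 1)) (smooth-falling (5 ℕ.+ k))) (+ 1) (λ x →
    let y = x - + 1 ; a = x - + (3 ℕ.+ k) ; b = x - + (4 ℕ.+ k) ; d = x - + (5 ℕ.+ k) in begin
    y * (a * b * χ (cone (K₁∪ K₂∪ G)) x) ≡⟨ swap y _ _ ⟩
    a * b * (y * χ (cone (K₁∪ K₂∪ G)) x)
      ≡⟨ cong (a * b *_) (trans (χ-cone (K₁∪ K₂∪ G) x) (cong (λ z → x * (d * z)) (trans (χ-K₁∪ (K₂∪ G) y) (cong (y *_) (trans (χ-K₂∪ G y) (cong (y *_) (e y))))))) ⟩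
    a * b * (x * (d * (y * (y * falling (suc k) y)))) ≡⟨ regroup a b x d y _ ⟩
    y * (y * (d * (b * (a * (x * falling (suc k) y))))) ≡⟨ cong (λ z → y * (y * (d * (b * (a * z))))) (falling-shift (suc k) x) ⟨
    y * (y * falling (5 ℕ.+ k) x) ∎)
    where
    opaque
      unfolding _+_
      swap : ∀ x c y → x * (c * y) ≡ c * (x * y)
      swap = solve-∀
      regroup : ∀ a b x d y c → a * b * (x * (d * (y * (y * c)))) ≡ y * (y * (d * (b * (a * (x * c)))))
      regroup = solve-∀

  -- Root lists and parity

  opaque
    unfolding _+_
    prodRoots-∷ : ∀ s l x → prodRoots (s ∷ᴸ l) x ≡ (x - + s) * prodRoots l x
    prodRoots-∷ s l x = refl

  smooth-prodRoots : ∀ l → Smooth (prodRoots l)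
  smooth-prodRoots [] = smooth-const (+ 1)
  smooth-prodRoots (s ∷ᴸ l) = smooth-resp (λ x → sym (prodRoots-∷ s l x)) (smooth-* (smooth-root (+ s)) (smooth-prodRoots l))

  factor : Bool → ℕ → ℤ → ℤ
  factor b k x = if b then x - + k else + 1

  prodRoots-filter-∷ʳ : ∀ (p : ℕ → Bool) l k x → prodRoots (filterᵇ p (l ∷ʳ k)) x ≡ prodRoots (filterᵇ p l) x * factor (p k) k x
  prodRoots-filter-∷ʳ p [] k x with p k
  ... | true = trans (prodRoots-∷ k [] x) (*-comm (x - + k) (+ 1))
  ... | false = sym (*-identityˡ (+ 1))
  prodRoots-filter-∷ʳ p (s ∷ᴸ l) k x with p s
  ... | true = trans (prodRoots-∷ s (filterᵇ p (l ∷ʳ k)) x) (trans (cong ((x - + s) *_) (prodRoots-filter-∷ʳ p l k x))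
                 (trans (sym (*-assoc _ _ _)) (cong (_* factor (p k) k x) (sym (prodRoots-∷ s (filterᵇ p l) x)))))
  ... | false = prodRoots-filter-∷ʳ p l k x

  -- Equal to 1 as long as `n` is at most `i`, and to `x - i` afterwards; it records in the
  -- induction over `upTo n` whether `i` has been passed.
  removed : ℕ → ℕ → ℤ → ℤ
  removed i zero x = + 1
  removed i (suc n) x = removed i n x * factor (n ℕ.≡ᵇ i) n x

  ≡ᵇ-refl : ∀ i → (i ℕ.≡ᵇ i) ≡ true
  ≡ᵇ-refl zero = refl
  ≡ᵇ-refl (suc i) = ≡ᵇ-refl i

  ≡ᵇ-≢ : ∀ {m n} → m ≢ n → (m ℕ.≡ᵇ n) ≡ false
  ≡ᵇ-≢ {m} {n} ne with m ℕ.≡ᵇ n in e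
  ... | false = refl
  ... | true = ⊥-elim (ne (ℕ.≡ᵇ⇒≡ m n (subst T (sym e) _)))

  removed-none : ∀ {i} n x → n ℕ.≤ i → removed i n x ≡ + 1
  removed-none zero x le = refl
  removed-none (suc n) x le = trans (cong₂ _*_ (removed-none n x (ℕ.<⇒≤ le)) (cong (λ b → factor b n x) (≡ᵇ-≢ (ℕ.<⇒≢ le)))) (*-identityˡ _)

  removed-one : ∀ {i} n x → i ℕ.< n → removed i n x ≡ x - + i
  removed-one {i} (suc n) x (s≤s le) with ℕ.m≤n⇒m<n∨m≡n le
  ... | inj₁ lt = trans (cong₂ _*_ (removed-one n x lt) (cong (λ b → factor b n x) (≡ᵇ-≢ (ℕ.>⇒≢ lt)))) (*-identityʳ _)
  ... | inj₂ refl = trans (cong₂ _*_ (removed-none n x ℕ.≤-refl) (cong (λ b → factor b n x) (≡ᵇ-refl n))) (*-identityˡ _)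

  below : ℕ → ℤ → ℤ
  below zero x = + 1
  below (suc n) x = below n x * (x - + n)

  below-falling : ∀ n x → below (suc n) x ≡ falling n x
  below-falling zero x = identity x
    where
    opaque
      unfolding _+_
      identity : ∀ x → + 1 * (x - + 0) ≡ x
      identity = solve-∀
  below-falling (suc n) x = trans (cong (_* (x - + suc n)) (below-falling n x)) (*-comm _ _)

  below-split : ∀ {i j} → i ≢ j → ∀ n x → let p = λ k → not (k ℕ.≡ᵇ i) ∧ not (k ℕ.≡ᵇ j) in
    removed i n x * removed j n x * prodRoots (filterᵇ p (upTo n)) x ≡ below n x
  below-split i≢j zero x = trans (*-identityʳ _) (*-identityˡ _)
  below-split {i} {j} i≢j (suc n) x = begin
    removed i n x * f * (removed j n x * g) * prodRoots (filterᵇ p (upTo (suc n))) x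
      ≡⟨ cong (λ l → removed i n x * f * (removed j n x * g) * prodRoots (filterᵇ p l) x) (upTo-∷ʳ n) ⟨
    removed i n x * f * (removed j n x * g) * prodRoots (filterᵇ p (upTo n ∷ʳ n)) x
      ≡⟨ cong (removed i n x * f * (removed j n x * g) *_) (prodRoots-filter-∷ʳ p (upTo n) n x) ⟩
    removed i n x * f * (removed j n x * g) * (prodRoots (filterᵇ p (upTo n)) x * factor (p n) n x)
      ≡⟨ regroup (removed i n x) f (removed j n x) g _ (factor (p n) n x) ⟩
    removed i n x * removed j n x * prodRoots (filterᵇ p (upTo n)) x * (f * g * factor (p n) n x)
      ≡⟨ cong₂ _*_ (below-split i≢j n x) factors ⟩
    below n x * (x - + n) ∎
    where
    p = λ k → not (k ℕ.≡ᵇ i) ∧ not (k ℕ.≡ᵇ j)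
    f = factor (n ℕ.≡ᵇ i) n x
    g = factor (n ℕ.≡ᵇ j) n x
    opaque
      unfolding _+_
      regroup : ∀ a f b g c h → a * f * (b * g) * (c * h) ≡ a * b * c * (f * g * h)
      regroup = solve-∀
    factors : f * g * factor (p n) n x ≡ x - + n
    factors with n ℕ.≡ᵇ i in ei | n ℕ.≡ᵇ j in ej
    ... | true | true = ⊥-elim (i≢j (trans (sym (ℕ.≡ᵇ⇒≡ n i (subst T (sym ei) _))) (ℕ.≡ᵇ⇒≡ n j (subst T (sym ej) _))))
    ... | true | false = trans (*-identityʳ _) (*-identityʳ _)
    ... | false | true = trans (*-identityʳ _) (*-identityˡ _)
    ... | false | false = trans (cong (_* (x - + n)) (*-identityˡ _)) (*-identityˡ _)

  Sset-roots : ∀ n {i j} → i ℕ.≤ n → j ℕ.≤ n → i ≢ j → ∀ x →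
    (x - + i) * (x - + j) * prodRoots (Sset n 1 i j) x ≡ (x - + 1) * falling n x
  Sset-roots n {i} {j} i≤n j≤n i≢j x = begin
    (x - + i) * (x - + j) * prodRoots (Sset n 1 i j) x ≡⟨ cong ((x - + i) * (x - + j) *_) (prodRoots-∷ 1 (filterᵇ p (upTo (suc n))) x) ⟩
    (x - + i) * (x - + j) * ((x - + 1) * R) ≡⟨ swap ((x - + i) * (x - + j)) (x - + 1) R ⟩
    (x - + 1) * ((x - + i) * (x - + j) * R)
      ≡⟨ cong (λ z → (x - + 1) * (z * R)) (cong₂ _*_ (removed-one (suc n) x (s≤s i≤n)) (removed-one (suc n) x (s≤s j≤n))) ⟨
    (x - + 1) * (removed i (suc n) x * removed j (suc n) x * R) ≡⟨ cong ((x - + 1) *_) (trans (below-split i≢j (suc n) x) (below-falling n x)) ⟩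
    (x - + 1) * falling n x ∎
    where
    p = λ k → not (k ℕ.≡ᵇ i) ∧ not (k ℕ.≡ᵇ j)
    R = prodRoots (filterᵇ p (upTo (suc n))) x
    opaque
      unfolding _+_
      swap : ∀ a b c → a * (b * c) ≡ b * (a * c)
      swap = solve-∀

  module _ {n i j : ℕ} (i≤n : i ℕ.≤ n) (j≤n : j ℕ.≤ n) (i≢j : i ≢ j) where

    spectrum⇒omits : ∀ {N} (G : SimpleGraph N) → HasLaplacianSpectrum G (Sset n 1 i j) →
      ∀ x → (x - + i) * (x - + j) * χ G x ≡ (x - + 1) * falling n x
    spectrum⇒omits G h x = trans (cong ((x - + i) * (x - + j) *_) (trans (sym (charPolyL-χ G x)) (h x))) (Sset-roots n i≤n j≤n i≢j x)

    omits⇒spectrum : (G : SimpleGraph n) → OmitsDoubling i j G → HasLaplacianSpectrum G (Sset n 1 i j)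
    omits⇒spectrum G h x = trans (charPolyL-χ G x)
      (smooth-cancel (smooth-χ G) (smooth-prodRoots S) (+ j)
        (smooth-cancel (smooth-* (smooth-root (+ j)) (smooth-χ G)) (smooth-* (smooth-root (+ j)) (smooth-prodRoots S)) (+ i)
          (λ x → trans (sym (*-assoc _ _ _)) (trans (h x) (trans (sym (Sset-roots n i≤n j≤n i≢j x)) (*-assoc _ _ _))))) x)
      where
      S = Sset n 1 i j

  triangular : ℕ → ℕ
  triangular zero = 0
  triangular (suc n) = suc n ℕ.+ triangular n

  monic-root : ∀ {n t f} b → Monic n t f → Monic (suc n) (b + t) (λ x → (x - b) * f x)
  monic-root {n} b F = monic-resp (λ x → +-identityʳ _) (monic-step b F (poly-zero n))

  opaque
    unfolding _+_
    pos-+ : ∀ m n → + (m ℕ.+ n) ≡ + m + + n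
    pos-+ = ℤ.pos-+

  monic-falling : ∀ n → Monic (suc n) (+ triangular n) (falling n)
  monic-falling zero = subst (λ t → Monic 1 t (falling 0)) (+-identityˡ (+ 0)) (monic-resp identity (monic-root (+ 0) monic-one))
    where
    opaque
      unfolding _+_
      identity : ∀ x → (x - + 0) * + 1 ≡ x
      identity = solve-∀
  monic-falling (suc n) = subst (λ t → Monic (suc (suc n)) t (falling (suc n))) (sym (pos-+ (suc n) _)) (monic-root (+ suc n) (monic-falling n))

  Even : ℤ → Set
  Even z = ∃[ e ] (z ≡ e + e)

  even-shift : ∀ {z w} → Even z → ∀ d → w ≡ z + (d + d) → Even w
  even-shift (e , p) d q = e + d , trans q (trans (cong (_+ (d + d)) p) (identity e d))
    where
    opaque
      unfolding _+_
      identity : ∀ e d → e + e + (d + d) ≡ e + d + (e + d)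
      identity = solve-∀

  opaque
    unfolding _+_
    even⇒double : ∀ {n} → Even (+ n) → ∃[ k ] (n ≡ 2 ℕ.* k)
    even⇒double (+ a , p) = a , trans (ℤ.+-injective p) (cong (a ℕ.+_) (sym (ℕ.+-identityʳ a)))
    double⇒even : ∀ k → Even (+ (2 ℕ.* k))
    double⇒even k = + k , cong (λ m → + (k ℕ.+ m)) (ℕ.+-identityʳ k)

  odd-not-even : ∀ k → ¬ Even (+ suc (2 ℕ.* k))
  odd-not-even k E with even⇒double E
  ... | m , p = ℕ.even≢odd m k (sym p)

  -- The number n(n+1)/2 - i is twice the number of edges of a graph with Laplacian
  -- spectrum {0, …, n} \ {i}.
  Admissible : ℕ → ℕ → Set
  Admissible n i = Even (+ i + + triangular n)

  opaque
    unfolding _+_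
    admissible-middle : ∀ {k i} → Admissible (3 ℕ.+ k) (suc i) → Admissible (suc k) i
    -- Here and below the witness is half of the change of the sum: it drops by
    -- `(k + 3) + (k + 2) + 1`, that is `2 (k + 3)`.
    admissible-middle {k} {i} E = even-shift E (- (+ 3 + + k)) (identity (+ i) (+ k) (+ triangular k))
      where
      identity : ∀ i k t → i + (+ 1 + k + t) ≡ + 1 + i + (+ 3 + k + (+ 2 + k + (+ 1 + k + t))) + (- (+ 3 + k) + - (+ 3 + k))
      identity = solve-∀
    admissible-first : ∀ {k} → Admissible (3 ℕ.+ k) 1 → Admissible (suc k) 2
    admissible-first {k} E = even-shift E (- (+ 2 + + k)) (identity (+ k) (+ triangular k))
      where
      identity : ∀ k t → + 2 + (+ 1 + k + t) ≡ + 1 + (+ 3 + k + (+ 2 + k + (+ 1 + k + t))) + (- (+ 2 + k) + - (+ 2 + k))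
      identity = solve-∀
    admissible-last : ∀ {k} → Admissible (4 ℕ.+ k) (3 ℕ.+ k) → Admissible (suc k) 2
    admissible-last {k} E = even-shift E (- (+ 5 + + k + + k)) (identity (+ k) (+ triangular k))
      where
      identity : ∀ k t → + 2 + (+ 1 + k + t) ≡ + 3 + k + (+ 4 + k + (+ 3 + k + (+ 2 + k + (+ 1 + k + t)))) + (- (+ 5 + k + k) + - (+ 5 + k + k))
      identity = solve-∀
    admissible-sum : ∀ {n i} → Admissible n i → Even (+ (i ℕ.+ triangular n))
    admissible-sum E = E

  not-admissible : ∀ n i k → i ℕ.+ triangular n ≡ suc (2 ℕ.* k) → ¬ Admissible n i
  not-admissible n i k e E = odd-not-even k (subst (λ m → Even (+ m)) e (admissible-sum {n} {i} E))

  -- Recursive realization of spectra with one gap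

  Omitting : ℕ → Set
  Omitting n = ∀ i → 0 ℕ.< i → i ℕ.< n → Admissible n i → Σ (SimpleGraph n) (Omits i)

  -- For order `n = k + 3`, a gap at 1 comes from `omits-complement-K₂` and a gap from 2 to `n - 2`
  -- from `omits-cone-K₁`, both starting at order `n - 2`. A gap at `n - 1` comes from
  -- `omits-cone-K₂`, starting at order `n - 3`.
  omitting-step : ∀ k → Omitting k → Omitting (suc k) → Omitting (3 ℕ.+ k)
  omitting-step k rec₀ rec₁ 1 _ _ E = first k rec₁ E
    where
    first : ∀ k → Omitting (suc k) → Admissible (3 ℕ.+ k) 1 → Σ (SimpleGraph (3 ℕ.+ k)) (Omits 1)
    -- A graph omitting 2 has to have order at least three here; the smaller cases are excluded by
    -- parity, the sums being `1 + 6` and `1 + 10`.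
    first 0 rec E = ⊥-elim (not-admissible 3 1 3 refl E)
    first 1 rec E = ⊥-elim (not-admissible 4 1 5 refl E)
    first (suc (suc k)) rec E with rec 2 (s≤s z≤n) (s≤s (s≤s (s≤s z≤n))) (admissible-first {suc (suc k)} E)
    ... | G , h = complement (K₂∪ G) , omits-complement-K₂ G h
  omitting-step k rec₀ rec₁ (suc (suc i)) _ i<n E with ℕ.m≤n⇒m<n∨m≡n (ℕ.≤-pred (ℕ.≤-pred (ℕ.≤-pred i<n)))
  ... | inj₁ i<k with rec₁ (suc i) (s≤s z≤n) (s≤s i<k) (admissible-middle {k} {suc i} E)
  ... | G , h = cone (K₁∪ G) , omits-cone-K₁ G h
  omitting-step k rec₀ rec₁ (suc (suc i)) _ i<n E | inj₂ refl = last k rec₀ E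
    where
    last : ∀ k → Omitting k → Admissible (3 ℕ.+ k) (2 ℕ.+ k) → Σ (SimpleGraph (3 ℕ.+ k)) (Omits (2 ℕ.+ k))
    -- The path on three vertices, with spectrum 0, 1, 3. In the next two cases the sums `3 + 10`
    -- and `4 + 15` are odd.
    last 0 rec E = cone (K₁∪ K₁∪ empty) , omits-cone-K₁ (K₁∪ empty) omits-K₁
    last 1 rec E = ⊥-elim (not-admissible 4 3 6 refl E)
    last 2 rec E = ⊥-elim (not-admissible 5 4 9 refl E)
    last (suc (suc (suc k))) rec E with rec 2 (s≤s z≤n) (s≤s (s≤s (s≤s z≤n))) (admissible-last {suc (suc k)} E)
    ... | G , h = cone (K₂∪ G) , omits-cone-K₂ G h

  omitting : ∀ n → Omitting n
  omitting 0 i 0<i () E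
  omitting 1 (suc i) 0<i (s≤s ()) E
  omitting 2 1 0<i i<n E = K₂∪ empty , omits-K₂
  omitting 2 (suc (suc i)) 0<i (s≤s (s≤s ())) E
  omitting (suc (suc (suc k))) = omitting-step k (omitting k) (omitting (suc k))

  -- The corresponding parity condition for {0, 1, 1, 2, …, n} \ {i, n - 1}.
  Balanced : ℕ → ℕ → Set
  Balanced n i = Even (+ i + + n + + triangular n)

  opaque
    unfolding _+_
    balanced-admissible : ∀ {k i} → Balanced (4 ℕ.+ k) (suc i) → Admissible (suc k) i
    balanced-admissible {k} {i} E = even-shift E (- (+ 7 + + k + + k)) (identity (+ i) (+ k) (+ triangular k))
      where
      identity : ∀ i k t → i + (+ 1 + k + t) ≡ + 1 + i + (+ 4 + k) + (+ 4 + k + (+ 3 + k + (+ 2 + k + (+ 1 + k + t)))) + (- (+ 7 + k + k) + - (+ 7 + k + k))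
      identity = solve-∀
    balanced-admissible-last : ∀ {k} → Balanced (5 ℕ.+ k) (3 ℕ.+ k) → Admissible (suc k) 2
    balanced-admissible-last {k} E = even-shift E (- (+ 10 + + k + + k + + k)) (identity (+ k) (+ triangular k))
      where
      identity : ∀ k t → + 2 + (+ 1 + k + t) ≡ + 3 + k + (+ 5 + k) + (+ 5 + k + (+ 4 + k + (+ 3 + k + (+ 2 + k + (+ 1 + k + t))))) + (- (+ 10 + k + k + k) + - (+ 10 + k + k + k))
      identity = solve-∀
    balanced-sum : ∀ {n i} → Balanced n i → Even (+ (i ℕ.+ n ℕ.+ triangular n))
    balanced-sum E = E
    -- The sum grows by `4 + (4n + 10) = 2 (2n + 7)`. Triangular numbers have parity of period four,
    -- which is the origin of the residues modulo 4.
    balanced-period : ∀ n i → Balanced n i ⇔ Balanced (4 ℕ.+ n) i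
    balanced-period n i = mk⇔
      (λ E → even-shift E (+ 7 + + n + + n) (up (+ i) (+ n) (+ triangular n)))
      (λ E → even-shift E (- (+ 7 + + n + + n)) (down (+ i) (+ n) (+ triangular n)))
      where
      up : ∀ i n t → i + (+ 4 + n) + (+ 4 + n + (+ 3 + n + (+ 2 + n + (+ 1 + n + t)))) ≡ i + n + t + (+ 7 + n + n + (+ 7 + n + n))
      up = solve-∀
      down : ∀ i n t → i + n + t ≡ i + (+ 4 + n) + (+ 4 + n + (+ 3 + n + (+ 2 + n + (+ 1 + n + t)))) + (- (+ 7 + n + n) + - (+ 7 + n + n))
      down = solve-∀
    -- The order plus its triangular number is 0, 2, 5, 9 for the four residues. The last two are
    -- odd and require an odd number, written as a successor.
    balanced-residues : ∀ i → (Balanced 0 i ⇔ Even (+ i)) × (Balanced 1 i ⇔ Even (+ i)) × (Balanced 2 (suc i) ⇔ Even (+ i)) × (Balanced 3 (suc i) ⇔ Even (+ i))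
    balanced-residues i =
        mk⇔ (λ E → even-shift E (+ 0) (a⁻ (+ i))) (λ E → even-shift E (+ 0) (a (+ i)))
      , mk⇔ (λ E → even-shift E (- (+ 1)) (b⁻ (+ i))) (λ E → even-shift E (+ 1) (b (+ i)))
      , mk⇔ (λ E → even-shift E (- (+ 3)) (c⁻ (+ i))) (λ E → even-shift E (+ 3) (c (+ i)))
      , mk⇔ (λ E → even-shift E (- (+ 5)) (d⁻ (+ i))) (λ E → even-shift E (+ 5) (d (+ i)))
      where
      a : ∀ i → i + + 0 + + 0 ≡ i + (+ 0 + + 0)
      a = solve-∀
      a⁻ : ∀ i → i ≡ i + + 0 + + 0 + (+ 0 + + 0)
      a⁻ = solve-∀
      b : ∀ i → i + + 1 + + 1 ≡ i + (+ 1 + + 1)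
      b = solve-∀
      b⁻ : ∀ i → i ≡ i + + 1 + + 1 + (- (+ 1) + - (+ 1))
      b⁻ = solve-∀
      c : ∀ i → + 1 + i + + 2 + + 3 ≡ i + (+ 3 + + 3)
      c = solve-∀
      c⁻ : ∀ i → i ≡ + 1 + i + + 2 + + 3 + (- (+ 3) + - (+ 3))
      c⁻ = solve-∀
      d : ∀ i → + 1 + i + + 3 + + 6 ≡ i + (+ 5 + + 5)
      d = solve-∀
      d⁻ : ∀ i → i ≡ + 1 + i + + 3 + + 6 + (- (+ 5) + - (+ 5))
      d⁻ = solve-∀
    -- The premise compares sums of roots, `e + e` being the trace; adding `i + (n - 1)` to both
    -- sides makes the left one a double.
    balanced-from-trace : ∀ n i e → 0 ℕ.< n → + i + (+ (n ℕ.∸ 1) + (e + e)) ≡ + 1 + + triangular n → Balanced n i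
    balanced-from-trace (suc j) i e _ p = + i + + j + e , trans (shift (+ i) (+ j) (+ triangular (suc j))) (trans (cong (λ z → z + (+ i + + j)) (sym p)) (regroup (+ i) (+ j) e))
      where
      shift : ∀ i j t → i + (+ 1 + j) + t ≡ + 1 + t + (i + j)
      shift = solve-∀
      regroup : ∀ i j e → i + (j + (e + e)) + (i + j) ≡ i + j + e + (i + j + e)
      regroup = solve-∀

  -- Necessity and sufficiency of the parity condition

  -- If `j` were not `n - 1`, the product `(x - i)(x - j)` would be nonzero at 1, `n - 1` and `n`,
  -- so these three would be eigenvalues, as `no-realization` forbids.
  last-removed : ∀ n {i j} (G : SimpleGraph n) → 3 ℕ.≤ n → i ℕ.< j → j ℕ.< n → i ≢ 1 → j ≢ 1 → OmitsDoubling i j G → j ≡ n ℕ.∸ 1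
  last-removed 1 G (s≤s ())
  last-removed 2 G (s≤s (s≤s ()))
  last-removed n@(suc (suc (suc k))) {i} {j} G 3≤n i<j j<n i≢1 j≢1 relation with j ℕ.≟ suc (suc k)
  ... | yes e = e
  ... | no j≢n-1 = ⊥-elim (no-realization k G (smooth-* (smooth-root (+ i)) (smooth-root (+ j)))
            (nonzero 1 i≢1 j≢1)
            (nonzero (suc (suc k)) (ℕ.<⇒≢ (ℕ.<-≤-trans i<j (ℕ.≤-pred j<n))) j≢n-1)
            (nonzero n (ℕ.<⇒≢ (ℕ.<-trans i<j j<n)) (ℕ.<⇒≢ j<n))
            relation)
    where
    opaque
      unfolding _+_
      difference : ∀ a b → + a - + b ≡ + 0 → a ≡ b
      difference a b e = ℤ.+-injective (ℤ.i-j≡0⇒i≡j (+ a) (+ b) e)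
    nonzero : ∀ a → i ≢ a → j ≢ a → (+ a - + i) * (+ a - + j) ≢ + 0
    nonzero a i≢a j≢a e with *-zero-product (+ a - + i) (+ a - + j) e
    ... | inj₁ z = i≢a (sym (difference a i z))
    ... | inj₂ z = j≢a (sym (difference a j z))

  necessary : ∀ n i j → 6 ℕ.≤ n → 0 ℕ.< i → i ℕ.< j → j ℕ.< n → i ≢ 1 → j ≢ 1 →
    LaplacianRealizable (Sset n 1 i j) → j ≡ n ℕ.∸ 1 × Balanced n i
  necessary n i j 6≤n 0<i i<j j<n i≢1 j≢1 (N , G , _ , spectrum) =
    -- The order `N` of the realizing graph is arbitrary; equality of degrees, `N + 2 = n + 2`,
    -- identifies it with `n`, and equality of second coefficients is the trace formula.
    conclude G relation (monic-unique
      (monic-resp (λ x → trans (sym (*-assoc _ _ _)) (relation x)) (monic-root (+ i) (monic-root (+ j) (proj₂ (monic-χ G)))))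
      (monic-root (+ 1) (monic-falling n)))
    where
    relation : ∀ x → (x - + i) * (x - + j) * χ G x ≡ (x - + 1) * falling n x
    relation = spectrum⇒omits (ℕ.<⇒≤ (ℕ.<-trans i<j j<n)) (ℕ.<⇒≤ j<n) (ℕ.<⇒≢ i<j) G spectrum
    conclude : ∀ {N e} (G : SimpleGraph N) → (∀ x → (x - + i) * (x - + j) * χ G x ≡ (x - + 1) * falling n x) →
      suc (suc N) ≡ suc (suc n) × + i + (+ j + (e + e)) ≡ + 1 + + triangular n → j ≡ n ℕ.∸ 1 × Balanced n i
    conclude {e = e} G relation (refl , trace) = last , balanced-from-trace n i e (ℕ.≤-trans (s≤s z≤n) 6≤n)
        (subst (λ j → + i + (+ j + (e + e)) ≡ + 1 + + triangular n) last trace)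
      where
      last : j ≡ n ℕ.∸ 1
      last = last-removed n G (ℕ.≤-trans (s≤s (s≤s (s≤s z≤n))) 6≤n) i<j j<n i≢1 j≢1 relation

  Realization : ℕ → ℕ → ℕ → Set
  Realization n i j = Σ (SimpleGraph n) λ G → Connected G × OmitsDoubling i j G

  sufficient : ∀ n i → 6 ℕ.≤ n → 1 ℕ.< i → suc i ℕ.< n → Balanced n i → Realization n i (n ℕ.∸ 1)
  sufficient (suc (suc (suc (suc (suc (suc k)))))) (suc i) (s≤s (s≤s (s≤s (s≤s (s≤s (s≤s _)))))) (s≤s 0<i) (s≤s (s≤s (s≤s i≤3+k))) E =
    by-position k E (ℕ.m≤n⇒m<n∨m≡n i≤3+k)
    where
    by-position : ∀ k → Balanced (6 ℕ.+ k) (suc i) → i ℕ.< 3 ℕ.+ k ⊎ i ≡ 3 ℕ.+ k → Realization (6 ℕ.+ k) (suc i) (5 ℕ.+ k)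
    by-position k E (inj₁ i<3+k) with omitting (3 ℕ.+ k) i 0<i i<3+k (balanced-admissible {suc (suc k)} {i} E)
    ... | G , h = cone (K₁∪ K₁∪ G) , cone-connected (K₁∪ K₁∪ G) , omits-doubling-K₁ G h
    -- Removing 4 and 5 at order 6 would start from a graph of order two; parity excludes it, as
    -- `4 + 6 + 21 = 31`.
    by-position zero E (inj₂ refl) = ⊥-elim (odd-not-even 15 (balanced-sum {6} {4} E))
    by-position (suc k) E (inj₂ refl) with omitting (3 ℕ.+ k) 2 (s≤s z≤n) (s≤s (s≤s (s≤s z≤n))) (balanced-admissible-last {suc (suc k)} E)
    ... | G , h = cone (K₁∪ K₂∪ G) , cone-connected (K₁∪ K₂∪ G) , omits-doubling-K₂ G h

  -- Residues modulo 4

  ParityCondition : ℕ → ℕ → Set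
  ParityCondition n i =
    (n ℕ.% 4 ≡ 0 × ∃[ k ] (1 ℕ.≤ k × k ℕ.≤ (n ℕ.∸ 2) ℕ./ 2 × i ≡ 2 ℕ.* k))
    ⊎ (n ℕ.% 4 ≡ 1 × ∃[ k ] (1 ℕ.≤ k × k ℕ.≤ (n ℕ.∸ 3) ℕ./ 2 × i ≡ 2 ℕ.* k))
    ⊎ (n ℕ.% 4 ≡ 2 × ∃[ k ] (1 ℕ.≤ k × k ℕ.≤ (n ℕ.∸ 4) ℕ./ 2 × i ≡ 2 ℕ.* k ℕ.+ 1))
    ⊎ (n ℕ.% 4 ≡ 3 × ∃[ k ] (1 ℕ.≤ k × k ℕ.≤ (n ℕ.∸ 3) ℕ./ 2 × i ≡ 2 ℕ.* k ℕ.+ 1))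

  ≤-half : ∀ {k} m → 2 ℕ.* k ℕ.≤ m → k ℕ.≤ m ℕ./ 2
  ≤-half {k} m le = subst (ℕ._≤ m ℕ./ 2) (ℕ.m*n/n≡m k 2) (ℕ./-monoˡ-≤ 2 (subst (ℕ._≤ m) (ℕ.*-comm 2 k) le))

  balanced-residue : ∀ q r i → Balanced (q ℕ.* 4 ℕ.+ r) i ⇔ Balanced r i
  balanced-residue zero r i = mk⇔ (λ E → E) (λ E → E)
  balanced-residue (suc q) r i = mk⇔
    (λ E → to (balanced-residue q r i) (from (balanced-period (q ℕ.* 4 ℕ.+ r) i) E))
    (λ E → to (balanced-period (q ℕ.* 4 ℕ.+ r) i) (from (balanced-residue q r i) E))

  by-residue : ∀ {n r} → n ℕ.% 4 ≡ r → n ≡ n ℕ./ 4 ℕ.* 4 ℕ.+ r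
  by-residue {n} e = trans (ℕ.m≡m%n+[m/n]*n n 4) (trans (ℕ.+-comm (n ℕ.% 4) _) (cong (n ℕ./ 4 ℕ.* 4 ℕ.+_) e))

  balanced⇔ : ∀ {n r} i → n ℕ.% 4 ≡ r → Balanced n i ⇔ Balanced r i
  balanced⇔ {n} {r} i e = mk⇔
    (λ E → to (balanced-residue (n ℕ./ 4) r i) (subst (λ n → Balanced n i) (by-residue e) E))
    (λ E → subst (λ n → Balanced n i) (sym (by-residue e)) (from (balanced-residue (n ℕ./ 4) r i) E))

  -- For `n = m + 4` the order of the roots gives only `i ≤ n - 2`. Here `n - 2` is odd and `i`
  -- even, which sharpens the bound to the required `n - 3`.
  2k≢n-2 : ∀ {m} k → (4 ℕ.+ m) ℕ.% 4 ≡ 1 → 2 ℕ.* k ≢ 2 ℕ.+ m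
  2k≢n-2 {m} k e p = ℕ.even≢odd (suc k) ((4 ℕ.+ m) ℕ./ 4 ℕ.* 2)
    (trans (double k) (trans (cong (2 ℕ.+_) p) (trans (by-residue {4 ℕ.+ m} e) (quadruple ((4 ℕ.+ m) ℕ./ 4)))))
    where
    double : ∀ k → 2 ℕ.* suc k ≡ 2 ℕ.+ 2 ℕ.* k
    double = ℕ-solve-∀
    quadruple : ∀ q → q ℕ.* 4 ℕ.+ 1 ≡ suc (2 ℕ.* (q ℕ.* 2))
    quadruple = ℕ-solve-∀

  -- The same sharpening for `i = 2k + 1`: the bound `2k ≤ n - 3` has an odd right-hand side and
  -- becomes `2k ≤ n - 4`.
  2k≢n-3 : ∀ {m} k → (4 ℕ.+ m) ℕ.% 4 ≡ 2 → 2 ℕ.* k ≢ 1 ℕ.+ m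
  2k≢n-3 {m} k e p = ℕ.even≢odd ((4 ℕ.+ m) ℕ./ 4 ℕ.* 2 ℕ.+ 1) (suc k)
    (sym (trans (double k) (trans (cong (3 ℕ.+_) p) (trans (by-residue {4 ℕ.+ m} e) (quadruple ((4 ℕ.+ m) ℕ./ 4))))))
    where
    double : ∀ k → suc (2 ℕ.* suc k) ≡ 3 ℕ.+ 2 ℕ.* k
    double = ℕ-solve-∀
    quadruple : ∀ q → q ℕ.* 4 ℕ.+ 2 ≡ 2 ℕ.* (q ℕ.* 2 ℕ.+ 1)
    quadruple = ℕ-solve-∀

  positive : ∀ {i k} → 0 ℕ.< i → i ≡ 2 ℕ.* k → 1 ℕ.≤ k
  positive {k = zero} () refl
  positive {k = suc k} _ _ = s≤s z≤n

  condition : ∀ n i → 4 ℕ.≤ n → 1 ℕ.< i → suc i ℕ.< n → Balanced n i → ParityCondition n i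
  condition n@(suc (suc (suc (suc m)))) (suc i) (s≤s (s≤s (s≤s (s≤s _)))) (s≤s 0<i) (s≤s (s≤s (s≤s i≤1+m))) E =
    cases (n ℕ.% 4) refl (ℕ.m%n<n n 4)
    where
    reduced : ∀ {r} → n ℕ.% 4 ≡ r → Balanced r (suc i)
    reduced e = to (balanced⇔ {n} (suc i) e) E
    cases : ∀ r → n ℕ.% 4 ≡ r → r ℕ.< 4 → ParityCondition n (suc i)
    cases 0 e _ with even⇒double (to (proj₁ (balanced-residues (suc i))) (reduced e))
    ... | k , p = inj₁ (e , k , positive (s≤s z≤n) p , ≤-half (2 ℕ.+ m) (subst (ℕ._≤ 2 ℕ.+ m) p (s≤s i≤1+m)) , p)
    cases 1 e _ with even⇒double (to (proj₁ (proj₂ (balanced-residues (suc i)))) (reduced e))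
    ... | k , p = inj₂ (inj₁ (e , k , positive (s≤s z≤n) p
        , ≤-half (1 ℕ.+ m) (ℕ.≤-pred (ℕ.≤∧≢⇒< (subst (ℕ._≤ 2 ℕ.+ m) p (s≤s i≤1+m)) (2k≢n-2 k e))) , p))
    cases 2 e _ with even⇒double (to (proj₁ (proj₂ (proj₂ (balanced-residues i)))) (reduced e))
    ... | k , p = inj₂ (inj₂ (inj₁ (e , k , positive 0<i p
        , ≤-half m (ℕ.≤-pred (ℕ.≤∧≢⇒< (subst (ℕ._≤ 1 ℕ.+ m) p i≤1+m) (2k≢n-3 k e))) , trans (cong suc p) (ℕ.+-comm 1 _))))
    cases 3 e _ with even⇒double (to (proj₂ (proj₂ (proj₂ (balanced-residues i)))) (reduced e))
    ... | k , p = inj₂ (inj₂ (inj₂ (e , k , positive 0<i p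
        , ≤-half (1 ℕ.+ m) (subst (ℕ._≤ 1 ℕ.+ m) p i≤1+m) , trans (cong suc p) (ℕ.+-comm 1 _))))
    cases (suc (suc (suc (suc _)))) e (s≤s (s≤s (s≤s (s≤s ()))))

  condition⁻ : ∀ n i → ParityCondition n i → Balanced n i
  condition⁻ n i (inj₁ (e , k , _ , _ , refl)) = from (balanced⇔ i e) (from (proj₁ (balanced-residues i)) (double⇒even k))
  condition⁻ n i (inj₂ (inj₁ (e , k , _ , _ , refl))) = from (balanced⇔ i e) (from (proj₁ (proj₂ (balanced-residues i))) (double⇒even k))
  condition⁻ n i (inj₂ (inj₂ (inj₁ (e , k , _ , _ , p)))) with trans p (ℕ.+-comm _ 1)
  ... | refl = from (balanced⇔ i e) (from (proj₁ (proj₂ (proj₂ (balanced-residues (2 ℕ.* k))))) (double⇒even k))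
  condition⁻ n i (inj₂ (inj₂ (inj₂ (e , k , _ , _ , p)))) with trans p (ℕ.+-comm _ 1)
  ... | refl = from (balanced⇔ i e) (from (proj₂ (proj₂ (proj₂ (balanced-residues (2 ℕ.* k))))) (double⇒even k))

  characterisation : ∀ n i j → 6 ℕ.≤ n → 0 ℕ.< i → i ℕ.< j → j ℕ.< n → i ≢ 1 → j ≢ 1 →
    LaplacianRealizable (Sset n 1 i j) ⇔ (j ≡ n ℕ.∸ 1 × ParityCondition n i)
  characterisation n i j 6≤n 0<i i<j j<n i≢1 j≢1 = mk⇔ forward backward
    where
    1<i : 1 ℕ.< i
    1<i = ℕ.≤∧≢⇒< 0<i (i≢1 ∘ sym)
    1+i<n : suc i ℕ.< n
    1+i<n = ℕ.≤-<-trans i<j j<n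
    4≤n : 4 ℕ.≤ n
    4≤n = ℕ.≤-trans (s≤s (s≤s (s≤s (s≤s z≤n)))) 6≤n
    forward : LaplacianRealizable (Sset n 1 i j) → j ≡ n ℕ.∸ 1 × ParityCondition n i
    forward real = let e , E = necessary n i j 6≤n 0<i i<j j<n i≢1 j≢1 real in e , condition n i 4≤n 1<i 1+i<n E
    realize : Realization n i j → LaplacianRealizable (Sset n 1 i j)
    realize (G , connected , h) = n , G , connected , omits⇒spectrum {n} {i} {j} (ℕ.<⇒≤ (ℕ.<-trans i<j j<n)) (ℕ.<⇒≤ j<n) (ℕ.<⇒≢ i<j) G h
    backward : j ≡ n ℕ.∸ 1 × ParityCondition n i → LaplacianRealizable (Sset n 1 i j)
    backward (e , c) = realize (subst (Realization n i) (sym e) (sufficient n i 6≤n 1<i 1+i<n (condition⁻ n i c)))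

open import Data.Nat using (ℕ; _≤_; _<_; _*_; _+_; _∸_; _/_; _%_)

theorem3p2 : (n i j : ℕ) → 6 ≤ n → 0 < i → i < j → j < n → i ≢ 1 → j ≢ 1 →
    (LaplacianRealizable (Sset n 1 i j) ⇔
    (j ≡ n ∸ 1 ×
    ((n % 4 ≡ 0 × ∃[ k ] (1 ≤ k × k ≤ (n ∸ 2) / 2 × i ≡ 2 * k))
    ⊎ (n % 4 ≡ 1 × ∃[ k ] (1 ≤ k × k ≤ (n ∸ 3) / 2 × i ≡ 2 * k))
    ⊎ (n % 4 ≡ 2 × ∃[ k ] (1 ≤ k × k ≤ (n ∸ 4) / 2 × i ≡ 2 * k + 1))
    ⊎ (n % 4 ≡ 3 × ∃[ k ] (1 ≤ k × k ≤ (n ∸ 3) / 2 × i ≡ 2 * k + 1)))))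
theorem3p2 = LaplacianSpectra.characterisation
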